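{- Let $m\ge 3$ be an odd integer and let $A\subseteq\{2,3,4,\dots\}$ be a set of odd integers such that for any $p,q\in A$ with $p,q\ge m$, neither $p+q+1$ nor $p+q-1$ belongs to $A$. For any integer $n>3$, every graph $G\in\mathcal{G}(A)$ with $\alpha_l(G)<n$ satisfies $\operatorname{def}(G)\le m(n-3)(n-2)^{\frac{m-3}{2}}+1$. Furthermore, when $m=3$, every such $G$ satisfies $\operatorname{def}(G)\le 2n-5$.
   Context: All graphs are finite and simple. The deficiency $\operatorname{def}(G)$ of a graph $G$ is the number of vertices not saturated by a maximum matching of $G$. The local independence number $\alpha_l(G)$ is the largest integer $t$ such that $G$ contains an induced subgraph isomorphic to the star $K_{1,t}$. For $i\ge 2$, $P_i$ denotes the path with $i$ vertices, and the bone $B_i$ is the tree obtained from $P_i$ by attaching two pendent edges (edges to new degree-one vertices) to each of the two end vertices of $P_i$. For a set $A\subseteq\{2,3,4,\dots\}$, $\mathcal{G}(A)$ denotes the family of connected graphs $G$ such that every induced subgraph of $G$ isomorphic to some bone $B_i$ has $i\in A$. -}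

module Defs where

open import Data.Nat using (ℕ; zero; suc; _+_; _*_; _∸_; _≤_; _<_)
open import Data.Nat.Properties using (_≟_) renaming (_<?_ to _<ℕ?_)
open import Data.Bool using (Bool; true; false; _∧_; _∨_)
open import Data.Fin using (Fin; toℕ)
import Data.Fin.Properties as FinP
open import Data.List using (List; []; _∷_; length; filter; concatMap)
open import Data.List.Base using (allFin)
open import Data.List.Relation.Unary.All using (All)
open import Data.List.Relation.Unary.Unique.Propositional using (Unique)
open import Data.Product using (Σ; ∃; _×_; _,_)
open import Function.Definitions using (Injective)
open import Relation.Binary.PropositionalEquality using (_≡_)
open import Relation.Nullary using (¬_)
open import Relation.Nullary.Decidable using (⌊_⌋; ¬?)

Odd : ℕ → Set
Odd p = ∃ λ k → p ≡ suc (2 * k)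

record Graph (N : ℕ) : Set where
  field
    adj    : Fin N → Fin N → Bool
    sym    : ∀ u v → adj u v ≡ adj v u
    irrefl : ∀ v → adj v v ≡ false
open Graph public

data Reachable {N : ℕ} (G : Graph N) : Fin N → Fin N → Set where
  here : ∀ {u} → Reachable G u u
  step : ∀ {u w v} → adj G u w ≡ true → Reachable G w v → Reachable G u v

Connected : ∀ {N} → Graph N → Set
Connected {N} G = ∀ (u v : Fin N) → Reachable G u v

InducedCopy : ∀ {k N} → (Fin k → Fin k → Bool) → Graph N → Set
InducedCopy {k} {N} H G =
  Σ (Fin k → Fin N) λ f →
    Injective _≡_ _≡_ f × (∀ i j → adj G (f i) (f j) ≡ H i j)

starAdj : (t : ℕ) → Fin (suc t) → Fin (suc t) → Bool
starAdj t a b = (⌊ toℕ a ≟ 0 ⌋ ∨ ⌊ toℕ b ≟ 0 ⌋) ∧ (Data.Bool.not ⌊ toℕ a ≟ toℕ b ⌋)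
  where import Data.Bool

-- adjacency of the bone B_i on vertices 0 .. i+3 (as naturals):
-- path 0 - 1 - ... - (i-1); leaves i, i+1 attached to 0;
-- leaves i+2, i+3 attached to i-1.
boneAdjℕ : ℕ → ℕ → ℕ → Bool
boneAdjℕ i a b =
     (⌊ a <ℕ? i ⌋ ∧ ⌊ b <ℕ? i ⌋ ∧ (⌊ suc a ≟ b ⌋ ∨ ⌊ suc b ≟ a ⌋))
  ∨ (⌊ a ≟ 0 ⌋ ∧ (⌊ b ≟ i ⌋ ∨ ⌊ b ≟ suc i ⌋))
  ∨ (⌊ b ≟ 0 ⌋ ∧ (⌊ a ≟ i ⌋ ∨ ⌊ a ≟ suc i ⌋))
  ∨ (⌊ a ≟ i ∸ 1 ⌋ ∧ (⌊ b ≟ i + 2 ⌋ ∨ ⌊ b ≟ i + 3 ⌋))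
  ∨ (⌊ b ≟ i ∸ 1 ⌋ ∧ (⌊ a ≟ i + 2 ⌋ ∨ ⌊ a ≟ i + 3 ⌋))

boneAdj : (i : ℕ) → Fin (i + 4) → Fin (i + 4) → Bool
boneAdj i a b = boneAdjℕ i (toℕ a) (toℕ b)

LocalIndepLessThan : ∀ {N} → Graph N → ℕ → Set
LocalIndepLessThan G n = ∀ t → n ≤ t → ¬ InducedCopy (starAdj t) G

InFamily : ∀ {N} → (ℕ → Set) → Graph N → Set
InFamily A G = Connected G × (∀ i → 2 ≤ i → InducedCopy (boneAdj i) G → A i)

endpoints : ∀ {N} → List (Fin N × Fin N) → List (Fin N)
endpoints = concatMap (λ { (u , v) → u ∷ v ∷ [] })

IsMatching : ∀ {N} → Graph N → List (Fin N × Fin N) → Set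
IsMatching G M = All (λ { (u , v) → adj G u v ≡ true }) M × Unique (endpoints M)

IsMaxMatching : ∀ {N} → Graph N → List (Fin N × Fin N) → Set
IsMaxMatching G M =
  IsMatching G M × (∀ M' → IsMatching G M' → length M' ≤ length M)

unsaturated : ∀ {N} → List (Fin N × Fin N) → ℕ
unsaturated {N} M = length (filter (λ v → ¬? (Data.List.Membership.DecPropositional._∈?_ FinP._≟_ v (endpoints M))) (allFin N))
  where import Data.List.Membership.DecPropositional

DefAtMost : ∀ {N} → Graph N → ℕ → Set
DefAtMost {N} G d = ∀ M → IsMaxMatching G M → unsaturated M ≤ d

{-# OPTIONS --safe #-}
-- Work with distances from a vertex that has two pendant neighbours; such a vertex appears as soon as
-- removing matched pairs from the last layer of a breadth-first search gets stuck. The two pendants turn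
-- every vertex with two independent neighbours in the next layer into the end of a bone to the root, so
-- the neighbours of an odd-layer vertex in the next layer form a clique.
--
-- Peeling the layers from the bottom either matches a pair or removes a star whose at least two leaves (Λ)
-- see only its centre (St), in an even layer; the unmatched vertices number at most #Λ ∸ #St. From the
-- bottom up one then keeps a set B of even-layer vertices that sees the leaves and the chosen parents of
-- the vertices kept below, discarding vertices without a parent of their own or two leaves of their own.
-- From each kept vertex a limb, that is an induced descending path ending in two leaves, hangs down; limbs
-- from different vertices of one layer do not touch, for otherwise they would close up to an even bone.
-- Hence B is a forest, each vertex of B accounts for at most n ∸ 3 units of the deficiency, and only heavy
-- vertices for any at all. The condition on A bounds the limbs below a heavy vertex that is far from the
-- root, and allows at most one long limb among the children of each vertex; counting the heavy vertices
-- of such a forest gives the bound.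
module Submission where

open import Defs renaming (sym to adj-sym; irrefl to adj-irrefl)
open import Data.Bool using (Bool; true; false; _∧_; _∨_; not; if_then_else_)
import Data.Bool.Properties as Boolₚ
open import Data.Empty using (⊥; ⊥-elim)
open import Data.Fin using (Fin; zero; suc; toℕ)
import Data.Fin.Properties as Finₚ
open import Data.List using (List; []; _∷_; length; filter)
open import Data.List.Relation.Unary.All as All using (All; []; _∷_)
open import Data.List.Relation.Unary.Any using (here; there)
open import Data.List.Relation.Unary.AllPairs using ([]; _∷_)
open import Data.List.Relation.Unary.Unique.Propositional using (Unique)
open import Data.List.Membership.Propositional using (_∈_)
import Data.List.Membership.DecPropositional as DecMembership
open import Data.Nat using (ℕ; zero; suc; pred; _+_; _*_; _∸_; _^_; _≤_; _<_; z≤n; s≤s; s≤s⁻¹; _⊓_)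
open import Data.Nat.DivMod using (_/_; m*n/n≡m)
open import Data.Nat.Induction using (<-wellFounded)
open import Data.Nat.Properties
open import Induction.WellFounded using (Acc; acc)
open import Data.Nat.Solver using (module +-*-Solver)
open import Data.Product using (Σ; ∃; ∃-syntax; _×_; _,_; proj₁; proj₂)
open import Data.Sum using (_⊎_; inj₁; inj₂; [_,_]′)
open import Data.Unit using (⊤; tt)
open import Function using (_∘_; id; case_of_)
open import Relation.Binary.PropositionalEquality using (_≡_; _≢_; refl; sym; trans; cong; cong₂; subst; subst₂; module ≡-Reasoning)
open import Relation.Nullary using (¬_; Dec; yes; no; does; contradiction)
open import Relation.Nullary.Decidable using (_×-dec_; _⊎-dec_; _→-dec_; ¬?; ⌊_⌋; dec-true)
open import Relation.Unary using (Decidable)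
open import Algebra.Properties.CommutativeMonoid.Sum +-0-commutativeMonoid
  using (sum; ∑-distrib-+; ∑-comm; sum-cong-≗; sum-replicate-zero)

-- Counting

𝟙 : ∀ {P : Set} → Dec P → ℕ
𝟙 d = if does d then 1 else 0

𝟙-mono : ∀ {P Q : Set} (p : Dec P) (q : Dec Q) → (P → Q) → 𝟙 p ≤ 𝟙 q
𝟙-mono (yes p) (yes q) f = ≤-refl
𝟙-mono (yes p) (no ¬q) f = contradiction (f p) ¬q
𝟙-mono (no ¬p) q       f = z≤n

𝟙≤1 : ∀ {P : Set} (p : Dec P) → 𝟙 p ≤ 1
𝟙≤1 (yes _) = ≤-refl
𝟙≤1 (no _)  = z≤n

𝟙-yes : ∀ {P : Set} (p : Dec P) → P → 𝟙 p ≡ 1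
𝟙-yes (yes _) _ = refl
𝟙-yes (no ¬p) p = contradiction p ¬p

𝟙-no : ∀ {P : Set} (p : Dec P) → ¬ P → 𝟙 p ≡ 0
𝟙-no (yes p) ¬p = contradiction p ¬p
𝟙-no (no _)  _  = refl

sum-mono : ∀ {N} {f g : Fin N → ℕ} → (∀ i → f i ≤ g i) → sum f ≤ sum g
sum-mono {zero}  h = z≤n
sum-mono {suc N} h = +-mono-≤ (h zero) (sum-mono (h ∘ suc))

term≤sum : ∀ {N} (f : Fin N → ℕ) i → f i ≤ sum f
term≤sum f zero    = m≤m+n _ _
term≤sum f (suc i) = ≤-trans (term≤sum (f ∘ suc) i) (m≤n+m _ _)

# : ∀ {N} {P : Fin N → Set} → Decidable P → ℕ
# P? = sum (λ i → 𝟙 (P? i))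

module _ {N : ℕ} {P Q : Fin N → Set} (P? : Decidable P) (Q? : Decidable Q) where

  #-⊆ : (∀ i → P i → Q i) → # P? ≤ # Q?
  #-⊆ h = sum-mono (λ i → 𝟙-mono (P? i) (Q? i) (h i))

  #-∪ : ∀ {R : Fin N → Set} (R? : Decidable R) → (∀ i → R i → P i ⊎ Q i) → # R? ≤ # P? + # Q?
  #-∪ R? h = ≤-trans (sum-mono pointwise) (≤-reflexive (∑-distrib-+ (𝟙 ∘ P?) (𝟙 ∘ Q?)))
    where
    pointwise : ∀ i → 𝟙 (R? i) ≤ 𝟙 (P? i) + 𝟙 (Q? i)
    pointwise i with R? i
    ... | no _  = z≤n
    ... | yes r with h i r
    ... | inj₁ p = ≤-trans (≤-reflexive (sym (𝟙-yes (P? i) p))) (m≤m+n _ _)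
    ... | inj₂ q = ≤-trans (≤-reflexive (sym (𝟙-yes (Q? i) q))) (m≤n+m _ _)

  #-⊎ : ∀ {R : Fin N → Set} (R? : Decidable R) → (∀ i → P i → R i) → (∀ i → Q i → R i) →
        (∀ i → P i → ¬ Q i) → # P? + # Q? ≤ # R?
  #-⊎ R? p⇒r q⇒r p⇒¬q = ≤-trans (≤-reflexive (sym (∑-distrib-+ (𝟙 ∘ P?) (𝟙 ∘ Q?)))) (sum-mono pointwise)
    where
    pointwise : ∀ i → 𝟙 (P? i) + 𝟙 (Q? i) ≤ 𝟙 (R? i)
    pointwise i with P? i
    ... | no _  = 𝟙-mono (Q? i) (R? i) (q⇒r i)
    ... | yes p = ≤-reflexive (trans (cong (1 +_) (𝟙-no (Q? i) (p⇒¬q i p))) (sym (𝟙-yes (R? i) (p⇒r i p))))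

#-none : ∀ {N} {P : Fin N → Set} (P? : Decidable P) → (∀ i → ¬ P i) → # P? ≡ 0
#-none {N} P? h = trans (sum-cong-≗ (λ i → 𝟙-no (P? i) (h i))) (sum-replicate-zero N)

#-pos : ∀ {N} {P : Fin N → Set} (P? : Decidable P) {i} → P i → 1 ≤ # P?
#-pos P? {i} p = ≤-trans (≤-reflexive (sym (𝟙-yes (P? i) p))) (term≤sum _ i)

#≤1 : ∀ {N} {P : Fin N → Set} (P? : Decidable P) → (∀ i j → P i → P j → i ≡ j) → # P? ≤ 1
#≤1 {zero}  P? h = z≤n
#≤1 {suc N} P? h with P? zero
... | yes p = ≤-reflexive (cong suc (#-none (P? ∘ suc) (λ i q → case h zero (suc i) p q of λ ())))
... | no _  = #≤1 (P? ∘ suc) (λ i j p q → Finₚ.suc-injective (h (suc i) (suc j) p q))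

Two : ∀ {N} → (Fin N → Set) → Set
Two P = ∃[ i ] ∃[ j ] (i ≢ j × P i × P j)

two? : ∀ {N} {P : Fin N → Set} (P? : Decidable P) → Dec (Two P)
two? P? = Finₚ.any? λ i → Finₚ.any? λ j → ¬? (i Finₚ.≟ j) ×-dec (P? i ×-dec P? j)

¬Two⇒#≤1 : ∀ {N} {P : Fin N → Set} (P? : Decidable P) → ¬ Two P → # P? ≤ 1
¬Two⇒#≤1 P? ¬two = #≤1 P? unique
  where
  unique : ∀ i j → _ → _ → i ≡ j
  unique i j p q with i Finₚ.≟ j
  ... | yes i≡j = i≡j
  ... | no i≢j  = contradiction (i , j , i≢j , p , q) ¬two

#-Two : ∀ {N} {P : Fin N → Set} (P? : Decidable P) → 2 ≤ # P? → Two P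
#-Two P? 2≤# with two? P?
... | yes t = t
... | no ¬t = contradiction (≤-trans 2≤# (¬Two⇒#≤1 P? ¬t)) λ { (s≤s ()) }

#-cover : ∀ {N} {P : Fin N → Set} {Q : Fin N → Fin N → Set}
          (P? : Decidable P) (Q? : ∀ b → Decidable (Q b)) →
          (∀ i → P i → ∃[ b ] Q b i) → # P? ≤ sum (λ b → # (Q? b))
#-cover P? Q? h = ≤-trans (sum-mono pointwise) (≤-reflexive (∑-comm (λ i b → 𝟙 (Q? b i))))
  where
  pointwise : ∀ i → 𝟙 (P? i) ≤ sum (λ b → 𝟙 (Q? b i))
  pointwise i with P? i
  ... | no _  = z≤n
  ... | yes p with h i p
  ... | b , q = ≤-trans (≤-reflexive (sym (𝟙-yes (Q? b i) q))) (term≤sum (λ b → 𝟙 (Q? b i)) b)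

#-inj : ∀ {N} {P Q : Fin N → Set} (P? : Decidable P) (Q? : Decidable Q) (f : Fin N → Fin N) →
        (∀ i → P i → Q (f i)) → (∀ i j → P i → P j → f i ≡ f j → i ≡ j) → # P? ≤ # Q?
#-inj {N} {P} P? Q? f into inj = ≤-trans
  (#-cover P? F? (λ i p → f i , p , refl))
  (sum-mono fibre)
  where
  F : Fin N → Fin N → Set
  F b i = P i × f i ≡ b
  F? : ∀ b → Decidable (F b)
  F? b i = P? i ×-dec (f i Finₚ.≟ b)
  fibre : ∀ b → # (F? b) ≤ 𝟙 (Q? b)
  fibre b with Q? b
  ... | yes _ = #≤1 (F? b) (λ i j (p , e) (q , e′) → inj i j p q (trans e (sym e′)))
  ... | no ¬q = ≤-reflexive (#-none (F? b) (λ { i (p , refl) → ¬q (into i p) }))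

#-image : ∀ {N} {P Q : Fin N → Set} (P? : Decidable P) (Q? : Decidable Q) (f : Fin N → Fin N) →
          (∀ j → Q j → ∃[ i ] (P i × f i ≡ j)) → # Q? ≤ # P?
#-image {N} {P} P? Q? f onto = ≤-trans
  (#-cover Q? F? onto)
  (sum-mono (λ i → bound i (P? i)))
  where
  F : Fin N → Fin N → Set
  F i j = P i × f i ≡ j
  F? : ∀ i → Decidable (F i)
  F? i j = P? i ×-dec (f i Finₚ.≟ j)
  bound : ∀ i (d : Dec (P i)) → # (F? i) ≤ 𝟙 d
  bound i (yes _) = #≤1 (F? i) (λ j k (_ , e) (_ , e′) → trans (sym e) e′)
  bound i (no ¬p) = ≤-reflexive (#-none (F? i) (λ j (p , _) → ¬p p))

_∖_ : ∀ {N} {P : Fin N → Set} → Decidable P → (a : Fin N) → Decidable (λ i → P i × i ≢ a)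
(P? ∖ a) i = P? i ×-dec ¬? (i Finₚ.≟ a)

#-remove : ∀ {N} {P : Fin N → Set} (P? : Decidable P) {a} → P a → # P? ≡ suc (# (P? ∖ a))
#-remove {N} {P} P? {a} pa = ≤-antisym
  (≤-trans (#-∪ (Finₚ._≟ a) (P? ∖ a) P? split)
           (+-monoˡ-≤ _ (#≤1 (Finₚ._≟ a) (λ i j e e′ → trans e (sym e′)))))
  (≤-trans (+-monoˡ-≤ _ (#-pos (Finₚ._≟ a) {a} refl))
           (#-⊎ (Finₚ._≟ a) (P? ∖ a) P? (λ { i refl → pa }) (λ i → proj₁) (λ i i≡a (_ , i≢a) → i≢a i≡a)))
  where
  split : ∀ i → P i → i ≡ a ⊎ (P i × i ≢ a)
  split i p with i Finₚ.≟ a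
  ... | yes e = inj₁ e
  ... | no ¬e = inj₂ (p , ¬e)

enumerate : ∀ {N} {P : Fin N → Set} (P? : Decidable P) →
            Σ (Fin (# P?) → Fin N) λ f → (∀ i → P (f i)) × (∀ i j → f i ≡ f j → i ≡ j)
enumerate {zero}  P? = (λ ()) , (λ ()) , (λ ())
enumerate {suc N} {P} P? with P? zero | enumerate (P? ∘ suc)
... | no _  | f , Pf , inj = suc ∘ f , Pf , λ i j e → inj i j (Finₚ.suc-injective e)
... | yes p | f , Pf , inj = g , Pg , ginj
  where
  g : Fin (suc (# (P? ∘ suc))) → Fin (suc N)
  g zero    = zero
  g (suc i) = suc (f i)
  Pg : ∀ i → P (g i)
  Pg zero    = p
  Pg (suc i) = Pf i
  ginj : ∀ i j → g i ≡ g j → i ≡ j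
  ginj zero    zero    e = refl
  ginj (suc i) (suc j) e = cong suc (inj i j (Finₚ.suc-injective e))

-- Brooms and bones

true≢false : ∀ {b : Bool} → b ≡ true → b ≡ false → ⊥
true≢false refl ()

¬true⇒false : ∀ {b : Bool} → ¬ b ≡ true → b ≡ false
¬true⇒false {true}  h = ⊥-elim (h refl)
¬true⇒false {false} h = refl

bool-ext : ∀ {b c : Bool} → (b ≡ true → c ≡ true) → (c ≡ true → b ≡ true) → b ≡ c
bool-ext {true}          f g = sym (f refl)
bool-ext {false} {true}  f g = g refl
bool-ext {false} {false} f g = refl

∨-split : ∀ b {c : Bool} → b ∨ c ≡ true → b ≡ true ⊎ c ≡ true
∨-split true  e = inj₁ refl
∨-split false e = inj₂ e

∨-inl : ∀ {b c : Bool} → b ≡ true → b ∨ c ≡ true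
∨-inl refl = refl

∨-inr : ∀ b {c : Bool} → c ≡ true → b ∨ c ≡ true
∨-inr true  e = refl
∨-inr false e = e

∧-split : ∀ b {c : Bool} → b ∧ c ≡ true → b ≡ true × c ≡ true
∧-split true e = refl , e

⌊⌋-out : ∀ {P : Set} (d : Dec P) → ⌊ d ⌋ ≡ true → P
⌊⌋-out (yes p) _ = p

data BoneEdge (k : ℕ) : ℕ → ℕ → Set where
  path⁺  : ∀ {i} → suc i < k → BoneEdge k i (suc i)
  path⁻  : ∀ {i} → suc i < k → BoneEdge k (suc i) i
  near₀⁺ : BoneEdge k 0 (k + 0)
  near₁⁺ : BoneEdge k 0 (k + 1)
  near₀⁻ : BoneEdge k (k + 0) 0
  near₁⁻ : BoneEdge k (k + 1) 0
  far₀⁺  : ∀ {i} → suc i ≡ k → BoneEdge k i (k + 2)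
  far₁⁺  : ∀ {i} → suc i ≡ k → BoneEdge k i (k + 3)
  far₀⁻  : ∀ {i} → suc i ≡ k → BoneEdge k (k + 2) i
  far₁⁻  : ∀ {i} → suc i ≡ k → BoneEdge k (k + 3) i

k+1≡ : ∀ k → k + 1 ≡ suc k
k+1≡ k = +-comm k 1

pathAdj nearAdj farAdj : ℕ → ℕ → ℕ → Bool
pathAdj k a b = ⌊ a <? k ⌋ ∧ ⌊ b <? k ⌋ ∧ (⌊ suc a ≟ b ⌋ ∨ ⌊ suc b ≟ a ⌋)
nearAdj k a b = ⌊ a ≟ 0 ⌋ ∧ (⌊ b ≟ k ⌋ ∨ ⌊ b ≟ suc k ⌋)
farAdj  k a b = ⌊ a ≟ k ∸ 1 ⌋ ∧ (⌊ b ≟ k + 2 ⌋ ∨ ⌊ b ≟ k + 3 ⌋)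

flip-edge : ∀ {k a b} → BoneEdge k a b → BoneEdge k b a
flip-edge (path⁺ h) = path⁻ h
flip-edge (path⁻ h) = path⁺ h
flip-edge near₀⁺    = near₀⁻
flip-edge near₁⁺    = near₁⁻
flip-edge near₀⁻    = near₀⁺
flip-edge near₁⁻    = near₁⁺
flip-edge (far₀⁺ e) = far₀⁻ e
flip-edge (far₁⁺ e) = far₁⁻ e
flip-edge (far₀⁻ e) = far₀⁺ e
flip-edge (far₁⁻ e) = far₁⁺ e

module _ {k : ℕ} (1≤k : 1 ≤ k) where

  pathAdj⇒edge : ∀ a b → pathAdj k a b ≡ true → BoneEdge k a b
  pathAdj⇒edge a b e with ∧-split ⌊ a <? k ⌋ e
  ... | a<k , e₁ with ∧-split ⌊ b <? k ⌋ e₁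
  ...   | b<k , e₂ with ∨-split ⌊ suc a ≟ b ⌋ e₂
  ...     | inj₁ e₃ = subst (BoneEdge k a) (⌊⌋-out (suc a ≟ b) e₃)
                        (path⁺ (subst (_< k) (sym (⌊⌋-out (suc a ≟ b) e₃)) (⌊⌋-out (b <? k) b<k)))
  ...     | inj₂ e₃ = subst (λ a → BoneEdge k a b) (⌊⌋-out (suc b ≟ a) e₃)
                        (path⁻ (subst (_< k) (sym (⌊⌋-out (suc b ≟ a) e₃)) (⌊⌋-out (a <? k) a<k)))

  nearAdj⇒edge : ∀ a b → nearAdj k a b ≡ true → BoneEdge k a b
  nearAdj⇒edge a b e with ∧-split ⌊ a ≟ 0 ⌋ e
  ... | a≡0 , e₁ with ∨-split ⌊ b ≟ k ⌋ e₁
  ...   | inj₁ e₂ = subst₂ (BoneEdge k) (sym (⌊⌋-out (a ≟ 0) a≡0)) (trans (+-identityʳ k) (sym (⌊⌋-out (b ≟ k) e₂))) near₀⁺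
  ...   | inj₂ e₂ = subst₂ (BoneEdge k) (sym (⌊⌋-out (a ≟ 0) a≡0)) (trans (k+1≡ k) (sym (⌊⌋-out (b ≟ suc k) e₂))) near₁⁺

  farAdj⇒edge : ∀ a b → farAdj k a b ≡ true → BoneEdge k a b
  farAdj⇒edge a b e with ∧-split ⌊ a ≟ k ∸ 1 ⌋ e
  ... | a≡ , e₁ with trans (cong suc (⌊⌋-out (a ≟ k ∸ 1) a≡)) (m+[n∸m]≡n 1≤k) | ∨-split ⌊ b ≟ k + 2 ⌋ e₁
  ...   | 1+a≡k | inj₁ e₂ = subst (BoneEdge k a) (sym (⌊⌋-out (b ≟ k + 2) e₂)) (far₀⁺ 1+a≡k)
  ...   | 1+a≡k | inj₂ e₂ = subst (BoneEdge k a) (sym (⌊⌋-out (b ≟ k + 3) e₂)) (far₁⁺ 1+a≡k)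

  boneAdj-true⇒edge : ∀ a b → boneAdjℕ k a b ≡ true → BoneEdge k a b
  boneAdj-true⇒edge a b e with ∨-split (pathAdj k a b) e
  ... | inj₁ h = pathAdj⇒edge a b h
  ... | inj₂ e₁ with ∨-split (nearAdj k a b) e₁
  ... | inj₁ h = nearAdj⇒edge a b h
  ... | inj₂ e₂ with ∨-split (nearAdj k b a) e₂
  ... | inj₁ h = flip-edge (nearAdj⇒edge b a h)
  ... | inj₂ e₃ with ∨-split (farAdj k a b) e₃
  ... | inj₁ h = farAdj⇒edge a b h
  ... | inj₂ h = flip-edge (farAdj⇒edge b a h)

⌊⌋-in : ∀ {P : Set} (d : Dec P) → P → ⌊ d ⌋ ≡ true
⌊⌋-in (yes _) _ = refl
⌊⌋-in (no ¬p) p = contradiction p ¬p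

∧-in : ∀ {b c : Bool} → b ≡ true → c ≡ true → b ∧ c ≡ true
∧-in refl refl = refl

edge⇒boneAdj-true : ∀ {k a b} → BoneEdge k a b → boneAdjℕ k a b ≡ true
edge⇒boneAdj-true {k} (path⁺ {i} h) =
  ∨-inl (∧-in (⌊⌋-in (i <? k) (<⇒≤ h)) (∧-in (⌊⌋-in (suc i <? k) h) (∨-inl (⌊⌋-in (suc i ≟ suc i) refl))))
edge⇒boneAdj-true {k} (path⁻ {i} h) =
  ∨-inl (∧-in (⌊⌋-in (suc i <? k) h) (∧-in (⌊⌋-in (i <? k) (<⇒≤ h))
    (∨-inr ⌊ suc (suc i) ≟ i ⌋ (⌊⌋-in (suc i ≟ suc i) refl))))
edge⇒boneAdj-true {k} near₀⁺ =
  ∨-inr (pathAdj k 0 (k + 0)) (∨-inl (∨-inl (⌊⌋-in (k + 0 ≟ k) (+-identityʳ k))))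
edge⇒boneAdj-true {k} near₁⁺ =
  ∨-inr (pathAdj k 0 (k + 1)) (∨-inl (∨-inr ⌊ k + 1 ≟ k ⌋ (⌊⌋-in (k + 1 ≟ suc k) (k+1≡ k))))
edge⇒boneAdj-true {k} near₀⁻ =
  ∨-inr (pathAdj k (k + 0) 0) (∨-inr (nearAdj k (k + 0) 0)
    (∨-inl (∨-inl (⌊⌋-in (k + 0 ≟ k) (+-identityʳ k)))))
edge⇒boneAdj-true {k} near₁⁻ =
  ∨-inr (pathAdj k (k + 1) 0) (∨-inr (nearAdj k (k + 1) 0)
    (∨-inl (∨-inr ⌊ k + 1 ≟ k ⌋ (⌊⌋-in (k + 1 ≟ suc k) (k+1≡ k)))))
edge⇒boneAdj-true {k} (far₀⁺ {i} refl) =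
  ∨-inr (pathAdj k i (k + 2)) (∨-inr (nearAdj k i (k + 2)) (∨-inr (nearAdj k (k + 2) i) (∨-inl
    (∧-in (⌊⌋-in (i ≟ i) refl) (∨-inl (⌊⌋-in (k + 2 ≟ k + 2) refl))))))
edge⇒boneAdj-true {k} (far₁⁺ {i} refl) =
  ∨-inr (pathAdj k i (k + 3)) (∨-inr (nearAdj k i (k + 3)) (∨-inr (nearAdj k (k + 3) i) (∨-inl
    (∧-in (⌊⌋-in (i ≟ i) refl) (∨-inr ⌊ k + 3 ≟ k + 2 ⌋ (⌊⌋-in (k + 3 ≟ k + 3) refl))))))
edge⇒boneAdj-true {k} (far₀⁻ {i} refl) =
  ∨-inr (pathAdj k (k + 2) i) (∨-inr (nearAdj k (k + 2) i) (∨-inr (nearAdj k i (k + 2)) (∨-inr (farAdj k (k + 2) i)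
    (∧-in (⌊⌋-in (i ≟ i) refl) (∨-inl (⌊⌋-in (k + 2 ≟ k + 2) refl))))))
edge⇒boneAdj-true {k} (far₁⁻ {i} refl) =
  ∨-inr (pathAdj k (k + 3) i) (∨-inr (nearAdj k (k + 3) i) (∨-inr (nearAdj k i (k + 3)) (∨-inr (farAdj k (k + 3) i)
    (∧-in (⌊⌋-in (i ≟ i) refl) (∨-inr ⌊ k + 3 ≟ k + 2 ⌋ (⌊⌋-in (k + 3 ≟ k + 3) refl))))))

module Adjacency {N : ℕ} (G : Graph N) where

  infix 4 _~_ _≁_ _~?_

  _~_ : Fin N → Fin N → Set
  u ~ v = adj G u v ≡ true

  _≁_ : Fin N → Fin N → Set
  u ≁ v = adj G u v ≡ false

  _~?_ : ∀ u v → Dec (u ~ v)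
  u ~? v = adj G u v Boolₚ.≟ true

  ~-sym : ∀ {u v} → u ~ v → v ~ u
  ~-sym {u} {v} e = trans (adj-sym G v u) e

  ≁-sym : ∀ {u v} → u ≁ v → v ≁ u
  ≁-sym {u} {v} e = trans (adj-sym G v u) e

  ~⇒≢ : ∀ {u v} → u ~ v → u ≢ v
  ~⇒≢ {u} e refl = true≢false e (adj-irrefl G u)

  Far : Fin N → Fin N → Set
  Far u v = u ≢ v × u ≁ v

  Far-sym : ∀ {u v} → Far u v → Far v u
  Far-sym (u≢v , e) = u≢v ∘ sym , ≁-sym e

  -- The list contains all vertices but the head; the number counts the vertices of the handle.
  data Broom : Fin N → List (Fin N) → ℕ → Set where
    tip  : ∀ {v a b} → v ~ a → v ~ b → Far a b → Broom v (a ∷ b ∷ []) 1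
    grow : ∀ {u v ts k} → u ~ v → All (Far u) ts → Broom v ts k → Broom u (v ∷ ts) (suc k)

  record Bone (k : ℕ) : Set where
    constructor bone
    field
      {centre}     : Fin N
      {rest}       : List (Fin N)
      broom        : Broom centre rest k
      {leaf₀ leaf₁} : Fin N
      c~leaf₀      : centre ~ leaf₀
      c~leaf₁      : centre ~ leaf₁
      leaves       : Far leaf₀ leaf₁
      far₀         : All (Far leaf₀) rest
      far₁         : All (Far leaf₁) rest

  join : ∀ {v ts k w us l} → Broom v ts k → Broom w us l → v ~ w →
         All (λ x → All (Far x) (w ∷ us)) ts → All (Far v) us → Bone (k + l)
  join (tip va vb ab) β v~w (fa ∷ fb ∷ []) fv = bone (grow v~w fv β) va vb ab fa fb
  join {k = suc k} {l = l} (grow u~v fu β′) β u~w (fv ∷ fts) fu′ =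
    subst Bone (+-suc k l)
      (join β′ (grow u~w fu′ β) (~-sym u~v)
        (All.zipWith (λ { (u-x , x-us) → Far-sym u-x ∷ x-us }) (fu , fts)) fv)

  broom-length : ∀ {v ts k} → Broom v ts k → 1 ≤ k
  broom-length (tip _ _ _)  = s≤s z≤n
  broom-length (grow _ _ _) = s≤s z≤n

  private
    at : ∀ {v ts k} → Broom v ts k → ℕ → Fin N
    at {v} (tip _ _ _)  _       = v
    at {v} (grow _ _ β) zero    = v
    at     (grow _ _ β) (suc j) = at β j

    end : ∀ {v ts k} → Broom v ts k → Bool → Fin N
    end (tip {a = a} _ _ _) false = a
    end (tip {b = b} _ _ _) true  = b
    end (grow _ _ β)        x     = end β x

    at-zero : ∀ {v ts k} (β : Broom v ts k) → at β 0 ≡ v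
    at-zero (tip _ _ _)  = refl
    at-zero (grow _ _ β) = refl

    at-suc∈ : ∀ {v ts k} (β : Broom v ts k) {j} → suc j < k → at β (suc j) ∈ ts
    at-suc∈ (tip _ _ _)  (s≤s ())
    at-suc∈ (grow _ _ β) {zero}  _       = here (at-zero β)
    at-suc∈ (grow _ _ β) {suc j} (s≤s h) = there (at-suc∈ β h)

    end∈ : ∀ {v ts k} (β : Broom v ts k) x → end β x ∈ ts
    end∈ (tip _ _ _)  false = here refl
    end∈ (tip _ _ _)  true  = there (here refl)
    end∈ (grow _ _ β) x     = there (end∈ β x)

    at-far : ∀ {v ts k u} (β : Broom v ts k) → All (Far u) ts → ∀ {j} → suc j < k → Far u (at β (suc j))
    at-far β f h = All.lookup f (at-suc∈ β h)

    at-adj⇒ : ∀ {v ts k} (β : Broom v ts k) {i j} → i < k → j < k → at β i ~ at β j → suc i ≡ j ⊎ suc j ≡ i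
    at-adj⇒ (tip _ _ _)   {zero}  {zero}  _ _ e = contradiction refl (~⇒≢ e)
    at-adj⇒ (tip _ _ _)   {suc _}         (s≤s ())
    at-adj⇒ (tip _ _ _)   {_}     {suc _} _ (s≤s ())
    at-adj⇒ (grow _ _ β)  {zero}  {zero}  _ _ e = contradiction refl (~⇒≢ e)
    at-adj⇒ (grow _ _ β)  {zero}  {suc zero} _ _ e = inj₁ refl
    at-adj⇒ (grow _ fu β) {zero}  {suc (suc j)} _ (s≤s h) e = ⊥-elim (true≢false e (proj₂ (at-far β fu h)))
    at-adj⇒ (grow _ _ β)  {suc zero}    {zero} _ _ e = inj₂ refl
    at-adj⇒ (grow _ fu β) {suc (suc i)} {zero} (s≤s h) _ e = ⊥-elim (true≢false (~-sym e) (proj₂ (at-far β fu h)))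
    at-adj⇒ (grow _ _ β)  {suc i} {suc j} (s≤s h) (s≤s h′) e =
      [ inj₁ ∘ cong suc , inj₂ ∘ cong suc ]′ (at-adj⇒ β h h′ e)

    at-edge : ∀ {v ts k} (β : Broom v ts k) {i} → suc i < k → at β i ~ at β (suc i)
    at-edge (tip _ _ _)    (s≤s ())
    at-edge (grow u~v _ β) {zero}  _       = subst (_ ~_) (sym (at-zero β)) u~v
    at-edge (grow _ _ β)   {suc i} (s≤s h) = at-edge β h

    at-injective : ∀ {v ts k} (β : Broom v ts k) {i j} → i < k → j < k → at β i ≡ at β j → i ≡ j
    at-injective (tip _ _ _)   {zero}  {zero}  _ _ e = refl
    at-injective (tip _ _ _)   {suc _}         (s≤s ())
    at-injective (tip _ _ _)   {_}     {suc _} _ (s≤s ())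
    at-injective (grow _ _ β)  {zero}  {zero}  _ _ e = refl
    at-injective (grow u~v _ β) {zero} {suc zero} _ _ e = contradiction (trans e (at-zero β)) (~⇒≢ u~v)
    at-injective (grow _ fu β) {zero}  {suc (suc j)} _ (s≤s h) e = contradiction e (proj₁ (at-far β fu h))
    at-injective (grow u~v _ β) {suc zero} {zero} _ _ e = contradiction (trans (sym e) (at-zero β)) (~⇒≢ u~v)
    at-injective (grow _ fu β) {suc (suc i)} {zero} (s≤s h) _ e = contradiction (sym e) (proj₁ (at-far β fu h))
    at-injective (grow _ _ β)  {suc i} {suc j} (s≤s h) (s≤s h′) e = cong suc (at-injective β h h′ e)

    end-adj⇒ : ∀ {v ts k} (β : Broom v ts k) {i} x → i < k → at β i ~ end β x → suc i ≡ k
    end-adj⇒ (tip _ _ _)   {zero}  x _ e = refl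
    end-adj⇒ (tip _ _ _)   {suc _} x (s≤s ())
    end-adj⇒ (grow _ fu β) {zero}  x _ e = ⊥-elim (true≢false e (proj₂ (All.lookup fu (end∈ β x))))
    end-adj⇒ (grow _ _ β)  {suc i} x (s≤s h) e = cong suc (end-adj⇒ β x h e)

    end-edge : ∀ {v ts k} (β : Broom v ts k) {i} x → suc i ≡ k → at β i ~ end β x
    end-edge (tip va vb _) {zero} false _ = va
    end-edge (tip va vb _) {zero} true  _ = vb
    end-edge (grow _ _ (tip _ _ _))  {zero} x ()
    end-edge (grow _ _ (grow _ _ _)) {zero} x ()
    end-edge (grow _ _ β)  {suc i} x e = end-edge β x (suc-injective e)

    end≢at : ∀ {v ts k} (β : Broom v ts k) {i} x → i < k → at β i ≢ end β x
    end≢at (tip va vb _)  false _ e = ~⇒≢ va e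
    end≢at (tip va vb _)  true  _ e = ~⇒≢ vb e
    end≢at (grow _ fu β) {zero}  x _ e = proj₁ (All.lookup fu (end∈ β x)) e
    end≢at (grow _ _ β)  {suc i} x (s≤s h) e = end≢at β x h e

    ends-far : ∀ {v ts k} (β : Broom v ts k) → Far (end β false) (end β true)
    ends-far (tip _ _ f)  = f
    ends-far (grow _ _ β) = ends-far β

  module _ {k} (B : Bone k) where
    open Bone B

    private
      leaf : ℕ → Fin N
      leaf 0 = leaf₀
      leaf 1 = leaf₁
      leaf 2 = end broom false
      leaf _ = end broom true

      place′ : ∀ n → Dec (n < k) → Fin N
      place′ n (yes _) = at broom n
      place′ n (no _)  = leaf (n ∸ k)

      place : ℕ → Fin N
      place n = place′ n (n <? k)

      data View : ℕ → Set where
        onPath : ∀ {n} → n < k → View n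
        onLeaf : ∀ {j} → j < 4 → View (k + j)

      view : ∀ n → n < k + 4 → View n
      view n h with n <? k
      ... | yes n<k = onPath n<k
      ... | no n≮k with m≤n⇒∃[o]m+o≡n (≮⇒≥ n≮k)
      ...   | j , refl = onLeaf (+-cancelˡ-< k j 4 h)

      place-path : ∀ {n} → n < k → place n ≡ at broom n
      place-path {n} n<k with n <? k
      ... | yes _   = refl
      ... | no n≮k = contradiction n<k n≮k

      place-leaf : ∀ j → place (k + j) ≡ leaf j
      place-leaf j with k + j <? k
      ... | yes h = contradiction h (m+n≮m k j)
      ... | no _  = cong leaf (m+n∸m≡n k j)

      end-far : ∀ x → Far leaf₀ (end broom x) × Far leaf₁ (end broom x)
      end-far x = All.lookup far₀ (end∈ broom x) , All.lookup far₁ (end∈ broom x)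

      leaf-far : ∀ {i j} → i < 4 → j < 4 → i ≢ j → Far (leaf i) (leaf j)
      leaf-far {0} {0} _ _ e = contradiction refl e
      leaf-far {0} {1} _ _ e = leaves
      leaf-far {0} {2} _ _ e = proj₁ (end-far false)
      leaf-far {0} {3} _ _ e = proj₁ (end-far true)
      leaf-far {1} {0} _ _ e = Far-sym leaves
      leaf-far {1} {1} _ _ e = contradiction refl e
      leaf-far {1} {2} _ _ e = proj₂ (end-far false)
      leaf-far {1} {3} _ _ e = proj₂ (end-far true)
      leaf-far {2} {0} _ _ e = Far-sym (proj₁ (end-far false))
      leaf-far {2} {1} _ _ e = Far-sym (proj₂ (end-far false))
      leaf-far {2} {2} _ _ e = contradiction refl e
      leaf-far {2} {3} _ _ e = ends-far broom
      leaf-far {3} {0} _ _ e = Far-sym (proj₁ (end-far true))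
      leaf-far {3} {1} _ _ e = Far-sym (proj₂ (end-far true))
      leaf-far {3} {2} _ _ e = Far-sym (ends-far broom)
      leaf-far {3} {3} _ _ e = contradiction refl e
      leaf-far {suc (suc (suc (suc _)))} (s≤s (s≤s (s≤s (s≤s ()))))
      leaf-far {_} {suc (suc (suc (suc _)))} _ (s≤s (s≤s (s≤s (s≤s ()))))

      near-far : ∀ {l} → All (Far l) rest → centre ~ l → ∀ {i} → i < k → at broom i ~ l → i ≡ 0
      near-far f c~l {zero}  h e = refl
      near-far f c~l {suc i} h e = ⊥-elim (true≢false (~-sym e) (proj₂ (at-far broom f h)))

      path-leaf-edge : ∀ {i j} → i < k → j < 4 → at broom i ~ leaf j → BoneEdge k i (k + j)
      path-leaf-edge {i} {0} h _ e = subst (λ i → BoneEdge k i _) (sym (near-far far₀ c~leaf₀ h e)) near₀⁺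
      path-leaf-edge {i} {1} h _ e = subst (λ i → BoneEdge k i _) (sym (near-far far₁ c~leaf₁ h e)) near₁⁺
      path-leaf-edge {i} {2} h _ e = far₀⁺ (end-adj⇒ broom false h e)
      path-leaf-edge {i} {3} h _ e = far₁⁺ (end-adj⇒ broom true h e)
      path-leaf-edge {i} {suc (suc (suc (suc _)))} _ (s≤s (s≤s (s≤s (s≤s ()))))

      leaf≢at : ∀ {i j} → i < k → j < 4 → at broom i ≢ leaf j
      leaf≢at {i} {0} h _ e = ~⇒≢ c~leaf₀ (trans (sym (at-zero broom))
        (subst (λ i → at broom i ≡ leaf₀) (i≡0 i h e) e))
        where
        i≡0 : ∀ i → i < k → at broom i ≡ leaf₀ → i ≡ 0
        i≡0 zero    h e = refl
        i≡0 (suc i) h e = contradiction (sym e) (proj₁ (at-far broom far₀ h))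
      leaf≢at {i} {1} h _ e = ~⇒≢ c~leaf₁ (trans (sym (at-zero broom))
        (subst (λ i → at broom i ≡ leaf₁) (i≡0 i h e) e))
        where
        i≡0 : ∀ i → i < k → at broom i ≡ leaf₁ → i ≡ 0
        i≡0 zero    h e = refl
        i≡0 (suc i) h e = contradiction (sym e) (proj₁ (at-far broom far₁ h))
      leaf≢at {i} {2} h _ e = end≢at broom false h e
      leaf≢at {i} {3} h _ e = end≢at broom true h e
      leaf≢at {i} {suc (suc (suc (suc _)))} _ (s≤s (s≤s (s≤s (s≤s ()))))

      adj⇒edge : ∀ {a b} → View a → View b → place a ~ place b → BoneEdge k a b
      adj⇒edge (onPath h) (onPath h′) e
        with at-adj⇒ broom h h′ (subst₂ _~_ (place-path h) (place-path h′) e)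
      ... | inj₁ refl = path⁺ h′
      ... | inj₂ refl = path⁻ h
      adj⇒edge (onPath h) (onLeaf {j} l) e =
        path-leaf-edge h l (subst₂ _~_ (place-path h) (place-leaf j) e)
      adj⇒edge (onLeaf {j} l) (onPath h) e =
        flip-edge (path-leaf-edge h l (~-sym (subst₂ _~_ (place-leaf j) (place-path h) e)))
      adj⇒edge (onLeaf {i} l) (onLeaf {j} l′) e with i ≟ j
      ... | yes refl = contradiction refl (~⇒≢ e)
      ... | no i≢j = ⊥-elim (true≢false (subst₂ _~_ (place-leaf i) (place-leaf j) e) (proj₂ (leaf-far l l′ i≢j)))

      0<k : 0 < k
      0<k = broom-length broom

      edge⇒adj : ∀ {a b} → BoneEdge k a b → place a ~ place b
      edge⇒adj (path⁺ h) = subst₂ _~_ (sym (place-path (<⇒≤ h))) (sym (place-path h)) (at-edge broom h)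
      edge⇒adj (path⁻ h) = ~-sym (edge⇒adj (path⁺ h))
      edge⇒adj near₀⁺ = subst₂ _~_ (sym (trans (place-path 0<k) (at-zero broom))) (sym (place-leaf 0)) c~leaf₀
      edge⇒adj near₁⁺ = subst₂ _~_ (sym (trans (place-path 0<k) (at-zero broom))) (sym (place-leaf 1)) c~leaf₁
      edge⇒adj near₀⁻ = ~-sym (edge⇒adj near₀⁺)
      edge⇒adj near₁⁻ = ~-sym (edge⇒adj near₁⁺)
      edge⇒adj (far₀⁺ e) =
        subst₂ _~_ (sym (place-path (≤-reflexive e))) (sym (place-leaf 2)) (end-edge broom false e)
      edge⇒adj (far₁⁺ e) =
        subst₂ _~_ (sym (place-path (≤-reflexive e))) (sym (place-leaf 3)) (end-edge broom true e)
      edge⇒adj (far₀⁻ e) = ~-sym (edge⇒adj (far₀⁺ e))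
      edge⇒adj (far₁⁻ e) = ~-sym (edge⇒adj (far₁⁺ e))

      place-injective : ∀ {a b} → View a → View b → place a ≡ place b → a ≡ b
      place-injective (onPath h) (onPath h′) e =
        at-injective broom h h′ (subst₂ _≡_ (place-path h) (place-path h′) e)
      place-injective (onPath h) (onLeaf {j} l) e =
        contradiction (subst₂ _≡_ (place-path h) (place-leaf j) e) (leaf≢at h l)
      place-injective (onLeaf {j} l) (onPath h) e =
        contradiction (sym (subst₂ _≡_ (place-leaf j) (place-path h) e)) (leaf≢at h l)
      place-injective (onLeaf {i} l) (onLeaf {j} l′) e with i ≟ j
      ... | yes refl = refl
      ... | no i≢j = contradiction (subst₂ _≡_ (place-leaf i) (place-leaf j) e) (proj₁ (leaf-far l l′ i≢j))

    bone⇒copy : InducedCopy (boneAdj k) G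
    bone⇒copy = place ∘ toℕ
      , (λ {i} {j} e → Finₚ.toℕ-injective
           (place-injective (view _ (Finₚ.toℕ<n i)) (view _ (Finₚ.toℕ<n j)) e))
      , λ i j → bool-ext
          (λ e → edge⇒boneAdj-true (adj⇒edge (view _ (Finₚ.toℕ<n i)) (view _ (Finₚ.toℕ<n j)) e))
          (λ e → edge⇒adj (boneAdj-true⇒edge 0<k (toℕ i) (toℕ j) e))

  star : ∀ {Q : Fin N → Set} (Q? : Decidable Q) c → (∀ {i} → Q i → c ~ i) →
         (∀ {i j} → Q i → Q j → i ≢ j → i ≁ j) → InducedCopy (starAdj (# Q?)) G
  star {Q} Q? c c~ indep with enumerate Q?
  ... | f , Qf , f-inj = g , g-inj , g-adj
    where
    g : Fin (suc (# Q?)) → Fin N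
    g zero    = c
    g (suc i) = f i
    g-inj : ∀ {i j} → g i ≡ g j → i ≡ j
    g-inj {zero}  {zero}  e = refl
    g-inj {zero}  {suc j} e = contradiction e (~⇒≢ (c~ (Qf j)))
    g-inj {suc i} {zero}  e = contradiction (sym e) (~⇒≢ (c~ (Qf i)))
    g-inj {suc i} {suc j} e = cong suc (f-inj i j e)
    g-adj : ∀ i j → adj G (g i) (g j) ≡ starAdj (# Q?) i j
    g-adj zero    zero    = adj-irrefl G c
    g-adj zero    (suc j) = c~ (Qf j)
    g-adj (suc i) zero    = ~-sym (c~ (Qf i))
    g-adj (suc i) (suc j) with i Finₚ.≟ j
    ... | yes refl = adj-irrefl G (f i)
    ... | no i≢j   = indep (Qf i) (Qf j) (i≢j ∘ f-inj i j)

-- Parity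

odd : ℕ → Bool
odd zero    = false
odd (suc n) = not (odd n)

double : ℕ → ℕ
double zero    = zero
double (suc j) = suc (suc (double j))

odd-double : ∀ j → odd (double j) ≡ false
odd-double zero    = refl
odd-double (suc j) = trans (Boolₚ.not-involutive _) (odd-double j)

2*≡double : ∀ j → 2 * j ≡ double j
2*≡double zero    = refl
2*≡double (suc j) = cong suc (trans (+-suc j (j + 0)) (cong suc (2*≡double j)))

odd-+ : ∀ {a b} → odd a ≡ true → odd (a + b) ≡ not (odd b)
odd-+ {suc zero}    {b} e = refl
odd-+ {suc (suc a)} {b} e = trans (Boolₚ.not-involutive _) (odd-+ {a} {b} (trans (sym (Boolₚ.not-involutive _)) e))

even⇒double : ∀ k → odd k ≡ false → ∃[ j ] k ≡ double j
even⇒double zero          e = 0 , refl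
even⇒double (suc (suc k)) e with even⇒double k (trans (sym (Boolₚ.not-involutive _)) e)
... | j , refl = suc j , refl

-- Breadth-first layers

least : ∀ {P : ℕ → Set} → (∀ k → Dec (P k)) → ∀ k → P k → ∃[ l ] (P l × (∀ j → j < l → ¬ P j))
least P? k p with P? 0
... | yes p₀ = 0 , p₀ , λ _ ()
least P? zero    p | no ¬p₀ = contradiction p ¬p₀
least P? (suc k) p | no ¬p₀ with least (P? ∘ suc) k p
... | l , pl , min = suc l , pl , λ { zero _ → ¬p₀ ; (suc j) (s≤s j<l) → min j j<l }

argmax : ∀ {N} {R : Fin N → Set} (R? : Decidable R) (f : Fin N → ℕ) →
         (∀ i → ¬ R i) ⊎ ∃[ v ] (R v × (∀ w → R w → f w ≤ f v))
argmax {zero}  R? f = inj₁ λ ()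
argmax {suc N} R? f with R? zero | argmax (R? ∘ suc) (f ∘ suc)
... | no ¬r | inj₁ none = inj₁ λ { zero → ¬r ; (suc i) → none i }
... | no ¬r | inj₂ (v , r , max) = inj₂ (suc v , r , λ { zero r₀ → contradiction r₀ ¬r ; (suc w) → max w })
... | yes r | inj₁ none = inj₂ (zero , r , λ { zero _ → ≤-refl ; (suc w) rw → contradiction rw (none w) })
... | yes r | inj₂ (v , rv , max) with ≤-total (f zero) (f (suc v))
...   | inj₁ h = inj₂ (suc v , rv , λ { zero _ → h ; (suc w) → max w })
...   | inj₂ h = inj₂ (zero , r , λ { zero _ → ≤-refl ; (suc w) rw → ≤-trans (max w rw) h })

-- Isolated vertices may have any layer, so deleted vertices can stay in the graph as isolated ones.
record Layering {N : ℕ} (G : Graph N) (root : Fin N) : Set where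
  open Adjacency G
  field
    lay      : Fin N → ℕ
    lay-root : lay root ≡ 0
    lay-adj  : ∀ {u v} → u ~ v → lay v ≤ suc (lay u)
    parent   : ∀ {v k} → lay v ≡ suc k → ∃[ p ] (p ~ v × lay p ≡ k)
    lay-zero : ∀ {v w} → lay v ≡ 0 → v ~ w → v ≡ root

  far-lay : ∀ {u v} → suc (lay u) < lay v → Far u v
  far-lay {u} {v} h =
      (λ { refl → <-irrefl refl (<-trans (n<1+n _) h) })
    , ¬true⇒false (λ e → <-irrefl refl (<-≤-trans h (lay-adj e)))

  far-lay′ : ∀ {u v} → suc (lay v) < lay u → Far u v
  far-lay′ = Far-sym ∘ far-lay

module _ {N : ℕ} (G : Graph N) (root : Fin N) where
  open Adjacency G

  private
    W : ℕ → Fin N → Set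
    W zero    v = v ≡ root
    W (suc k) v = ∃[ w ] (W k w × w ~ v)

    W? : ∀ k v → Dec (W k v)
    W? zero    v = v Finₚ.≟ root
    W? (suc k) v = Finₚ.any? λ w → W? k w ×-dec (w ~? v)

    walk : ∀ {u v} k → W k u → Reachable G u v → ∃[ l ] W l v
    walk k w here       = k , w
    walk k w (step e r) = walk (suc k) (_ , w , e) r

    Isolated : Fin N → Set
    Isolated v = ∀ w → v ≁ w

    Dist : Fin N → ℕ → Set
    Dist v d = (W d v × (∀ j → j < d → ¬ W j v)) ⊎ (Isolated v × d ≡ 0)

    dist : ∀ {v} → Reachable G root v ⊎ Isolated v → ∃[ d ] Dist v d
    dist (inj₁ r) with walk 0 refl r
    ... | l , w with least (λ k → W? k _) l w
    ...   | d , wd , min = d , inj₁ (wd , min)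
    dist (inj₂ i) = 0 , inj₂ (i , refl)

  bfs : (∀ v → Reachable G root v ⊎ (∀ w → v ≁ w)) → Layering G root
  bfs reach = record
    { lay      = lay
    ; lay-root = lay-root
    ; lay-adj  = λ {u} {v} → lay-adj u v
    ; parent   = λ {v} {k} → parent v k
    ; lay-zero = λ {v} {w} → lay-zero v w
    }
    where
    lay : Fin N → ℕ
    lay v = proj₁ (dist (reach v))
    spec : ∀ v → Dist v (lay v)
    spec v = proj₂ (dist (reach v))
    lay≤ : ∀ {v k} → W k v → ∀ {w} → v ~ w → lay v ≤ k
    lay≤ {v} {k} wk e with spec v
    ... | inj₁ (_ , min) = ≮⇒≥ (λ h → min k h wk)
    ... | inj₂ (i , _)   = ⊥-elim (true≢false e (i _))
    lay-root : lay root ≡ 0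
    lay-root with spec root
    ... | inj₁ (_ , min) = n≤0⇒n≡0 (≮⇒≥ (λ h → min 0 h refl))
    ... | inj₂ (_ , e)   = e
    lay-adj : ∀ u v → u ~ v → lay v ≤ suc (lay u)
    lay-adj u v e with spec u
    ... | inj₁ (w , _) = lay≤ (u , w , e) (~-sym e)
    ... | inj₂ (i , _) = ⊥-elim (true≢false e (i v))
    parent : ∀ v k → lay v ≡ suc k → ∃[ p ] (p ~ v × lay p ≡ k)
    parent v k e with spec v
    ... | inj₂ (_ , e′) = case trans (sym e) e′ of λ ()
    ... | inj₁ (w , _) with lay v | e
    ...   | .(suc k) | refl with w
    ...     | p , wp , p~v = p , p~v , ≤-antisym (lay≤ wp p~v) (s≤s⁻¹ (subst (_≤ suc (lay p)) e (lay-adj p v p~v)))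
    lay-zero : ∀ v w → lay v ≡ 0 → v ~ w → v ≡ root
    lay-zero v w e v~w with spec v
    ... | inj₂ (i , _) = ⊥-elim (true≢false v~w (i w))
    ... | inj₁ (x , _) with lay v | e
    ...   | .0 | refl = x

-- Peeling off the last layer

module Peeling {N : ℕ} (G : Graph N) {root : Fin N} (L : Layering G root) where
  open Adjacency G
  open Layering L

  record Closed (R : Fin N → Set) : Set where
    field
      up   : ∀ {v k} → R v → lay v ≡ suc k → ∃[ p ] (R p × p ~ v × lay p ≡ k)
      base : ∀ {v} → R v → lay v ≡ 0 → v ≡ root
  open Closed

  record Star (R : Fin N → Set) (u : Fin N) (V : Fin N → Set) : Set where
    field
      u∈       : R u
      V⊆       : ∀ {v} → V v → R v
      V~       : ∀ {v} → V v → u ~ v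
      V-lay    : ∀ {v} → V v → lay v ≡ suc (lay u)
      pendant  : ∀ {v w} → V v → R w → v ~ w → w ≡ u
      two      : Two V

  data Peel (R : Fin N → Set) : Set₁ where
    trivial : (∀ v → R v → v ≡ root) → Peel R
    pair    : ∀ {a b} → R a → R b → a ~ b → Closed (λ x → R x × ¬ (x ≡ a ⊎ x ≡ b)) → Peel R
    leafy   : ∀ {u V} → Decidable V → Star R u V → Closed (λ x → R x × ¬ (x ≡ u ⊎ V x)) → Peel R

  module _ {R : Fin N → Set} (R? : Decidable R) (C : Closed R) where

    private
      module Last (h : ℕ) (top : ∀ w → R w → lay w ≤ suc h)
                  (indep : ∀ {a b} → R a → R b → lay a ≡ suc h → lay b ≡ suc h → a ≁ b)
                  {v u} (Rv : R v) (lay-v : lay v ≡ suc h)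
                  (Ru : R u) (u~v : u ~ v) (lay-u : lay u ≡ h) where

        V : Fin N → Set
        V w = R w × (u ~ w × (lay w ≡ suc h × (∀ p → R p × (p ~ w × lay p ≡ h) → p ≡ u)))

        V? : Decidable V
        V? w = R? w ×-dec ((u ~? w) ×-dec ((lay w ≟ suc h) ×-dec
                 Finₚ.all? (λ p → (R? p ×-dec ((p ~? w) ×-dec (lay p ≟ h))) →-dec (p Finₚ.≟ u))))

        closed : ∀ {D : Fin N → Set} → (∀ x → D x → x ≡ u ⊎ lay x ≡ suc h) → (∀ x → V x → D x) →
                 Closed (λ x → R x × ¬ D x)
        base (closed D⊆ V⊆D) (Rx , _) e = base C Rx e
        up (closed {D} D⊆ V⊆D) {x} {k} (Rx , ¬Dx) e with k ≟ h
        ... | no k≢h with up C Rx e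
        ...   | p , Rp , p~x , lay-p = p , (Rp , ¬Dp) , p~x , lay-p
          where
          ¬Dp : ¬ D p
          ¬Dp Dp with D⊆ p Dp
          ... | inj₁ refl = k≢h (trans (sym lay-p) lay-u)
          ... | inj₂ e′ = <-irrefl refl (≤-trans (≤-reflexive (cong suc (trans (sym e′) lay-p)))
                            (≤-trans (≤-reflexive (sym e)) (top x Rx)))
        up (closed {D} D⊆ V⊆D) {x} {k} (Rx , ¬Dx) e | yes refl
          with Finₚ.any? (λ p → (R? p ×-dec ((p ~? x) ×-dec (lay p ≟ h))) ×-dec ¬? (p Finₚ.≟ u))
        ... | yes (p , (Rp , p~x , lay-p) , p≢u) = p , (Rp , ¬Dp) , p~x , lay-p
          where
          ¬Dp : ¬ D p
          ¬Dp Dp with D⊆ p Dp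
          ... | inj₁ e′ = p≢u e′
          ... | inj₂ e′ = 1+n≢n (trans (sym e′) lay-p)
        ... | no none = contradiction (V⊆D x (Rx , u~x , e , only-u)) ¬Dx
          where
          only-u : ∀ p → R p × (p ~ x × lay p ≡ h) → p ≡ u
          only-u p q with p Finₚ.≟ u
          ... | yes p≡u = p≡u
          ... | no p≢u = contradiction (p , q , p≢u) none
          u~x : u ~ x
          u~x with up C Rx e
          ... | p , Rp , p~x , lay-p = subst (_~ x) (only-u p (Rp , p~x , lay-p)) p~x

        peel-last : Peel R
        peel-last with two? V?
        ... | yes two = leafy V? record
            { u∈ = Ru ; V⊆ = proj₁ ; V~ = proj₁ ∘ proj₂
            ; V-lay = λ (_ , _ , e , _) → trans e (cong suc (sym lay-u))
            ; pendant = pendant ; two = two }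
            (closed (λ { x (inj₁ e) → inj₁ e ; x (inj₂ (_ , _ , e , _)) → inj₂ e }) (λ x → inj₂))
          where
          pendant : ∀ {v w} → V v → R w → v ~ w → w ≡ u
          pendant {v} {w} (Rv , _ , e , only) Rw v~w with lay w ≟ suc h
          ... | yes e′ = ⊥-elim (true≢false v~w (indep Rv Rw e e′))
          ... | no ne  = only w (Rw , ~-sym v~w , ≤-antisym
                  (s≤s⁻¹ (≤∧≢⇒< (top w Rw) ne))
                  (s≤s⁻¹ (≤-trans (≤-reflexive (sym e)) (lay-adj (~-sym v~w)))))
        ... | no ¬two with Finₚ.any? V?
        ...   | yes (w , Vw) = pair Ru (proj₁ Vw) (proj₁ (proj₂ Vw))
            (closed (λ { x (inj₁ e) → inj₁ e ; x (inj₂ refl) → inj₂ (proj₁ (proj₂ (proj₂ Vw))) }) only)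
          where
          only : ∀ x → V x → x ≡ u ⊎ x ≡ w
          only x Vx with x Finₚ.≟ w
          ... | yes e = inj₂ e
          ... | no ne = contradiction (x , w , ne , Vx , Vw) ¬two
        ...   | no none = pair Ru Rv u~v
            (closed (λ { x (inj₁ e) → inj₁ e ; x (inj₂ refl) → inj₂ lay-v })
                    (λ x Vx → contradiction (x , Vx) none))

    peel : Peel R
    peel with argmax R? lay
    ... | inj₁ none = trivial (λ v Rv → contradiction Rv (none v))
    ... | inj₂ (v , Rv , max) with lay v in lay-v
    ...   | zero = trivial (λ w Rw → base C Rw (n≤0⇒n≡0 (max w Rw)))
    ...   | suc h with Finₚ.any? (λ a → Finₚ.any? (λ b →
                       (R? a ×-dec (lay a ≟ suc h)) ×-dec ((R? b ×-dec (lay b ≟ suc h)) ×-dec (a ~? b))))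
    ...     | yes (a , b , (Ra , la) , (Rb , lb) , a~b) = pair Ra Rb a~b record
              { base = λ (Rx , _) → base C Rx
              ; up   = λ {x} {k} (Rx , _) e → let p , Rp , p~x , lay-p = up C Rx e in
                  p , (Rp , [ (λ p≡a → low Rx e lay-p (trans (cong lay p≡a) la)) , (λ p≡b → low Rx e lay-p (trans (cong lay p≡b) lb)) ]′) , p~x , lay-p }
      where
      low : ∀ {x k p} → R x → lay x ≡ suc k → lay p ≡ k → lay p ≢ suc h
      low {x} Rx e lay-p e′ = <-irrefl refl (≤-trans (≤-reflexive (cong suc (trans (sym e′) lay-p)))
                            (≤-trans (≤-reflexive (sym e)) (max x Rx)))
    ...     | no none with up C Rv lay-v
    ...       | u , Ru , u~v , lay-u = Last.peel-last h max
                  (λ Ra Rb la lb → ¬true⇒false (λ a~b → none (_ , _ , (Ra , la) , (Rb , lb) , a~b)))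
                  Rv lay-v Ru u~v lay-u

-- Matchings

module Matching {N : ℕ} (G : Graph N) where
  open Adjacency G

  MatchedIn : (Fin N → Set) → List (Fin N × Fin N) → Set
  MatchedIn R M = IsMatching G M × All R (endpoints M)

  MatchesAllBut : ∀ {R : Fin N → Set} → Decidable R → ℕ → Set
  MatchesAllBut {R} R? d = ∃[ M ] (MatchedIn R M × # R? ≤ 2 * length M + d)

  matched-[] : ∀ {R} → MatchedIn R []
  matched-[] = ([] , []) , []

  matched-∷ : ∀ {R R′ : Fin N → Set} {a b M} → R a → R b → a ~ b → (∀ x → R′ x → R x × (x ≢ a × x ≢ b)) →
              MatchedIn R′ M → MatchedIn R ((a , b) ∷ M)
  matched-∷ Ra Rb a~b h ((adj , uniq) , r) =
      (a~b ∷ adj , (~⇒≢ a~b ∷ All.map (λ r → proj₁ (proj₂ (h _ r)) ∘ sym) r)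
                   ∷ (All.map (λ r → proj₂ (proj₂ (h _ r)) ∘ sym) r) ∷ uniq)
    , Ra ∷ Rb ∷ All.map (proj₁ ∘ h _) r

  length-endpoints : ∀ (M : List (Fin N × Fin N)) → length (endpoints M) ≡ 2 * length M
  length-endpoints []      = refl
  length-endpoints (_ ∷ M) = trans (cong (2 +_) (length-endpoints M)) (sym (*-suc 2 (length M)))

  private
    open DecMembership (Finₚ._≟_ {N}) using (_∈?_)

    length-unique : ∀ {xs : List (Fin N)} → Unique xs → length xs ≡ # (_∈? xs)
    length-unique {[]} [] = sym (#-none (_∈? []) (λ i ()))
    length-unique {x ∷ xs} (x∉ ∷ u) = ≤-antisym
      (≤-trans (≤-reflexive (cong suc (length-unique u)))
        (≤-trans (+-monoˡ-≤ _ (#-pos (Finₚ._≟ x) {x} refl))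
          (#-⊎ (Finₚ._≟ x) (_∈? xs) (_∈? (x ∷ xs)) (λ i → here) (λ i → there)
            (λ { i refl i∈ → All.lookup x∉ i∈ refl }))))
      (≤-trans (#-∪ (Finₚ._≟ x) (_∈? xs) (_∈? (x ∷ xs)) (λ { i (here e) → inj₁ e ; i (there h) → inj₂ h }))
        (+-mono-≤ (#≤1 (Finₚ._≟ x) (λ i j e e′ → trans e (sym e′))) (≤-reflexive (sym (length-unique u)))))

    length-filter-tabulate : ∀ {K} {P : Fin N → Set} (P? : Decidable P) (f : Fin K → Fin N) →
                             length (filter P? (Data.List.tabulate f)) ≡ # (P? ∘ f)
    length-filter-tabulate {zero}  P? f = refl
    length-filter-tabulate {suc K} P? f with P? (f zero)
    ... | yes _ = cong suc (length-filter-tabulate P? (f ∘ suc))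
    ... | no _  = length-filter-tabulate P? (f ∘ suc)

  unsaturated-matching : ∀ {M} → IsMatching G M → unsaturated M + 2 * length M ≤ N
  unsaturated-matching {M} (_ , u) = begin
    unsaturated M + 2 * length M
      ≡⟨ cong₂ _+_ (length-filter-tabulate (λ v → ¬? (v ∈? endpoints M)) id)
                   (trans (sym (length-endpoints M)) (length-unique u)) ⟩
    # (λ v → ¬? (v ∈? endpoints M)) + # (_∈? endpoints M)
      ≤⟨ #-⊎ (λ v → ¬? (v ∈? endpoints M)) (_∈? endpoints M) all? (λ _ _ → tt) (λ _ _ → tt) (λ _ ¬p p → ¬p p) ⟩
    # all?
      ≤⟨ size all? ⟩
    N ∎
    where
    open ≤-Reasoning
    all? : Decidable {A = Fin N} (λ _ → ⊤)
    all? _ = yes tt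
    size : ∀ {K} {P : Fin K → Set} (P? : Decidable P) → # P? ≤ K
    size {zero}  P? = z≤n
    size {suc K} P? = +-mono-≤ (𝟙≤1 (P? zero)) (size (P? ∘ suc))

  deficiency≤ : ∀ {M d} → IsMatching G M → N ≤ 2 * length M + d → DefAtMost G d
  deficiency≤ {M} {d} m h M* (m* , max) = +-cancelʳ-≤ (2 * length M*) (unsaturated M*) d (begin
    unsaturated M* + 2 * length M* ≤⟨ unsaturated-matching m* ⟩
    N                              ≤⟨ h ⟩
    2 * length M + d               ≤⟨ +-monoˡ-≤ d (*-monoʳ-≤ 2 (max M m)) ⟩
    2 * length M* + d              ≡⟨ +-comm _ d ⟩
    d + 2 * length M*              ∎)
    where open ≤-Reasoning

module Decompose {N : ℕ} (G : Graph N) {root : Fin N} (L : Layering G root) where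
  open Adjacency G
  open Layering L
  open Peeling G L
  open Matching G

  private
    pair-size : ∀ {R : Fin N → Set} (R? : Decidable R) (a b : Fin N) →
                # R? ≤ 2 + # (λ x → R? x ×-dec ¬? ((x Finₚ.≟ a) ⊎-dec (x Finₚ.≟ b)))
    pair-size {R} R? a b = ≤-trans (#-∪ ab? rest? R? split) (+-monoˡ-≤ (# rest?) two)
      where
      ab? : Decidable (λ x → x ≡ a ⊎ x ≡ b)
      ab? x = (x Finₚ.≟ a) ⊎-dec (x Finₚ.≟ b)
      rest? : Decidable (λ x → R x × ¬ (x ≡ a ⊎ x ≡ b))
      rest? x = R? x ×-dec ¬? (ab? x)
      split : ∀ x → R x → (x ≡ a ⊎ x ≡ b) ⊎ (R x × ¬ (x ≡ a ⊎ x ≡ b))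
      split x r with ab? x
      ... | yes e = inj₁ e
      ... | no ne = inj₂ (r , ne)
      single : ∀ c → # (Finₚ._≟ c) ≤ 1
      single c = #≤1 (Finₚ._≟ c) (λ i j e e′ → trans e (sym e′))
      two : # ab? ≤ 2
      two = ≤-trans (#-∪ (Finₚ._≟ a) (Finₚ._≟ b) ab? (λ x → id)) (+-mono-≤ (single a) (single b))

    smaller : ∀ {R : Fin N → Set} (R? : Decidable R) {D : Fin N → Set} (D? : Decidable D) {a} → R a → D a →
              # (λ x → R? x ×-dec ¬? (D? x)) < # R?
    smaller R? D? {a} Ra Da = ≤-trans
      (s≤s (#-⊆ (λ x → R? x ×-dec ¬? (D? x)) (R? ∖ a) (λ { x (Rx , ¬Dx) → Rx , λ { refl → ¬Dx Da } })))
      (≤-reflexive (sym (#-remove R? Ra)))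

    2+2* : ∀ l d → 2 + (2 * l + d) ≡ 2 * suc l + d
    2+2* l d = cong (_+ d) (sym (*-suc 2 l))

  match-pairs : ∀ {d} → 1 ≤ d →
    (∀ {R} (R? : Decidable R) → Closed R → ∀ {u V} → Star R u V → MatchesAllBut R? d) →
    ∀ {R} (R? : Decidable R) → Closed R → MatchesAllBut R? d
  match-pairs {d} 1≤d leafy-case {R} R? = go R? (<-wellFounded (# R?))
    where
    go : ∀ {R} (R? : Decidable R) → Acc _<_ (# R?) → Closed R → MatchesAllBut R? d
    go R? (acc rec) C with peel R? C
    ... | trivial t = [] , matched-[] , ≤-trans (#≤1 R? (λ i j p q → trans (t i p) (sym (t j q)))) 1≤d
    ... | leafy V? S _ = leafy-case R? C S
    ... | pair {a} {b} Ra Rb a~b C′ with go (λ x → R? x ×-dec ¬? ((x Finₚ.≟ a) ⊎-dec (x Finₚ.≟ b)))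
          (rec (smaller R? (λ x → (x Finₚ.≟ a) ⊎-dec (x Finₚ.≟ b)) Ra (inj₁ refl))) C′
    ...   | M , m , h = (a , b) ∷ M
          , matched-∷ Ra Rb a~b (λ x (Rx , ne) → Rx , ne ∘ inj₁ , ne ∘ inj₂) m
          , ≤-trans (pair-size R? a b) (≤-trans (+-monoʳ-≤ 2 h) (≤-reflexive (2+2* (length M) d)))

  -- Λ collects the leaves and St the centres of the stars met while peeling, and cen sends a leaf to its
  -- centre; extra counts the root when it is left over as a single vertex.
  record Decomposition {R : Fin N → Set} (R? : Decidable R) : Set₁ where
    field
      {M}       : List (Fin N × Fin N)
      matched   : MatchedIn R M
      {Λ St}    : Fin N → Set
      Λ?        : Decidable Λ
      St?       : Decidable St
      cen       : Fin N → Fin N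
      {extra}   : ℕ
      size      : # R? + # St? ≤ 2 * length M + (# Λ? + extra)
      extra≤    : extra ≡ 0 ⊎ (extra ≡ 1 × R root × ¬ St root)
      Λ⊆R       : ∀ {t} → Λ t → R t
      St⊆R      : ∀ {u} → St u → R u
      cen-St    : ∀ {t} → Λ t → St (cen t)
      cen~      : ∀ {t} → Λ t → cen t ~ t
      lay-cen   : ∀ {t} → Λ t → lay t ≡ suc (lay (cen t))
      St-even   : ∀ {u} → St u → odd (lay u) ≡ false
      partner   : ∀ {t} → Λ t → ∃[ t′ ] (Λ t′ × t′ ≢ t × cen t′ ≡ cen t)
      Λ-indep   : ∀ {s t} → Λ s → Λ t → s ≁ t

  module _ (centre-even : ∀ {u a b} → u ~ a → u ~ b → lay a ≡ suc (lay u) → lay b ≡ suc (lay u) →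
                          Far a b → odd (lay u) ≡ false) where
    open Decomposition

    private
      trivial-case : ∀ {R} (R? : Decidable R) → (∀ v → R v → v ≡ root) → Decomposition R?
      trivial-case {R} R? t = record
        { matched = matched-[]
        ; Λ = λ _ → ⊥ ; St = λ _ → ⊥ ; Λ? = none? ; St? = none? ; cen = id ; extra = 𝟙 (R? root)
        ; size = ≤-trans (≤-reflexive (trans (cong (# R? +_) none) (+-identityʳ _)))
                   (≤-trans (count (R? root)) (m≤n+m _ (# none?)))
        ; extra≤ = spec (R? root)
        ; Λ⊆R = λ () ; St⊆R = λ () ; cen-St = λ () ; cen~ = λ () ; lay-cen = λ () ; St-even = λ ()
        ; partner = λ () ; Λ-indep = λ () }
        where
        none? : Decidable (λ (_ : Fin N) → ⊥)
        none? _ = no id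
        none : # none? ≡ 0
        none = #-none none? (λ _ ())
        count : (d : Dec (R root)) → # R? ≤ 𝟙 d
        count (yes _) = #≤1 R? (λ i j p q → trans (t i p) (sym (t j q)))
        count (no ¬r) = ≤-reflexive (#-none R? (λ i r → ¬r (subst R (t i r) r)))
        spec : (d : Dec (R root)) → 𝟙 d ≡ 0 ⊎ (𝟙 d ≡ 1 × R root × ¬ ⊥)
        spec (yes r) = inj₂ (refl , r , id)
        spec (no _)  = inj₁ refl

      pair-case : ∀ {R} (R? : Decidable R) {a b} → R a → R b → a ~ b →
        Decomposition (λ x → R? x ×-dec ¬? ((x Finₚ.≟ a) ⊎-dec (x Finₚ.≟ b))) → Decomposition R?
      pair-case R? {a} {b} Ra Rb a~b D = record
        { matched = matched-∷ Ra Rb a~b (λ x (Rx , ne) → Rx , ne ∘ inj₁ , ne ∘ inj₂) (matched D)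
        ; Λ? = Λ? D ; St? = St? D ; cen = cen D
        ; size = ≤-trans (+-monoˡ-≤ _ (pair-size R? a b)) (≤-trans (s≤s (s≤s (size D)))
                   (≤-reflexive (2+2* (length (M D)) _)))
        ; extra≤ = [ inj₁ , (λ (e , (r , _) , s) → inj₂ (e , r , s)) ]′ (extra≤ D)
        ; Λ⊆R = proj₁ ∘ Λ⊆R D ; St⊆R = proj₁ ∘ St⊆R D ; cen-St = cen-St D ; cen~ = cen~ D
        ; lay-cen = lay-cen D ; St-even = St-even D ; partner = partner D ; Λ-indep = Λ-indep D }

      leafy-case : ∀ {R} (R? : Decidable R) {u V} (V? : Decidable V) → Star R u V →
        Decomposition (λ x → R? x ×-dec ¬? ((x Finₚ.≟ u) ⊎-dec V? x)) → Decomposition R?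
      leafy-case {R} R? {u} {V} V? S D = record
        { matched = matched-∷ (S.u∈) (S.V⊆ Vv) (S.V~ Vv)
            (λ x (Rx , ne) → Rx , ne ∘ inj₁ , λ { refl → ne (inj₂ Vv) }) (matched D)
        ; Λ = Λ′ ; St = St′ ; Λ? = Λ′? ; St? = St′? ; cen = cen′ ; extra = extra D
        ; size = size′
        ; extra≤ = [ inj₁ , (λ (e , (r , ne) , s) → inj₂ (e , r , [ ne ∘ inj₁ , s ]′)) ]′ (extra≤ D)
        ; Λ⊆R = [ S.V⊆ , proj₁ ∘ Λ⊆R D ]′
        ; St⊆R = [ (λ { refl → S.u∈ }) , proj₁ ∘ St⊆R D ]′
        ; cen-St = λ {t} → cen-St′ t ; cen~ = λ {t} → cen~′ t ; lay-cen = λ {t} → lay-cen′ t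
        ; St-even = [ (λ { refl → u-even }) , St-even D ]′
        ; partner = λ {t} → partner′ t
        ; Λ-indep = indep′ }
        where
        module S = Star S
        v₀ = proj₁ S.two
        v₁ = proj₁ (proj₂ S.two)
        Vv : V v₀
        Vv = proj₁ (proj₂ (proj₂ (proj₂ S.two)))
        Vv₁ : V v₁
        Vv₁ = proj₂ (proj₂ (proj₂ (proj₂ S.two)))
        Λ′ St′ : Fin N → Set
        Λ′ t = V t ⊎ Λ D t
        St′ x = x ≡ u ⊎ St D x
        Λ′? : Decidable Λ′
        Λ′? t = V? t ⊎-dec Λ? D t
        St′? : Decidable St′
        St′? x = (x Finₚ.≟ u) ⊎-dec St? D x
        ¬V : ∀ {t} → Λ D t → ¬ V t
        ¬V l v = proj₂ (Λ⊆R D l) (inj₂ v)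
        pick : ∀ t → Dec (V t) → Fin N
        pick t (yes _) = u
        pick t (no _)  = cen D t
        cen′ : Fin N → Fin N
        cen′ t = pick t (V? t)
        cen-V : ∀ {t} → V t → cen′ t ≡ u
        cen-V {t} v with V? t
        ... | yes _ = refl
        ... | no ¬v = contradiction v ¬v
        cen-Λ : ∀ {t} → Λ D t → cen′ t ≡ cen D t
        cen-Λ {t} l with V? t
        ... | yes v = contradiction v (¬V l)
        ... | no _  = refl
        cen-St′ : ∀ t → Λ′ t → St′ (cen′ t)
        cen-St′ t (inj₁ v) = inj₁ (cen-V v)
        cen-St′ t (inj₂ l) = inj₂ (subst (St D) (sym (cen-Λ l)) (cen-St D l))
        cen~′ : ∀ t → Λ′ t → cen′ t ~ t
        cen~′ t (inj₁ v) = subst (_~ t) (sym (cen-V v)) (S.V~ v)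
        cen~′ t (inj₂ l) = subst (_~ t) (sym (cen-Λ l)) (cen~ D l)
        lay-cen′ : ∀ t → Λ′ t → lay t ≡ suc (lay (cen′ t))
        lay-cen′ t (inj₁ v) = trans (S.V-lay v) (cong (suc ∘ lay) (sym (cen-V v)))
        lay-cen′ t (inj₂ l) = trans (lay-cen D l) (cong (suc ∘ lay) (sym (cen-Λ l)))
        V-indep : ∀ {s t} → V s → R t → t ≢ u → s ≁ t
        V-indep vs rt t≢u = ¬true⇒false (t≢u ∘ S.pendant vs rt)
        V≢u : ∀ {t} → V t → t ≢ u
        V≢u v = ~⇒≢ (S.V~ v) ∘ sym
        u-even : odd (lay u) ≡ false
        u-even = centre-even (S.V~ Vv) (S.V~ Vv₁) (S.V-lay Vv) (S.V-lay Vv₁)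
          (proj₁ (proj₂ (proj₂ S.two)) , V-indep Vv (S.V⊆ Vv₁) (V≢u Vv₁))
        partner′ : ∀ t → Λ′ t → ∃[ t′ ] (Λ′ t′ × t′ ≢ t × cen′ t′ ≡ cen′ t)
        partner′ t (inj₁ v) with t Finₚ.≟ v₀
        ... | yes refl = v₁ , inj₁ Vv₁ , proj₁ (proj₂ (proj₂ S.two)) ∘ sym , trans (cen-V Vv₁) (sym (cen-V v))
        ... | no ne    = v₀ , inj₁ Vv , ne ∘ sym , trans (cen-V Vv) (sym (cen-V v))
        partner′ t (inj₂ l) with partner D l
        ... | t′ , l′ , ne , e = t′ , inj₂ l′ , ne , trans (cen-Λ l′) (trans e (sym (cen-Λ l)))
        indep′ : ∀ {s t} → Λ′ s → Λ′ t → s ≁ t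
        indep′ (inj₁ v) (inj₁ v′) = V-indep v (S.V⊆ v′) (V≢u v′)
        indep′ (inj₁ v) (inj₂ l)  = V-indep v (proj₁ (Λ⊆R D l)) (proj₂ (Λ⊆R D l) ∘ inj₁)
        indep′ (inj₂ l) (inj₁ v)  = ≁-sym (V-indep v (proj₁ (Λ⊆R D l)) (proj₂ (Λ⊆R D l) ∘ inj₁))
        indep′ (inj₂ l) (inj₂ l′) = Λ-indep D l l′
        D? : Decidable (λ x → x ≡ u ⊎ V x)
        D? x = (x Finₚ.≟ u) ⊎-dec V? x
        rest? : Decidable (λ x → R x × ¬ (x ≡ u ⊎ V x))
        rest? x = R? x ×-dec ¬? (D? x)
        split : ∀ x → R x → (x ≡ u ⊎ V x) ⊎ (R x × ¬ (x ≡ u ⊎ V x))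
        split x r with D? x
        ... | yes d = inj₁ d
        ... | no nd = inj₂ (r , nd)
        single : # (Finₚ._≟ u) ≤ 1
        single = #≤1 (Finₚ._≟ u) (λ i j e e′ → trans e (sym e′))
        open ≤-Reasoning
        open +-*-Solver
        size′ : # R? + # St′? ≤ 2 * suc (length (M D)) + (# Λ′? + extra D)
        size′ = begin
          # R? + # St′?
            ≤⟨ +-mono-≤ (≤-trans (#-∪ D? rest? R? split) (+-monoˡ-≤ (# rest?)
                 (≤-trans (#-∪ (Finₚ._≟ u) V? D? (λ _ → id)) (+-monoˡ-≤ (# V?) single))))
                 (≤-trans (#-∪ (Finₚ._≟ u) (St? D) St′? (λ _ → id)) (+-monoˡ-≤ (# (St? D)) single)) ⟩
          ((1 + # V?) + # rest?) + (1 + # (St? D))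
            ≡⟨ solve 3 (λ v r s → ((con 1 :+ v) :+ r) :+ (con 1 :+ s) := (con 2 :+ v) :+ (r :+ s)) refl
                 (# V?) (# rest?) (# (St? D)) ⟩
          (2 + # V?) + (# rest? + # (St? D))
            ≤⟨ +-monoʳ-≤ (2 + # V?) (size D) ⟩
          (2 + # V?) + (2 * length (M D) + (# (Λ? D) + extra D))
            ≡⟨ solve 4 (λ v l a e → (con 2 :+ v) :+ (con 2 :* l :+ (a :+ e))
                                  := con 2 :* (con 1 :+ l) :+ ((v :+ a) :+ e)) refl
                 (# V?) (length (M D)) (# (Λ? D)) (extra D) ⟩
          2 * suc (length (M D)) + ((# V? + # (Λ? D)) + extra D)
            ≤⟨ +-monoʳ-≤ (2 * suc (length (M D))) (+-monoˡ-≤ (extra D)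
                 (#-⊎ V? (Λ? D) Λ′? (λ _ → inj₁) (λ _ → inj₂) (λ _ v l → ¬V l v))) ⟩
          2 * suc (length (M D)) + (# Λ′? + extra D) ∎

    decompose : ∀ {R} (R? : Decidable R) → Closed R → Decomposition R?
    decompose R? = go R? (<-wellFounded (# R?))
      where
      go : ∀ {R} (R? : Decidable R) → Acc _<_ (# R?) → Closed R → Decomposition R?
      go R? (acc rec) C with peel R? C
      ... | trivial t = trivial-case R? t
      ... | pair {a} {b} Ra Rb a~b C′ = pair-case R? Ra Rb a~b
            (go _ (rec (smaller R? (λ x → (x Finₚ.≟ a) ⊎-dec (x Finₚ.≟ b)) Ra (inj₁ refl))) C′)
      ... | leafy {u} V? S C′ = leafy-case R? V? S
            (go _ (rec (smaller R? (λ x → (x Finₚ.≟ u) ⊎-dec V? x) (Star.u∈ S) (inj₁ refl))) C′)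

-- Limbs

record Frame {N : ℕ} (G : Graph N) : Set₁ where
  open Adjacency G
  field
    {root}    : Fin N
    layering  : Layering G root
    v₁ v₂     : Fin N
    v₁≢v₂     : v₁ ≢ v₂
    root~v₁   : root ~ v₁
    root~v₂   : root ~ v₂
    pendant₁  : ∀ {w} → v₁ ~ w → w ≡ root
    pendant₂  : ∀ {w} → v₂ ~ w → w ≡ root
    Size      : ℕ → Set
    Size-odd  : ∀ {k} → Size k → odd k ≡ true
    Size-bone : ∀ {k} → 2 ≤ k → Bone k → Size k

module Rooted {N : ℕ} {G : Graph N} (F : Frame G) where
  open Adjacency G public
  open Frame F public
  open Layering layering public

  Sep : List (Fin N) → List (Fin N) → Set
  Sep xs ys = ∀ {x y} → x ∈ xs → y ∈ ys → Far x y

  no-even-bone : ∀ {k} → 2 ≤ k → odd k ≡ false → Bone k → ⊥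
  no-even-bone 2≤k e B = true≢false (Size-odd (Size-bone 2≤k B)) e

  lay≢ : ∀ {u v} → lay u < lay v → u ≢ v
  lay≢ h refl = <-irrefl refl h

  private
    lay-pendant : ∀ {v} → root ~ v → (∀ {w} → v ~ w → w ≡ root) → ∀ {z} → z ≢ root → Far z v ⊎ z ≡ v
    lay-pendant {v} root~v p {z} z≢r with z Finₚ.≟ v
    ... | yes e = inj₂ e
    ... | no ne = inj₁ (ne , ¬true⇒false (λ z~v → z≢r (p (~-sym z~v))))

    Above : ℕ → Fin N → Set
    Above k z = lay z < k ⊎ (z ≡ v₁ ⊎ z ≡ v₂)

    -- A vertex with a neighbour one layer further down is not a pendant neighbour of the root.
    far-above : ∀ {x c k} → x ~ c → c ≢ root → lay x ≡ suc k → ∀ {z} → Above k z → Far x z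
    far-above x~c c≢r e (inj₁ h) = far-lay′ (≤-trans (s≤s h) (≤-reflexive (sym e)))
    far-above {x} x~c c≢r e (inj₂ (inj₁ refl)) with lay-pendant root~v₁ pendant₁ {x} (λ { refl → case trans (sym lay-root) e of λ () })
    ... | inj₁ f    = f
    ... | inj₂ refl = contradiction (pendant₁ x~c) c≢r
    far-above {x} x~c c≢r e (inj₂ (inj₂ refl)) with lay-pendant root~v₂ pendant₂ {x} (λ { refl → case trans (sym lay-root) e of λ () })
    ... | inj₁ f    = f
    ... | inj₂ refl = contradiction (pendant₂ x~c) c≢r

    lay-suc≢root : ∀ {c k} → lay c ≡ suc k → c ≢ root
    lay-suc≢root e refl = case trans (sym lay-root) e of λ ()

    up-broom : ∀ k {x c} → lay x ≡ k → x ~ c → c ≢ root → ∃[ ts ] (Broom x ts (suc k) × All (Above k) ts)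
    up-broom zero e x~c _ with lay-zero e x~c
    ... | refl = v₁ ∷ v₂ ∷ [] , tip root~v₁ root~v₂ v₁-v₂ , inj₂ (inj₁ refl) ∷ inj₂ (inj₂ refl) ∷ []
      where
      v₁-v₂ : Far v₁ v₂
      v₁-v₂ = v₁≢v₂ , ¬true⇒false (λ h → ~⇒≢ root~v₂ (sym (pendant₁ h)))
    up-broom (suc k) {x} e x~c c≢r with parent e
    ... | p , p~x , lay-p with up-broom k lay-p p~x (lay-suc≢root e)
    ...   | ts , β , above = p ∷ ts
            , grow (~-sym p~x) (All.map (far-above x~c c≢r e) above) β
            , inj₁ (≤-reflexive (cong suc lay-p))
              ∷ All.map [ (λ h → inj₁ (<-trans h (n<1+n k))) , inj₂ ]′ above

  root-bone : ∀ {z a b k} → lay z ≡ suc k → z ~ a → z ~ b → lay a ≡ suc (lay z) → lay b ≡ suc (lay z) →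
              Far a b → Size (suc (lay z))
  root-bone {z} {a} {b} {k} lay-z z~a z~b lay-a lay-b a-b
    with up-broom (suc k) lay-z z~a (lay-suc≢root lay-a)
  ... | ts , β , above = subst (Size ∘ suc) (sym lay-z)
        (Size-bone (s≤s (s≤s z≤n)) (bone β z~a z~b a-b
          (All.map (far z~a lay-a) above) (All.map (far z~b lay-b) above)))
    where
    z≢root : z ≢ root
    z≢root = lay-suc≢root lay-z
    far : ∀ {a} → z ~ a → lay a ≡ suc (lay z) → ∀ {y} → Above (suc k) y → Far a y
    far z~a e h = far-above (~-sym z~a) z≢root (trans e (cong suc lay-z)) h

  odd-layer-clique : ∀ {z a b} → odd (lay z) ≡ true → z ~ a → z ~ b → lay a ≡ suc (lay z) → lay b ≡ suc (lay z) →
                     ¬ Far a b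
  odd-layer-clique {z} o z~a z~b lay-a lay-b a-b with lay z in e
  ... | suc k = true≢false (Size-odd (root-bone e z~a z~b (trans lay-a (cong suc (sym e))) (trans lay-b (cong suc (sym e))) a-b))
                           (cong not (trans (cong odd e) o))

  centre-even : ∀ {u a b} → u ~ a → u ~ b → lay a ≡ suc (lay u) → lay b ≡ suc (lay u) → Far a b →
                odd (lay u) ≡ false
  centre-even u~a u~b la lb f = ¬true⇒false (λ o → odd-layer-clique o u~a u~b la lb f)

  over? : ∀ v → Decidable (λ p → p ~ v × lay v ≡ suc (lay p))
  over? v p = (p ~? v) ×-dec (lay v ≟ suc (lay p))

  up : Fin N → Fin N
  up v with Finₚ.any? (over? v)
  ... | yes (p , _) = p
  ... | no _        = v

  up-spec : ∀ {v k} → lay v ≡ suc k → up v ~ v × lay v ≡ suc (lay (up v))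
  up-spec {v} e with Finₚ.any? (over? v)
  ... | yes (_ , h) = h
  ... | no none with parent e
  ...   | p , p~v , refl = contradiction (p , p~v , e) none

  module Leaves {R : Fin N → Set} {R? : Decidable R} (D : Decompose.Decomposition G layering R?) where
    open Decompose.Decomposition D public

    ΛParent : Fin N → Fin N → Set
    ΛParent w t = Λ t × (t ~ w × lay w ≡ suc (lay t))

    ΛParent? : ∀ w → Decidable (ΛParent w)
    ΛParent? w t = Λ? t ×-dec ((t ~? w) ×-dec (lay w ≟ suc (lay t)))

    par : Fin N → Fin N
    par w with Finₚ.any? (ΛParent? w)
    ... | yes (t , _) = t
    ... | no _        = up w

    par-spec : ∀ {w k} → lay w ≡ suc k → par w ~ w × lay w ≡ suc (lay (par w))
    par-spec {w} e with Finₚ.any? (ΛParent? w)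
    ... | yes (t , _ , h) = h
    ... | no _            = up-spec e

    par-prefers-Λ : ∀ {w t} → ΛParent w t → Λ (par w)
    par-prefers-Λ {w} h with Finₚ.any? (ΛParent? w)
    ... | yes (_ , l , _) = l
    ... | no none         = contradiction (_ , h) none

    Λ-odd : ∀ {t} → Λ t → odd (lay t) ≡ true
    Λ-odd l = trans (cong odd (lay-cen l)) (cong not (St-even (cen-St l)))

    module _ (B : Fin N → Set) where

      PrivateLeaf : Fin N → Fin N → Set
      PrivateLeaf b t = Λ t × (b ~ t × (lay t ≡ suc (lay b) × (∀ b′ → B b′ → b′ ~ t → b′ ≡ b)))

      Child : Fin N → Fin N → Set
      Child b w = B w × (b ~ par w × lay w ≡ suc (suc (lay b)))

      data Limb : Fin N → ℕ → Set where
        stop : ∀ {b s t} → B b → PrivateLeaf b s → PrivateLeaf b t → s ≢ t → Limb b 1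
        next : ∀ {b w k} → B b → Child b w → Limb w k → Limb b (suc (suc k))

    module _ {B : Fin N → Set} where

      limb-head : ∀ {b k} → Limb B b k → B b
      limb-head (stop Bb _ _ _) = Bb
      limb-head (next Bb _ _)   = Bb

      tail : ∀ {b k} → Limb B b k → List (Fin N)
      tail (stop {s = s} {t} _ _ _ _) = s ∷ t ∷ []
      tail (next {w = w} _ _ ℓ)       = par w ∷ w ∷ tail ℓ

      limb-odd : ∀ {b k} → Limb B b k → odd k ≡ true
      limb-odd (stop _ _ _ _) = refl
      limb-odd (next _ _ ℓ)   = trans (Boolₚ.not-involutive _) (limb-odd ℓ)

      child-par : ∀ {b w} → Child B b w → par w ~ w × (lay w ≡ suc (lay (par w)) × lay (par w) ≡ suc (lay b))
      child-par (_ , _ , e) with par-spec e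
      ... | p~w , e′ = p~w , e′ , suc-injective (trans (sym e′) e)

      tail-below : ∀ {b k} (ℓ : Limb B b k) → All (λ z → lay b < lay z) (tail ℓ)
      tail-below (stop _ (_ , _ , e , _) (_ , _ , e′ , _) _) = ≤-reflexive (sym e) ∷ ≤-reflexive (sym e′) ∷ []
      tail-below (next {b} {w} _ c ℓ) =
          ≤-reflexive (sym (proj₂ (proj₂ (child-par c))))
        ∷ b<w
        ∷ All.map (<-trans b<w) (tail-below ℓ)
        where
        b<w : lay b < lay w
        b<w = ≤-trans (n≤1+n _) (≤-reflexive (sym (proj₂ (proj₂ c))))

      far-tail : ∀ {b k a} (ℓ : Limb B b k) → lay a < lay b → All (Far a) (tail ℓ)
      far-tail ℓ h = All.map (λ b<z → far-lay (≤-<-trans h b<z)) (tail-below ℓ)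

      limb-broom : ∀ {b k} (ℓ : Limb B b k) → Broom b (tail ℓ) k
      limb-broom (stop _ (l , b~s , _) (l′ , b~t , _) s≢t) = tip b~s b~t (s≢t , Λ-indep l l′)
      limb-broom (next {b} {w} _ c@(_ , b~x , e) ℓ) with child-par c
      ... | x~w , e₁ , e₂ = grow b~x (far-lay (≤-reflexive (sym e)) ∷ far-tail ℓ (≤-trans (n≤1+n _) (≤-reflexive (sym e))))
                              (grow x~w (far-tail ℓ (≤-reflexive (sym e₁))) (limb-broom ℓ))

      -- The layer of the far end of a limb is lay b + k ∸ 1, and its bone to the root has one vertex more.
      limb-size : ∀ {b k j} → Limb B b k → lay b ≡ suc j → Size (lay b + k)
      limb-size {b} (stop _ (l , b~s , e , _) (l′ , b~t , e′ , _) s≢t) lay-b =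
        subst Size (+-comm 1 (lay b)) (root-bone lay-b b~s b~t e e′ (s≢t , Λ-indep l l′))
      limb-size {b} (next {w = w} {k} _ (_ , _ , e) ℓ) lay-b =
        subst Size (trans (cong (_+ k) e) (sym (trans (+-suc (lay b) (suc k)) (cong suc (+-suc (lay b) k)))))
          (limb-size ℓ e)

      no-fork : ∀ {x w k a b} → Limb B w k → x ~ w → lay w ≡ suc (lay x) → x ~ a → x ~ b → Far a b →
                lay a ≤ lay x → lay b ≤ lay x → a ≁ w → b ≁ w → ⊥
      no-fork {x} {w} {k} ℓ x~w e x~a x~b a-b la lb a≁w b≁w = no-even-bone
        (s≤s (broom-length (limb-broom ℓ))) (cong not (limb-odd ℓ))
        (bone (grow x~w (far-tail ℓ x<w) (limb-broom ℓ)) x~a x~b a-b (far la a≁w) (far lb b≁w))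
        where
        x<w : lay x < lay w
        x<w = ≤-reflexive (sym e)
        far : ∀ {a} → lay a ≤ lay x → a ≁ w → All (Far a) (w ∷ tail ℓ)
        far la a≁w = (lay≢ (≤-<-trans la x<w) , a≁w) ∷ far-tail ℓ (≤-<-trans la x<w)

      no-side-fork : ∀ {x w k t u t′ j} → Limb B w k → x ~ w → lay w ≡ suc (lay x) →
        t ~ x → lay t ≡ lay x → t ≁ w → u ~ t → lay t ≡ suc (lay u) → u ≁ x → lay u ≡ suc j →
        u ~ t′ → lay t′ ≡ lay x → t′ ≢ t → t′ ≁ t → t′ ≁ x → t′ ≁ w → ⊥
      no-side-fork {x} {w} {k} {t} {u} {t′} ℓ x~w e t~x lay-t t≁w u~t lay-u u≁x u≢root u~t′ lay-t′ t′≢t t′≁t t′≁x t′≁w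
        with parent u≢root
      ... | y , y~u , lay-y = no-even-bone (s≤s (s≤s z≤n))
            (cong not (trans (Boolₚ.not-involutive _) (limb-odd ℓ)))
            (bone (grow u~t (((λ { refl → true≢false u~t′ (≁-sym t′≁x) }) , u≁x)
                             ∷ far-lay (≤-reflexive (trans (cong suc (trans (sym lay-u) lay-t)) (sym e)))
                             ∷ far-tail ℓ (<-trans u<x x<w))
                   (grow t~x ((lay≢ t<w , t≁w) ∷ far-tail ℓ t<w)
                    (grow x~w (far-tail ℓ x<w) (limb-broom ℓ))))
              u~t′ (~-sym y~u) (Far-sym (far-y (≤-reflexive (sym lay-t′))))
              ((t′≢t , t′≁t) ∷ ((λ { refl → true≢false u~t′ u≁x }) , t′≁x)
                ∷ (lay≢ (≤-<-trans (≤-reflexive lay-t′) x<w) , t′≁w)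
                ∷ far-tail ℓ (≤-<-trans (≤-reflexive lay-t′) x<w))
              (far-y (≤-reflexive (sym lay-t)) ∷ far-y ≤-refl ∷ far-y (<⇒≤ x<w)
                ∷ far-tail ℓ (<-trans (≤-<-trans (≤-trans (n≤1+n _) (≤-reflexive (trans (cong suc lay-y) (sym u≢root)))) u<x) x<w)))
        where
        x<w : lay x < lay w
        x<w = ≤-reflexive (sym e)
        t<w : lay t < lay w
        t<w = ≤-<-trans (≤-reflexive lay-t) x<w
        u<x : lay u < lay x
        u<x = ≤-reflexive (trans (sym lay-u) lay-t)
        far-y : ∀ {z} → lay x ≤ lay z → Far y z
        far-y h = far-lay (≤-trans (≤-reflexive (cong suc (trans (cong suc lay-y) (sym u≢root)))) (≤-trans u<x h))

-- The forest of kept centres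

double-mono : ∀ {i j} → i ≤ j → double i ≤ double j
double-mono z≤n     = z≤n
double-mono (s≤s h) = s≤s (s≤s (double-mono h))

double-cancel-≤ : ∀ {i j} → double i ≤ suc (double j) → i ≤ j
double-cancel-≤ {zero}          h = z≤n
double-cancel-≤ {suc i} {suc j} (s≤s (s≤s h)) = s≤s (double-cancel-≤ h)
double-cancel-≤ {suc i} {zero}  (s≤s ())

module Kept {N : ℕ} {G : Graph N} (F : Frame G) {R : Fin N → Set} {R? : Decidable R}
            (D : Decompose.Decomposition G (Frame.layering F) R?) where
  open Rooted F public
  open Leaves D public

  -- The parent of a kept vertex either lies in Λ, or sees a Λ-vertex of its layer and then also the centre
  -- of that vertex, or is solitary; only in the last case does it cost a vertex that is not in St.
  Solitary : Fin N → Set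
  Solitary x = ¬ Λ x × (∀ t → Λ t → lay t ≡ lay x → ¬ t ~ x)

  solitary? : Decidable Solitary
  solitary? x = ¬? (Λ? x) ×-dec Finₚ.all? (λ t → Λ? t →-dec ((lay t ≟ lay x) →-dec ¬? (t ~? x)))

  module _ (B : Fin N → Set) (c : ℕ) where

    Unclaimed : Fin N → Set
    Unclaimed t = Λ t × (suc (double c) ≤ lay t × (∀ w → B w → t ~ w → lay w ≢ suc (lay t)))

    Covered : Fin N → Set
    Covered t = Unclaimed t × ∃[ b ] (B b × (b ~ t × lay t ≡ suc (lay b)))

    SolitaryPar : Fin N → Set
    SolitaryPar w = B w × (double (suc c) ≤ lay w × Solitary (par w))

  module _ {B : Fin N → Set} (B? : Decidable B) (c : ℕ) where

    unclaimed? : Decidable (Unclaimed B c)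
    unclaimed? t = Λ? t ×-dec ((suc (double c) ≤? lay t) ×-dec
      Finₚ.all? (λ w → B? w →-dec ((t ~? w) →-dec ¬? (lay w ≟ suc (lay t)))))

    covered? : Decidable (Covered B c)
    covered? t = unclaimed? t ×-dec Finₚ.any? (λ b → B? b ×-dec ((b ~? t) ×-dec (lay t ≟ suc (lay b))))

    solitaryPar? : Decidable (SolitaryPar B c)
    solitaryPar? w = B? w ×-dec ((double (suc c) ≤? lay w) ×-dec solitary? (par w))

  St≥? : ∀ c → Decidable (λ u → St u × double c ≤ lay u)
  St≥? c u = St? u ×-dec (double c ≤? lay u)

  -- B consists of the vertices kept in the layers 2c and below; count is what pays for them.
  record State (c : ℕ) : Set₁ where
    field
      {B}       : Fin N → Set
      B?        : Decidable B
      level     : ∀ {b} → B b → ∃[ j ] (lay b ≡ double j × c ≤ j)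
      limb      : ∀ {b} → B b → ∃[ k ] Limb B b k
      dominated : ∀ {w} → B w → double c < lay w → ∃[ b ] (B b × Child B b w)
      unique    : ∀ {w b b′} → B b → B b′ → Child B b w → Child B b′ w → b ≡ b′
      apart     : ∀ {b b′ k k′} → b ≢ b′ → lay b ≡ lay b′ → (ℓ : Limb B b k) (ℓ′ : Limb B b′ k′) →
                  Sep (b ∷ tail ℓ) (b′ ∷ tail ℓ′)
      count     : # (unclaimed? B? c) + # B? ≤ # (covered? B? c) + (# (St≥? c) + # (solitaryPar? B? c))

    low : ∀ {b} → B b → double c ≤ lay b
    low Bb with level Bb
    ... | j , e , c≤j = ≤-trans (double-mono c≤j) (≤-reflexive (sym e))

    B-even : ∀ {b} → B b → odd (lay b) ≡ false
    B-even Bb with level Bb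
    ... | j , e , _ = trans (cong odd e) (odd-double j)

  module Step {c : ℕ} (S : State (suc (suc c))) where
    open State S

    h : ℕ
    h = double (suc c)

    odd-suc-h : odd (suc h) ≡ true
    odd-suc-h = cong not (odd-double (suc c))

    deep : ∀ {w} → B w → suc (suc h) ≤ lay w
    deep = low

    Free : Fin N → Set
    Free t = Λ t × (lay t ≡ suc h × (∀ w → B w → t ~ w → lay w ≢ suc (lay t)))

    free? : Decidable Free
    free? t = Λ? t ×-dec ((lay t ≟ suc h) ×-dec
      Finₚ.all? (λ w → B? w →-dec ((t ~? w) →-dec ¬? (lay w ≟ suc (lay t)))))

    free-≁ : ∀ {t w} → Free t → B w → t ≁ w
    free-≁ {t} {w} (_ , lt , f) Bw = ¬true⇒false (λ t~w → f w Bw t~w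
      (≤-antisym (lay-adj t~w) (≤-trans (≤-reflexive (cong suc lt)) (deep Bw))))

    Dominates : (Fin N → Set) → Set
    Dominates C = ∀ {w} → B w → lay w ≡ suc (suc h) → ∃[ b ] (C b × b ~ par w)

    module _ (C : Fin N → Set) where

      SoleParent : Fin N → Fin N → Set
      SoleParent b w = B w × (lay w ≡ suc (suc h) × (b ~ par w × (∀ b′ → C b′ → b′ ~ par w → b′ ≡ b)))

      SoleCentre : Fin N → Fin N → Set
      SoleCentre b t = Free t × (b ~ t × (∀ b′ → C b′ → b′ ~ t → b′ ≡ b))

      Useful : Fin N → Set
      Useful b = ∃ (SoleParent b) ⊎ Two (SoleCentre b)

      Reached : Fin N → Set
      Reached t = Free t × ∃[ b ] (C b × b ~ t)

    module _ {C : Fin N → Set} (C? : Decidable C) where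

      soleParent? : ∀ b → Decidable (SoleParent C b)
      soleParent? b w = B? w ×-dec ((lay w ≟ suc (suc h)) ×-dec ((b ~? par w) ×-dec
        Finₚ.all? (λ b′ → C? b′ →-dec ((b′ ~? par w) →-dec (b′ Finₚ.≟ b)))))

      soleCentre? : ∀ b → Decidable (SoleCentre C b)
      soleCentre? b t = free? t ×-dec ((b ~? t) ×-dec
        Finₚ.all? (λ b′ → C? b′ →-dec ((b′ ~? t) →-dec (b′ Finₚ.≟ b))))

      useful? : Decidable (Useful C)
      useful? b = Finₚ.any? (soleParent? b) ⊎-dec two? (soleCentre? b)

      reached? : Decidable (Reached C)
      reached? t = free? t ×-dec Finₚ.any? (λ b → C? b ×-dec (b ~? t))

    -- Dropping a useless vertex loses at most one reached leaf, whence gain.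
    record Pruning {C : Fin N → Set} (C? : Decidable C) : Set₁ where
      field
        {C′}   : Fin N → Set
        C′?    : Decidable C′
        ⊆C     : ∀ {b} → C′ b → C b
        dom    : Dominates C′
        useful : ∀ {b} → C′ b → Useful C′ b
        gain   : # (reached? C?) + # C′? ≤ # (reached? C′?) + # C?

    prune : ∀ {C} (C? : Decidable C) → Dominates C → Pruning C?
    prune C? = go C? (<-wellFounded (# C?))
      where
      open Pruning
      go : ∀ {C} (C? : Decidable C) → Acc _<_ (# C?) → Dominates C → Pruning C?
      go {C} C? (acc rec) dom₀ with Finₚ.any? (λ b → C? b ×-dec ¬? (useful? C? b))
      ... | no none = record
        { C′? = C? ; ⊆C = id ; dom = dom₀ ; useful = λ {b} → use b ; gain = ≤-refl }
        where
        use : ∀ b → C b → Useful C b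
        use b Cb with useful? C? b
        ... | yes u = u
        ... | no ¬u = contradiction (b , Cb , ¬u) none
      ... | yes (b , Cb , ¬useful) = record
        { C′? = C′? P ; ⊆C = proj₁ ∘ ⊆C P ; dom = dom P ; useful = useful P ; gain = gain′ }
        where
        dom₁ : Dominates (λ x → C x × x ≢ b)
        dom₁ {w} Bw e with Finₚ.any? (λ x → (C? x ×-dec ¬? (x Finₚ.≟ b)) ×-dec (x ~? par w))
        ... | yes (x , h) = x , h
        ... | no none = contradiction (inj₁ (w , Bw , e , b~ , sole)) ¬useful
          where
          sole : ∀ x → C x → x ~ par w → x ≡ b
          sole x Cx x~ with x Finₚ.≟ b
          ... | yes e = e
          ... | no ne = contradiction (x , (Cx , ne) , x~) none
          b~ : b ~ par w
          b~ with dom₀ Bw e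
          ... | x , Cx , x~ = subst (_~ par w) (sole x Cx x~) x~
        P : Pruning (C? ∖ b)
        P = go (C? ∖ b) (rec (≤-reflexive (sym (#-remove C? Cb)))) dom₁
        split : ∀ t → Reached C t → SoleCentre C b t ⊎ Reached (λ x → C x × x ≢ b) t
        split t (f , x , Cx , x~t) with Finₚ.any? (λ x → (C? x ×-dec ¬? (x Finₚ.≟ b)) ×-dec (x ~? t))
        ... | yes (y , h) = inj₂ (f , y , h)
        ... | no none = inj₁ (f , subst (_~ t) (sole x Cx x~t) x~t , sole)
          where
          sole : ∀ x → C x → x ~ t → x ≡ b
          sole x Cx x~ with x Finₚ.≟ b
          ... | yes e = e
          ... | no ne = contradiction (x , (Cx , ne) , x~) none
        open ≤-Reasoning
        gain′ : # (reached? C?) + # (C′? P) ≤ # (reached? (C′? P)) + # C?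
        gain′ = begin
          # (reached? C?) + # (C′? P)
            ≤⟨ +-monoˡ-≤ _ (≤-trans (#-∪ (soleCentre? C? b) (reached? (C? ∖ b)) (reached? C?) split)
                 (+-monoˡ-≤ (# (reached? (C? ∖ b))) (¬Two⇒#≤1 (soleCentre? C? b) (¬useful ∘ inj₂)))) ⟩
          suc (# (reached? (C? ∖ b)) + # (C′? P))
            ≤⟨ s≤s (gain P) ⟩
          suc (# (reached? (C′? P)) + # (C? ∖ b))
            ≡⟨ sym (+-suc _ _) ⟩
          # (reached? (C′? P)) + suc (# (C? ∖ b))
            ≡⟨ cong (# (reached? (C′? P)) +_) (sym (#-remove C? Cb)) ⟩
          # (reached? (C′? P)) + # C? ∎

    SolitaryNext : Fin N → Set
    SolitaryNext w = B w × (lay w ≡ suc (suc h) × Solitary (par w))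

    solitaryNext? : Decidable SolitaryNext
    solitaryNext? w = B? w ×-dec ((lay w ≟ suc (suc h)) ×-dec solitary? (par w))

    StHere? : Decidable (λ u → St u × lay u ≡ h)
    StHere? u = St? u ×-dec (lay u ≟ h)

    Start : Fin N → Set
    Start b = (St b × lay b ≡ h) ⊎ ∃[ w ] (SolitaryNext w × up (par w) ≡ b)

    start? : Decidable Start
    start? b = StHere? b ⊎-dec Finₚ.any? (λ w → solitaryNext? w ×-dec (up (par w) Finₚ.≟ b))

    lay-par : ∀ {w} → lay w ≡ suc (suc h) → par w ~ w × lay (par w) ≡ suc h
    lay-par e with par-spec e
    ... | p~w , e′ = p~w , suc-injective (trans (sym e′) e)

    no-Λ-parent : ∀ {w t} → lay w ≡ suc (suc h) → ¬ Λ (par w) → Λ t → lay t ≡ lay (par w) → t ≁ w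
    no-Λ-parent e ¬Λp l lt = ¬true⇒false (λ t~w → ¬Λp (par-prefers-Λ
      (l , t~w , trans e (cong suc (sym (trans lt (proj₂ (lay-par e))))))))

    -- Otherwise the limb of w, its parent x, t and the centre of t would form an even bone.
    centre-sees : ∀ {w t} → B w → lay w ≡ suc (suc h) → ¬ Λ (par w) → Λ t → lay t ≡ lay (par w) → t ~ par w →
                  cen t ~ par w
    centre-sees {w} {t} Bw e ¬Λp l lt t~x with cen t ~? par w
    ... | yes h = h
    ... | no ¬h with partner l
    ...   | t′ , l′ , t′≢t , ce = ⊥-elim (no-side-fork (proj₂ (limb Bw)) x~w lay-w t~x lt t≁w (cen~ l) (lay-cen l)
              (¬true⇒false ¬h) lay-u u~t′ lt′ t′≢t (Λ-indep l′ l) t′≁x t′≁w)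
      where
      x~w : par w ~ w
      x~w = proj₁ (lay-par e)
      lay-w : lay w ≡ suc (lay (par w))
      lay-w = proj₂ (par-spec e)
      lay-u : lay (cen t) ≡ suc (suc (double c))
      lay-u = suc-injective (trans (sym (lay-cen l)) (trans lt (proj₂ (lay-par e))))
      u~t′ : cen t ~ t′
      u~t′ = subst (_~ t′) ce (cen~ l′)
      lt′ : lay t′ ≡ lay (par w)
      lt′ = trans (lay-cen l′) (trans (cong (suc ∘ lay) ce) (trans (sym (lay-cen l)) lt))
      t≁w : t ≁ w
      t≁w = no-Λ-parent e ¬Λp l lt
      t′≁w : t′ ≁ w
      t′≁w = no-Λ-parent e ¬Λp l′ lt′
      t′≁x : t′ ≁ par w
      t′≁x = ¬true⇒false (λ t′~x → no-fork (proj₂ (limb Bw)) x~w lay-w (~-sym t~x) (~-sym t′~x)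
        (t′≢t ∘ sym , Λ-indep l l′) (≤-reflexive lt) (≤-reflexive lt′) t≁w t′≁w)

    start-dominates : Dominates Start
    start-dominates {w} Bw e with Λ? (par w)
    ... | yes l = cen (par w) , inj₁ (cen-St l , suc-injective (trans (sym (lay-cen l)) (proj₂ (lay-par e)))) , cen~ l
    ... | no ¬l with Finₚ.any? (λ t → Λ? t ×-dec ((lay t ≟ lay (par w)) ×-dec (t ~? par w)))
    ...   | yes (t , l , lt , t~x) = cen t
            , inj₁ (cen-St l , suc-injective (trans (sym (lay-cen l)) (trans lt (proj₂ (lay-par e)))))
            , centre-sees Bw e ¬l l lt t~x
    ...   | no none = up (par w)
            , inj₂ (w , (Bw , e , ¬l , λ t l lt t~x → none (t , l , lt , t~x)) , refl)
            , proj₁ (up-spec (proj₂ (lay-par e)))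

    start-lay : ∀ {b} → Start b → lay b ≡ h
    start-lay (inj₁ (_ , e)) = e
    start-lay (inj₂ (w , (_ , e , _) , refl)) =
      suc-injective (trans (sym (proj₂ (up-spec (proj₂ (lay-par e))))) (proj₂ (lay-par e)))

    module Grow (P : Pruning start?) where
      open Pruning P renaming (C′ to C; C′? to C?)

      C-lay : ∀ {b} → C b → lay b ≡ h
      C-lay Cb = start-lay (⊆C Cb)

      B⁺ : Fin N → Set
      B⁺ b = C b ⊎ B b

      B⁺? : Decidable B⁺
      B⁺? b = C? b ⊎-dec B? b

      extend : ∀ {b k} → Limb B b k → Limb B⁺ b k
      extend (stop Bb (l , b~s , e , p) (l′ , b~t , e′ , p′) s≢t) =
        stop (inj₂ Bb) (l , b~s , e , priv e p) (l′ , b~t , e′ , priv e′ p′) s≢t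
        where
        priv : ∀ {t} → lay t ≡ suc _ → (∀ b′ → B b′ → b′ ~ t → b′ ≡ _) → ∀ b′ → B⁺ b′ → b′ ~ t → b′ ≡ _
        priv e p b′ (inj₂ Bb′) b′~t = p b′ Bb′ b′~t
        priv e p b′ (inj₁ Cb′) b′~t = contradiction
          (≤-trans (s≤s (deep Bb)) (≤-trans (≤-reflexive (sym e)) (≤-trans (lay-adj b′~t) (≤-reflexive (cong suc (C-lay Cb′))))))
          (λ le → 1+n≰n (≤-trans (n≤1+n _) le))
      extend (next Bb (Bw , c) ℓ) = next (inj₂ Bb) (inj₂ Bw , c) (extend ℓ)

      old : ∀ {b} → B⁺ b → h < lay b → B b
      old (inj₁ Cb) lt = contradiction (C-lay Cb) (>⇒≢ lt)
      old (inj₂ Bb) lt = Bb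

      restrict : ∀ {b k} (ℓ : Limb B⁺ b k) → h < lay b → Σ (Limb B b k) λ ℓ′ → tail ℓ′ ≡ tail ℓ
      restrict (stop Bb (l , b~s , e , p) (l′ , b~t , e′ , p′) s≢t) lt =
        stop (old Bb lt) (l , b~s , e , λ b′ → p b′ ∘ inj₂) (l′ , b~t , e′ , λ b′ → p′ b′ ∘ inj₂) s≢t , refl
      restrict (next {w = w} Bb (Bw , b~x , e) ℓ) lt with restrict ℓ h<w
        where
        h<w : h < lay w
        h<w = <-trans lt (≤-trans (n≤1+n _) (≤-reflexive (sym e)))
      ... | ℓ′ , tail≡ = next (old Bb lt) (old Bw (<-trans lt (≤-trans (n≤1+n _) (≤-reflexive (sym e)))) , b~x , e) ℓ′
                       , cong (λ ts → par w ∷ w ∷ ts) tail≡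

      child-old : ∀ {b w} → lay b ≡ h → Child B⁺ b w → B w × (lay w ≡ suc (suc h) × b ~ par w)
      child-old {w = w} lb (Bw , b~x , e) = old Bw (≤-trans (n≤1+n _) (≤-reflexive (sym lw))) , lw , b~x
        where
        lw : lay w ≡ suc (suc h)
        lw = trans e (cong (2 +_) lb)

      Unseen : ∀ {b k} → Limb B⁺ b k → Fin N → Set
      Unseen (stop _ _ _ _)     b′ = ⊤
      Unseen (next {w = w} _ _ _) b′ = b′ ≁ par w

      head-far : ∀ {b b′ k} → b ≢ b′ → lay b ≡ h → C b′ → (ℓ : Limb B⁺ b k) → Unseen ℓ b′ → All (Far b′) (tail ℓ)
      head-far b≢b′ lb Cb′ (stop _ (l , b~s , e , p) (l′ , b~t , e′ , p′) _) _ = far e p ∷ far e′ p′ ∷ []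
        where
        far : ∀ {t} → lay t ≡ suc _ → (∀ x → B⁺ x → x ~ t → x ≡ _) → Far _ t
        far e p = lay≢ (≤-reflexive (trans (cong suc (trans (C-lay Cb′) (sym lb))) (sym e)))
                , ¬true⇒false (λ b′~t → b≢b′ (sym (p _ (inj₁ Cb′) b′~t)))
      head-far {b} {b′} b≢b′ lb Cb′ (next {w = w} _ c ℓ) unseen =
          (lay≢ (≤-reflexive (trans (cong suc lb′) (sym (proj₂ (proj₂ (child-par {B⁺} c)))))) , unseen)
        ∷ far-lay (≤-reflexive (sym lw))
        ∷ far-tail ℓ (≤-trans (n≤1+n _) (≤-reflexive (sym lw)))
        where
        lb′ : lay b′ ≡ lay b
        lb′ = trans (C-lay Cb′) (sym lb)
        lw : lay w ≡ suc (suc (lay b′))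
        lw = trans (proj₂ (proj₂ c)) (cong (2 +_) (sym lb′))

      stop-next : ∀ {b b′ s t k} → lay b ≡ h → lay b′ ≡ h → PrivateLeaf B⁺ b s → PrivateLeaf B⁺ b t → s ≢ t →
                  (ℓ : Limb B⁺ b′ (suc (suc k))) → Unseen ℓ b → All (Far s) (tail ℓ)
      stop-next {b} {b′} {s} {t} lb lb′ (l , b~s , e , p) (l′ , b~t , e′ , p′) s≢t (next {w = w} _ c ℓ) unseen =
          (s≢x , ¬true⇒false s~x⇒⊥)
        ∷ (lay≢ s<w , s≁w)
        ∷ far-tail ℓ s<w
        where
        Bw : B w
        Bw = proj₁ (child-old lb′ c)
        lw : lay w ≡ suc (suc h)
        lw = proj₁ (proj₂ (child-old lb′ c))
        x~w : par w ~ w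
        x~w = proj₁ (lay-par lw)
        ls : lay s ≡ lay (par w)
        ls = trans e (trans (cong suc lb) (sym (proj₂ (lay-par lw))))
        lt : lay t ≡ lay (par w)
        lt = trans e′ (trans (cong suc lb) (sym (proj₂ (lay-par lw))))
        s<w : lay s < lay w
        s<w = ≤-reflexive (trans (cong suc ls) (sym (proj₂ (par-spec lw))))
        not-b : ∀ {z} → (∀ x → B⁺ x → x ~ z → x ≡ b) → z ≁ w
        not-b p = ¬true⇒false (λ z~w → lay≢ (≤-trans (s≤s (≤-reflexive lb)) (≤-trans (n≤1+n _) (≤-reflexive (sym lw))))
          (sym (p w (inj₂ Bw) (~-sym z~w))))
        s≁w : s ≁ w
        s≁w = not-b p
        s≢x : s ≢ par w
        s≢x e = true≢false (subst (_~ w) (sym e) x~w) s≁w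
        s~x⇒⊥ : s ~ par w → ⊥
        s~x⇒⊥ s~x = no-side-fork (proj₂ (limb Bw)) x~w (proj₂ (par-spec lw)) s~x ls s≁w b~s e unseen lb b~t lt
          (s≢t ∘ sym) (Λ-indep l′ l)
          (¬true⇒false (λ t~x → no-fork (proj₂ (limb Bw)) x~w (proj₂ (par-spec lw)) (~-sym s~x) (~-sym t~x)
            (s≢t , Λ-indep l l′) (≤-reflexive ls) (≤-reflexive lt) s≁w (not-b p′)))
          (not-b p′)

      tails-sep : ∀ {b b′ k k′} → b ≢ b′ → lay b ≡ h → lay b′ ≡ h → C b → C b′ →
                  (ℓ : Limb B⁺ b k) (ℓ′ : Limb B⁺ b′ k′) → Unseen ℓ b′ → Unseen ℓ′ b → Sep (tail ℓ) (tail ℓ′)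
      tails-sep {b} {b′} b≢b′ lb lb′ Cb Cb′ (stop _ (l , b~s , e , p) (l′ , b~t , e′ , p′) _)
        (stop _ (m , b~s′ , f , q) (m′ , b~t′ , f′ , q′) _) _ _ = λ
          { (here refl) (here refl)                 → far l m p b~s q b~s′
          ; (here refl) (there (here refl))         → far l m′ p b~s q′ b~t′
          ; (there (here refl)) (here refl)         → far l′ m p′ b~t q b~s′
          ; (there (here refl)) (there (here refl)) → far l′ m′ p′ b~t q′ b~t′ }
        where
        far : ∀ {x y} → Λ x → Λ y → (∀ z → B⁺ z → z ~ x → z ≡ b) → b ~ x →
              (∀ z → B⁺ z → z ~ y → z ≡ b′) → b′ ~ y → Far x y
        far lx ly p b~x q b~y = (λ { refl → b≢b′ (q b (inj₁ Cb) b~x) }) , Λ-indep lx ly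
      tails-sep b≢b′ lb lb′ Cb Cb′ (stop _ p q s≢t) ℓ′@(next _ _ _) u u′ = λ
          { (here refl)         → All.lookup (stop-next lb lb′ p q s≢t ℓ′ u′)
          ; (there (here refl)) → All.lookup (stop-next lb lb′ q p (s≢t ∘ sym) ℓ′ u′) }
      tails-sep b≢b′ lb lb′ Cb Cb′ ℓ@(next _ _ _) (stop _ p q s≢t) u u′ = λ x∈ → λ
          { (here refl)         → Far-sym (All.lookup (stop-next lb′ lb p q s≢t ℓ u) x∈)
          ; (there (here refl)) → Far-sym (All.lookup (stop-next lb′ lb q p (s≢t ∘ sym) ℓ u) x∈) }
      tails-sep {b} {b′} b≢b′ lb lb′ Cb Cb′ (next {w = w} {k} _ c ℓ) (next {w = w′} {k′} _ c′ ℓ′) u u′ = λ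
          { (here refl) (here refl)          → x-x′
          ; (here refl) (there (here refl))  → x-w′
          ; (here refl) (there (there y∈))   → All.lookup (far-tail ℓ′ x<w′) y∈
          ; (there (here refl)) (here refl)  → Far-sym x′-w
          ; (there (there x∈)) (here refl)   → Far-sym (All.lookup (far-tail ℓ x′<w) x∈)
          ; (there x∈) (there y∈)            → below x∈ y∈ }
        where
        lw : lay w ≡ suc (suc h)
        lw = proj₁ (proj₂ (child-old lb c))
        lw′ : lay w′ ≡ suc (suc h)
        lw′ = proj₁ (proj₂ (child-old lb′ c′))
        lx : lay (par w) ≡ suc h
        lx = proj₂ (lay-par lw)
        lx′ : lay (par w′) ≡ suc h
        lx′ = proj₂ (lay-par lw′)
        x<w′ : lay (par w) < lay w′
        x<w′ = ≤-reflexive (trans (cong suc lx) (sym lw′))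
        x′<w : lay (par w′) < lay w
        x′<w = ≤-reflexive (trans (cong suc lx′) (sym lw))
        x≢x′ : par w ≢ par w′
        x≢x′ e = true≢false (subst (b ~_) e (proj₁ (proj₂ c))) u′
        below : Sep (w ∷ tail ℓ) (w′ ∷ tail ℓ′)
        below with restrict ℓ (≤-trans (n≤1+n _) (≤-reflexive (sym lw))) | restrict ℓ′ (≤-trans (n≤1+n _) (≤-reflexive (sym lw′)))
        ... | r , e | r′ , e′ = subst₂ (λ ts us → Sep (w ∷ ts) (w′ ∷ us)) e e′
                (apart (λ { refl → x≢x′ refl }) (trans lw (sym lw′)) r r′)
        odd-x : ∀ {x} → lay x ≡ suc h → odd (lay x) ≡ true
        odd-x e = trans (cong odd e) odd-suc-h
        x-w′ : Far (par w) w′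
        x-w′ = lay≢ x<w′ , ¬true⇒false (λ x~w′ → odd-layer-clique (odd-x lx) (proj₁ (lay-par lw)) x~w′
          (proj₂ (par-spec lw)) (trans lw′ (cong suc (sym lx))) (below (here refl) (here refl)))
        x′-w : Far (par w′) w
        x′-w = lay≢ x′<w , ¬true⇒false (λ x′~w → odd-layer-clique (odd-x lx′) x′~w (proj₁ (lay-par lw′))
          (trans lw (cong suc (sym lx′))) (proj₂ (par-spec lw′)) (below (here refl) (here refl)))
        x-x′ : Far (par w) (par w′)
        x-x′ = x≢x′ , ¬true⇒false (λ x~x′ → no-even-bone (s≤s (≤-trans (s≤s z≤n) (m≤n+m _ k)))
          (trans (cong not (odd-+ {k} {suc k′} (limb-odd ℓ))) (trans (Boolₚ.not-involutive _) (cong not (limb-odd ℓ′))))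
          (join (grow (proj₁ (lay-par lw)) (far-tail ℓ (≤-reflexive (sym (proj₂ (par-spec lw))))) (limb-broom ℓ))
                (grow (proj₁ (lay-par lw′)) (far-tail ℓ′ (≤-reflexive (sym (proj₂ (par-spec lw′))))) (limb-broom ℓ′))
                x~x′
                (All.tabulate (λ { (here refl) → Far-sym x′-w ∷ All.tabulate (below (here refl))
                                 ; (there x∈) → Far-sym (All.lookup (far-tail ℓ x′<w) x∈) ∷ All.tabulate (below (there x∈)) }))
                (x-w′ ∷ far-tail ℓ′ x<w′)))

      private-leaf : ∀ {b t} → C b → SoleCentre C b t → PrivateLeaf B⁺ b t
      private-leaf Cb (f@(l , lt , _) , b~t , sole) =
        l , b~t , trans lt (cong suc (sym (C-lay Cb))) , λ
          { b′ (inj₁ Cb′) b′~t → sole b′ Cb′ b′~t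
          ; b′ (inj₂ Bb′) b′~t → ⊥-elim (true≢false (~-sym b′~t) (free-≁ f Bb′)) }

      useful-limb : ∀ {b} → C b → ∃[ k ] Σ (Limb B⁺ b k) λ ℓ → ∀ {b′} → C b′ → b′ ≢ b → Unseen ℓ b′
      useful-limb {b} Cb with useful Cb
      ... | inj₁ (w , Bw , lw , b~x , sole) =
              _ , next (inj₁ Cb) (inj₂ Bw , b~x , trans lw (cong (2 +_) (sym (C-lay Cb)))) (extend (proj₂ (limb Bw)))
                , λ Cb′ ne → ¬true⇒false (ne ∘ sole _ Cb′)
      ... | inj₂ (s , t , s≢t , p , q) = _ , stop (inj₁ Cb) (private-leaf Cb p) (private-leaf Cb q) s≢t , λ _ _ → tt

      C-far : ∀ {b b′} → C b → C b′ → b ≢ b′ → Far b b′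
      C-far {b} {b′} Cb Cb′ b≢b′ = b≢b′ , ¬true⇒false adjacent⇒⊥
        where
        adjacent⇒⊥ : b ~ b′ → ⊥
        adjacent⇒⊥ b~b′ with useful-limb Cb | useful-limb Cb′
        ... | k , ℓ , u | k′ , ℓ′ , u′ = no-even-bone
          (+-mono-≤ (broom-length (limb-broom ℓ)) (broom-length (limb-broom ℓ′)))
          (trans (odd-+ {k} {k′} (limb-odd ℓ)) (cong not (limb-odd ℓ′)))
          (join (limb-broom ℓ) (limb-broom ℓ′) b~b′
            (All.tabulate (λ x∈ → Far-sym (All.lookup (head-far b≢b′ (C-lay Cb) Cb′ ℓ (u Cb′ (b≢b′ ∘ sym))) x∈)
              ∷ All.tabulate (tails-sep b≢b′ (C-lay Cb) (C-lay Cb′) Cb Cb′ ℓ ℓ′ (u Cb′ (b≢b′ ∘ sym)) (u′ Cb b≢b′) x∈)))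
            (head-far (b≢b′ ∘ sym) (C-lay Cb′) Cb ℓ′ (u′ Cb b≢b′)))

      C-unique : ∀ {w b b′} → C b → C b′ → Child B⁺ b w → Child B⁺ b′ w → b ≡ b′
      C-unique {w} {b} {b′} Cb Cb′ c c′ with b Finₚ.≟ b′ | child-old (C-lay Cb) c | child-old (C-lay Cb′) c′
      ... | yes e | _ | _ = e
      ... | no ne | Bw , lw , b~x | _ , _ , b′~x = ⊥-elim (no-fork (proj₂ (limb Bw))
              (proj₁ (lay-par lw)) (proj₂ (par-spec lw)) (~-sym b~x) (~-sym b′~x) (C-far Cb Cb′ ne)
              (above Cb) (above Cb′) (proj₂ (far-w Cb)) (proj₂ (far-w Cb′)))
        where
        above : ∀ {b} → C b → lay b ≤ lay (par w)
        above Cb = ≤-trans (≤-reflexive (C-lay Cb)) (≤-trans (n≤1+n h) (≤-reflexive (sym (proj₂ (lay-par lw)))))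
        far-w : ∀ {b} → C b → Far b w
        far-w Cb = far-lay (≤-reflexive (trans (cong (2 +_) (C-lay Cb)) (sym lw)))

      all-unseen : ∀ {b b′ k} → b ≢ b′ → C b → C b′ → (ℓ : Limb B⁺ b k) → Unseen ℓ b′
      all-unseen ne Cb Cb′ (stop _ _ _ _) = tt
      all-unseen ne Cb Cb′ (next _ c@(Bw , _ , lw) _) = ¬true⇒false (λ b′~x → ne (C-unique Cb Cb′ c
        (Bw , b′~x , trans lw (cong (2 +_) (trans (C-lay Cb) (sym (C-lay Cb′)))))))

      apart⁺ : ∀ {b b′ k k′} → b ≢ b′ → lay b ≡ lay b′ → (ℓ : Limb B⁺ b k) (ℓ′ : Limb B⁺ b′ k′) →
               Sep (b ∷ tail ℓ) (b′ ∷ tail ℓ′)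
      apart⁺ {b} {b′} ne le ℓ ℓ′ with limb-head ℓ | limb-head ℓ′
      ... | inj₁ Cb | inj₁ Cb′ = λ
              { (here refl) (here refl) → C-far Cb Cb′ ne
              ; (here refl) (there y∈)  →
                  All.lookup (head-far (ne ∘ sym) (C-lay Cb′) Cb ℓ′ (all-unseen (ne ∘ sym) Cb′ Cb ℓ′)) y∈
              ; (there x∈) (here refl)  →
                  Far-sym (All.lookup (head-far ne (C-lay Cb) Cb′ ℓ (all-unseen ne Cb Cb′ ℓ)) x∈)
              ; (there x∈) (there y∈)   → tails-sep ne (C-lay Cb) (C-lay Cb′) Cb Cb′ ℓ ℓ′
                  (all-unseen ne Cb Cb′ ℓ) (all-unseen (ne ∘ sym) Cb′ Cb ℓ′) x∈ y∈ }
      ... | inj₁ Cb | inj₂ Bb′ = contradiction (trans (sym le) (C-lay Cb)) (>⇒≢ (≤-trans (n≤1+n _) (deep Bb′)))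
      ... | inj₂ Bb | inj₁ Cb′ = contradiction (trans le (C-lay Cb′)) (>⇒≢ (≤-trans (n≤1+n _) (deep Bb)))
      ... | inj₂ Bb | inj₂ Bb′ with restrict ℓ (≤-trans (n≤1+n _) (deep Bb)) | restrict ℓ′ (≤-trans (n≤1+n _) (deep Bb′))
      ...   | r , e | r′ , e′ = subst₂ (λ ts us → Sep (b ∷ ts) (b′ ∷ us)) e e′ (apart ne le r r′)

      child-restrict : ∀ {b w} → B b → Child B⁺ b w → Child B b w
      child-restrict Bb (Bw , b~x , e) = old Bw (≤-trans (≤-trans (n≤1+n _) (deep Bb)) (≤-trans (m≤n+m _ 2) (≤-reflexive (sym e)))) , b~x , e

      dominated⁺ : ∀ {w} → B⁺ w → h < lay w → ∃[ b ] (B⁺ b × Child B⁺ b w)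
      dominated⁺ {w} B⁺w lt with old B⁺w lt | lay w ≟ suc (suc h)
      ... | Bw | yes e with dom Bw e
      ...   | b , Cb , b~x = b , inj₁ Cb , inj₂ Bw , b~x , trans e (cong (2 +_) (sym (C-lay Cb)))
      dominated⁺ {w} B⁺w lt | Bw | no ne with dominated Bw (≤∧≢⇒< (deep Bw) (ne ∘ sym))
      ...   | b , Bb , _ , b~x , e = b , inj₂ Bb , inj₂ Bw , b~x , e

      unique⁺ : ∀ {w b b′} → B⁺ b → B⁺ b′ → Child B⁺ b w → Child B⁺ b′ w → b ≡ b′
      unique⁺ (inj₁ Cb) (inj₁ Cb′) c c′ = C-unique Cb Cb′ c c′
      unique⁺ (inj₂ Bb) (inj₂ Bb′) c c′ = unique Bb Bb′ (child-restrict Bb c) (child-restrict Bb′ c′)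
      unique⁺ (inj₁ Cb) (inj₂ Bb′) (_ , _ , e) (_ , _ , e′) = contradiction
        (trans (suc-injective (suc-injective (trans (sym e′) e))) (C-lay Cb)) (>⇒≢ (≤-trans (n≤1+n _) (deep Bb′)))
      unique⁺ (inj₂ Bb) (inj₁ Cb′) (_ , _ , e) (_ , _ , e′) = contradiction
        (trans (suc-injective (suc-injective (trans (sym e) e′))) (C-lay Cb′)) (>⇒≢ (≤-trans (n≤1+n _) (deep Bb)))

      count⁺ : # (unclaimed? B⁺? (suc c)) + # B⁺? ≤
               # (covered? B⁺? (suc c)) + (# (St≥? (suc c)) + # (solitaryPar? B⁺? (suc c)))
      count⁺ = begin
        # (unclaimed? B⁺? (suc c)) + # B⁺?
          ≤⟨ +-mono-≤ (#-∪ free? (unclaimed? B? (suc (suc c))) (unclaimed? B⁺? (suc c)) split) (#-∪ C? B? B⁺? (λ _ → id)) ⟩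
        (# free? + Uo) + (# C? + # B?)
          ≤⟨ +-monoˡ-≤ (# C? + # B?) (+-monoˡ-≤ Uo (#-⊆ free? (reached? start?) free⇒reached)) ⟩
        (# (reached? start?) + Uo) + (# C? + # B?)
          ≡⟨ solve 4 (λ a b c d → (a :+ b) :+ (c :+ d) := (a :+ c) :+ (b :+ d)) refl (# (reached? start?)) Uo (# C?) (# B?) ⟩
        (# (reached? start?) + # C?) + (Uo + # B?)
          ≤⟨ +-mono-≤ gain count ⟩
        (# (reached? C?) + # start?) + (Co + (So + Po))
          ≤⟨ +-monoˡ-≤ _ (+-monoʳ-≤ (# (reached? C?)) (≤-trans (#-∪ StHere? ex? start? (λ _ → id))
               (+-monoʳ-≤ (# StHere?) (#-image solitaryNext? ex? (up ∘ par) (λ _ → id))))) ⟩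
        (# (reached? C?) + (# StHere? + # solitaryNext?)) + (Co + (So + Po))
          ≡⟨ solve 6 (λ a b c d e f → (a :+ (b :+ c)) :+ (d :+ (e :+ f)) := (a :+ d) :+ ((b :+ e) :+ (c :+ f))) refl
               (# (reached? C?)) (# StHere?) (# solitaryNext?) Co So Po ⟩
        (# (reached? C?) + Co) + ((# StHere? + So) + (# solitaryNext? + Po))
          ≤⟨ +-mono-≤ (#-⊎ (reached? C?) (covered? B? (suc (suc c))) (covered? B⁺? (suc c)) reached⇒ covered⇒
                 (λ t ((_ , lt , _) , _) ((_ , le , _) , _) → <⇒≢ (≤-trans (s≤s (n≤1+n _)) le) (sym lt)))
               (+-mono-≤
                 (#-⊎ StHere? (St≥? (suc (suc c))) (St≥? (suc c)) (λ u (s , e) → s , ≤-reflexive (sym e))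
                   (λ u (s , le) → s , ≤-trans (m≤n+m _ 2) le) (λ u (_ , e) (_ , le) → <⇒≢ (≤-trans (n≤1+n _) le) (sym e)))
                 (#-⊎ solitaryNext? (solitaryPar? B? (suc (suc c))) (solitaryPar? B⁺? (suc c))
                   (λ w (Bw , e , p) → inj₂ Bw , ≤-reflexive (sym e) , p)
                   (λ w (Bw , le , p) → inj₂ Bw , ≤-trans (m≤n+m _ 2) le , p)
                   (λ w (_ , e , _) (_ , le , _) → <⇒≢ (≤-trans (n≤1+n _) le) (sym e)))) ⟩
        # (covered? B⁺? (suc c)) + (# (St≥? (suc c)) + # (solitaryPar? B⁺? (suc c))) ∎
        where
        open ≤-Reasoning
        open +-*-Solver
        Uo Co So Po : ℕ
        Uo = # (unclaimed? B? (suc (suc c)))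
        Co = # (covered? B? (suc (suc c)))
        So = # (St≥? (suc (suc c)))
        Po = # (solitaryPar? B? (suc (suc c)))
        ex? : Decidable (λ b → ∃[ w ] (SolitaryNext w × up (par w) ≡ b))
        ex? b = Finₚ.any? (λ w → solitaryNext? w ×-dec (up (par w) Finₚ.≟ b))
        split : ∀ t → Unclaimed B⁺ (suc c) t → Free t ⊎ Unclaimed B (suc (suc c)) t
        split t (l , le , f) with lay t ≟ suc h
        ... | yes e = inj₁ (l , e , λ w → f w ∘ inj₂)
        ... | no ne = inj₂ (l , ≤∧≢⇒< (≤∧≢⇒< le (ne ∘ sym)) (λ e → true≢false (Λ-odd l)
                (trans (cong odd (sym e)) (cong not odd-suc-h))) , λ w → f w ∘ inj₂)
        free⇒reached : ∀ t → Free t → Reached Start t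
        free⇒reached t f@(l , lt , _) =
          f , cen t , inj₁ (cen-St l , suc-injective (trans (sym (lay-cen l)) lt)) , cen~ l
        reached⇒ : ∀ t → Reached C t → Covered B⁺ (suc c) t
        reached⇒ t ((l , lt , f) , b , Cb , b~t) =
            (l , ≤-reflexive (sym lt) , λ
              { w (inj₁ Cw) _ e → <⇒≢ (≤-trans (n≤1+n _) (≤-reflexive (sym (trans e (cong suc lt))))) (sym (C-lay Cw))
              ; w (inj₂ Bw)     → f w Bw })
          , b , inj₁ Cb , b~t , trans lt (cong suc (sym (C-lay Cb)))
        covered⇒ : ∀ t → Covered B (suc (suc c)) t → Covered B⁺ (suc c) t
        covered⇒ t ((l , le , f) , b , Bb , b~t , e) =
            (l , ≤-trans (m≤n+m _ 2) le , λ
              { w (inj₁ Cw) _ e → <⇒≢ (≤-trans (≤-trans (m≤n+m _ 2) le) (≤-trans (n≤1+n _) (≤-reflexive (sym e)))) (sym (C-lay Cw))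
              ; w (inj₂ Bw)     → f w Bw })
          , b , inj₂ Bb , b~t , e

      level⁺ : ∀ {b} → B⁺ b → ∃[ j ] (lay b ≡ double j × suc c ≤ j)
      level⁺ (inj₁ Cb) = suc c , C-lay Cb , ≤-refl
      level⁺ (inj₂ Bb) with level Bb
      ... | j , e , le = j , e , ≤-trans (n≤1+n _) le

      limb⁺ : ∀ {b} → B⁺ b → ∃[ k ] Limb B⁺ b k
      limb⁺ (inj₁ Cb) with useful-limb Cb
      ... | k , ℓ , _ = k , ℓ
      limb⁺ (inj₂ Bb) with limb Bb
      ... | k , ℓ = k , extend ℓ

      grown : State (suc c)
      grown = record
        { B? = B⁺? ; level = level⁺ ; limb = limb⁺ ; dominated = dominated⁺ ; unique = unique⁺
        ; apart = apart⁺ ; count = count⁺ }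

  empty : ∀ c → (∀ v → lay v ≤ double (suc c)) → State (suc c)
  empty c bound = record
    { B = λ _ → ⊥ ; B? = none? ; level = λ () ; limb = λ () ; dominated = λ () ; unique = λ ()
    ; apart = λ ne le ℓ ℓ′ → ⊥-elim (limb-head ℓ)
    ; count = ≤-trans (≤-reflexive (cong₂ _+_
        (#-none (unclaimed? none? (suc c)) (λ { t (_ , le , _) → <-irrefl refl (≤-trans le (bound t)) }))
        (#-none none? (λ _ ())))) z≤n }
    where
    none? : Decidable (λ (_ : Fin N) → ⊥)
    none? _ = no id

  descend : ∀ c → State (suc c) → State 1
  descend zero    S = S
  descend (suc c) S = descend c (Step.Grow.grown S (Step.prune S (Step.start? S) (Step.start-dominates S)))

  forest : State 1
  forest = descend (sum lay) (empty (sum lay) (λ v →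
    ≤-trans (term≤sum lay v) (≤-trans (n≤double (sum lay)) (m≤n+m _ 2))))
    where
    n≤double : ∀ n → n ≤ double n
    n≤double zero    = z≤n
    n≤double (suc n) = s≤s (≤-trans (n≤double n) (n≤1+n _))

-- Weights

sum-*ˡ : ∀ {N} c (f : Fin N → ℕ) → sum (λ i → c * f i) ≡ c * sum f
sum-*ˡ {zero}  c f = sym (*-zeroʳ c)
sum-*ˡ {suc N} c f = trans (cong (c * f zero +_) (sum-*ˡ c (f ∘ suc))) (sym (*-distribˡ-+ c (f zero) _))

module Weighed {N : ℕ} {G : Graph N} (F : Frame G) {R : Fin N → Set} {R? : Decidable R}
               (D : Decompose.Decomposition G (Frame.layering F) R?) (S : Kept.State F D 1) where
  open Kept F D public
  open State S public

  lay-B : ∀ {b} → B b → ∃[ k ] lay b ≡ suc (suc k)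
  lay-B {b} Bb with lay b | low Bb
  ... | suc (suc k) | _ = k , refl
  ... | suc zero    | s≤s ()

  par~ : ∀ {w} → B w → par w ~ w
  par~ Bw = proj₁ (par-spec (proj₂ (lay-B Bw)))

  lay-par : ∀ {w} → B w → lay w ≡ suc (lay (par w))
  lay-par Bw = proj₂ (par-spec (proj₂ (lay-B Bw)))

  par-odd : ∀ {w} → B w → odd (lay (par w)) ≡ true
  par-odd {w} Bw = trans (sym (Boolₚ.not-involutive _)) (cong not (trans (cong odd (sym (lay-par Bw))) (B-even Bw)))

  child : ∀ {b w} → B w → b ~ par w → lay (par w) ≡ suc (lay b) → Child B b w
  child Bw b~x e = Bw , b~x , trans (lay-par Bw) (cong suc e)

  par-far-child : ∀ {w w′} → B w → B w′ → w ≢ w′ → lay w ≡ lay w′ → Far (par w) w′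
  par-far-child {w} {w′} Bw Bw′ ne e =
      lay≢ (≤-reflexive (trans (sym (lay-par Bw)) e))
    , ¬true⇒false (λ x~w′ → odd-layer-clique (par-odd Bw) (par~ Bw) x~w′ (lay-par Bw) (trans (sym e) (lay-par Bw))
        (apart ne e (proj₂ (limb Bw)) (proj₂ (limb Bw′)) (here refl) (here refl)))

  par-far : ∀ {w w′} → B w → B w′ → w ≢ w′ → lay w ≡ lay w′ → Far (par w) (par w′)
  par-far {w} {w′} Bw Bw′ ne e with limb Bw | limb Bw′
  ... | k , ℓ | k′ , ℓ′ =
      (λ x≡x′ → true≢false (par~ Bw′) (subst (_≁ w′) x≡x′ (proj₂ x-w′)))
    , ¬true⇒false (λ x~x′ → no-even-bone (s≤s (≤-trans (s≤s z≤n) (m≤n+m _ k)))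
        (trans (cong not (odd-+ {k} {suc k′} (limb-odd ℓ))) (trans (Boolₚ.not-involutive _) (cong not (limb-odd ℓ′))))
        (join (grow (par~ Bw) (far-tail ℓ (≤-reflexive (sym (lay-par Bw)))) (limb-broom ℓ))
              (grow (par~ Bw′) (far-tail ℓ′ (≤-reflexive (sym (lay-par Bw′)))) (limb-broom ℓ′))
              x~x′
              (All.tabulate (λ { (here refl) → Far-sym x′-w ∷ All.tabulate (sep (here refl))
                               ; (there y∈)  → Far-sym (All.lookup (far-tail ℓ x′<w) y∈) ∷ All.tabulate (sep (there y∈)) }))
              (x-w′ ∷ far-tail ℓ′ x<w′)))
    where
    sep = apart ne e ℓ ℓ′
    x-w′ : Far (par w) w′
    x-w′ = par-far-child Bw Bw′ ne e
    x′-w : Far (par w′) w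
    x′-w = par-far-child Bw′ Bw (ne ∘ sym) (sym e)
    x<w′ : lay (par w) < lay w′
    x<w′ = ≤-reflexive (trans (sym (lay-par Bw)) e)
    x′<w : lay (par w′) < lay w
    x′<w = ≤-reflexive (trans (sym (lay-par Bw′)) (sym e))

  par-injective : ∀ {w w′} → B w → B w′ → par w ≡ par w′ → w ≡ w′
  par-injective {w} {w′} Bw Bw′ e with w Finₚ.≟ w′
  ... | yes w≡w′ = w≡w′
  ... | no ne = contradiction e (proj₁ (par-far Bw Bw′ ne
        (trans (lay-par Bw) (trans (cong (suc ∘ lay) e) (sym (lay-par Bw′))))))

  IsPar : Fin N → Set
  IsPar t = ∃[ w ] (B w × par w ≡ t)

  isPar? : Decidable IsPar
  isPar? t = Finₚ.any? (λ w → B? w ×-dec (par w Finₚ.≟ t))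

  -- Parents that see a Λ-vertex of their layer are left out, which keeps Own independent within a layer.
  Own : Fin N → Set
  Own t = Unclaimed B 1 t ⊎ (IsPar t × (Λ t ⊎ Solitary t))

  Bottom Top : Fin N → Fin N → Set
  Bottom b t = b ~ t × (lay t ≡ suc (lay b) × Own t)
  Top b t = t ≡ par b ⊎ (4 ≤ lay b × ΛParent b t)

  bottom? : ∀ b → Decidable (Bottom b)
  bottom? b t = (b ~? t) ×-dec ((lay t ≟ suc (lay b)) ×-dec
    (unclaimed? B? 1 t ⊎-dec (isPar? t ×-dec (Λ? t ⊎-dec solitary? t))))

  top? : ∀ b → Decidable (Top b)
  top? b t = (t Finₚ.≟ par b) ⊎-dec ((4 ≤? lay b) ×-dec ΛParent? b t)

  own-indep : ∀ {s t} → Own s → Own t → s ≢ t → lay s ≡ lay t → s ≁ t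
  own-indep {s} {t} os ot ne e with kind os | kind ot
    where
    kind : ∀ {t} → Own t → Λ t ⊎ (IsPar t × Solitary t)
    kind (inj₁ (l , _))     = inj₁ l
    kind (inj₂ (_ , inj₁ l)) = inj₁ l
    kind (inj₂ (p , inj₂ s)) = inj₂ (p , s)
  ... | inj₁ l             | inj₁ l′             = Λ-indep l l′
  ... | inj₁ l             | inj₂ (_ , _ , s)    = ¬true⇒false (s _ l e)
  ... | inj₂ (_ , _ , s)   | inj₁ l              = ≁-sym (¬true⇒false (s _ l (sym e)))
  ... | inj₂ ((w , Bw , refl) , _) | inj₂ ((w′ , Bw′ , refl) , _) =
          proj₂ (par-far Bw Bw′ (λ { refl → ne refl }) (trans (lay-par Bw) (trans (cong suc e) (sym (lay-par Bw′)))))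

  top-indep : ∀ {b s t} → Top b s → Top b t → s ≢ t → s ≁ t
  top-indep (inj₁ refl) (inj₁ refl)   ne = contradiction refl ne
  top-indep (inj₁ refl) (inj₂ (_ , p)) ne = Λ-indep (par-prefers-Λ p) (proj₁ p)
  top-indep (inj₂ (_ , p)) (inj₁ refl) ne = Λ-indep (proj₁ p) (par-prefers-Λ p)
  top-indep (inj₂ (_ , p)) (inj₂ (_ , q)) ne = Λ-indep (proj₁ p) (proj₁ q)

  top-spec : ∀ {b t} → B b → Top b t → t ~ b × lay b ≡ suc (lay t)
  top-spec Bb (inj₁ refl) = par~ Bb , lay-par Bb
  top-spec Bb (inj₂ (_ , _ , h)) = h

  top-bottom-far : ∀ {b s t} → B b → Top b s → lay t ≡ suc (lay b) → Far s t
  top-bottom-far Bb s lt = far-lay (≤-reflexive (trans (cong suc (sym (proj₂ (top-spec Bb s)))) (sym lt)))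

  weight : Fin N → ℕ
  weight b = # (top? b) + # (bottom? b)

  Heavy : Fin N → Set
  Heavy b = B b × 3 ≤ weight b

  heavy? : Decidable Heavy
  heavy? b = B? b ×-dec (3 ≤? weight b)

  module Total (y : ℕ)
    (star≤ : ∀ {Q : Fin N → Set} (Q? : Decidable Q) c → (∀ {i} → Q i → c ~ i) →
             (∀ {i j} → Q i → Q j → i ≢ j → i ≁ j) → # Q? ≤ 2 + y) where

    weight≤ : ∀ {b} → B b → weight b ≤ 2 + y
    weight≤ {b} Bb = ≤-trans
      (#-⊎ (top? b) (bottom? b) both? (λ _ → inj₁) (λ _ → inj₂)
        (λ t s (_ , lt , _) → proj₁ (top-bottom-far Bb s lt) refl))
      (star≤ both? b [ ~-sym ∘ proj₁ ∘ top-spec Bb , proj₁ ]′ indep)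
      where
      both? : Decidable (λ t → Top b t ⊎ Bottom b t)
      both? t = top? b t ⊎-dec bottom? b t
      indep : ∀ {s t} → Top b s ⊎ Bottom b s → Top b t ⊎ Bottom b t → s ≢ t → s ≁ t
      indep (inj₁ s) (inj₁ t) ne = top-indep s t ne
      indep (inj₁ s) (inj₂ (_ , lt , _)) ne = proj₂ (top-bottom-far Bb s lt)
      indep (inj₂ (_ , ls , _)) (inj₁ t) ne = ≁-sym (proj₂ (top-bottom-far Bb t ls))
      indep (inj₂ (_ , ls , o)) (inj₂ (_ , lt , o′)) ne = own-indep o o′ ne (trans ls (sym lt))

    Λ₀ Claimed HasΛ NoΛ ΛPar SolPar Owned : Fin N → Set
    Λ₀ t      = Λ t × lay t ≡ 1
    Claimed t = Λ t × ∃[ b ] (B b × (4 ≤ lay b × ΛParent b t))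
    HasΛ b    = B b × (4 ≤ lay b × Λ (par b))
    NoΛ b     = B b × ¬ (4 ≤ lay b × Λ (par b))
    ΛPar t    = (IsPar t × 3 ≤ lay t) × Λ t
    SolPar t  = (IsPar t × 3 ≤ lay t) × Solitary t
    Owned t   = ∃[ b ] (B b × Bottom b t)

    Λ₀? : Decidable Λ₀
    Λ₀? t = Λ? t ×-dec (lay t ≟ 1)
    claimed? : Decidable Claimed
    claimed? t = Λ? t ×-dec Finₚ.any? (λ b → B? b ×-dec ((4 ≤? lay b) ×-dec ΛParent? b t))
    hasΛ? : Decidable HasΛ
    hasΛ? b = B? b ×-dec ((4 ≤? lay b) ×-dec Λ? (par b))
    noΛ? : Decidable NoΛ
    noΛ? b = B? b ×-dec ¬? ((4 ≤? lay b) ×-dec Λ? (par b))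
    ΛPar? : Decidable ΛPar
    ΛPar? t = (isPar? t ×-dec (3 ≤? lay t)) ×-dec Λ? t
    solPar? : Decidable SolPar
    solPar? t = (isPar? t ×-dec (3 ≤? lay t)) ×-dec solitary? t
    owned? : Decidable Owned
    owned? t = Finₚ.any? (λ b → B? b ×-dec bottom? b t)
    ΛTop? : ∀ b → Decidable (λ t → B b × (4 ≤ lay b × ΛParent b t))
    ΛTop? b t = B? b ×-dec ((4 ≤? lay b) ×-dec ΛParent? b t)
    BTop? : ∀ b → Decidable (λ t → B b × Top b t)
    BTop? b t = B? b ×-dec top? b t
    BBot? : ∀ b → Decidable (λ t → B b × Bottom b t)
    BBot? b t = B? b ×-dec bottom? b t

    private
      Λ-split : # Λ? ≤ # Λ₀? + (# (unclaimed? B? 1) + # claimed?)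
      Λ-split = ≤-trans (#-∪ Λ₀? rest? Λ? split) (+-monoʳ-≤ (# Λ₀?) (#-∪ (unclaimed? B? 1) claimed? rest? (λ _ → id)))
        where
        rest? : Decidable (λ t → Unclaimed B 1 t ⊎ Claimed t)
        rest? t = unclaimed? B? 1 t ⊎-dec claimed? t
        3≤ : ∀ {t} → Λ t → lay t ≢ 1 → 3 ≤ lay t
        3≤ {t} l ne with lay t | Λ-odd l
        ... | suc zero          | _ = contradiction refl ne
        ... | suc (suc (suc _)) | _ = s≤s (s≤s (s≤s z≤n))
        split : ∀ t → Λ t → Λ₀ t ⊎ (Unclaimed B 1 t ⊎ Claimed t)
        split t l with lay t ≟ 1
        ... | yes e = inj₁ (l , e)
        ... | no ne with Finₚ.any? (λ b → B? b ×-dec ((t ~? b) ×-dec (lay b ≟ suc (lay t))))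
        ...   | yes (b , Bb , t~b , e) =
                  inj₂ (inj₂ (l , b , Bb , ≤-trans (s≤s (3≤ l ne)) (≤-reflexive (sym e)) , l , t~b , e))
        ...   | no none = inj₂ (inj₁ (l , 3≤ l ne , λ b Bb t~b e → none (b , Bb , t~b , e)))

      claimed-top : # claimed? + # noΛ? ≤ sum (λ b → # (BTop? b))
      claimed-top = ≤-trans (+-monoˡ-≤ (# noΛ?) (#-cover claimed? ΛTop? (λ t (_ , b , h) → b , h)))
        (≤-trans (≤-reflexive (sym (∑-distrib-+ (λ b → # (ΛTop? b)) (𝟙 ∘ noΛ?)))) (sum-mono pointwise))
        where
        pointwise : ∀ b → # (ΛTop? b) + 𝟙 (noΛ? b) ≤ # (BTop? b)
        pointwise b = bound (noΛ? b)
          where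
          bound : (d : Dec (NoΛ b)) → # (ΛTop? b) + 𝟙 d ≤ # (BTop? b)
          bound (no _) = ≤-trans (≤-reflexive (+-identityʳ _))
            (#-⊆ (ΛTop? b) (BTop? b) (λ t (Bb , h) → Bb , inj₂ h))
          bound (yes (Bb , none)) = ≤-trans
            (≤-reflexive (cong (_+ 1) (#-none (ΛTop? b) (λ t (_ , le , p) → none (le , par-prefers-Λ p)))))
            (#-pos (BTop? b) {par b} (Bb , inj₁ refl))

      B-split : # B? ≤ # hasΛ? + # noΛ?
      B-split = #-∪ hasΛ? noΛ? B? split
        where
        split : ∀ b → B b → HasΛ b ⊎ NoΛ b
        split b Bb with (4 ≤? lay b) ×-dec Λ? (par b)
        ... | yes h = inj₁ (Bb , h)
        ... | no ¬h = inj₂ (Bb , ¬h)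

      3≤par : ∀ {w} → B w → 4 ≤ lay w → 3 ≤ lay (par w)
      3≤par Bw le = s≤s⁻¹ (≤-trans le (≤-reflexive (lay-par Bw)))

      pars-owned : # (covered? B? 1) + (# hasΛ? + # (solitaryPar? B? 1)) ≤ sum (λ b → # (BBot? b))
      pars-owned = ≤-trans (+-monoʳ-≤ (# (covered? B? 1)) (+-mono-≤
          (#-inj hasΛ? ΛPar? par (λ w (Bw , le , l) → ((w , Bw , refl) , 3≤par Bw le) , l)
            (λ w w′ (Bw , _) (Bw′ , _) → par-injective Bw Bw′))
          (#-inj (solitaryPar? B? 1) solPar? par (λ w (Bw , le , s) → ((w , Bw , refl) , 3≤par Bw le) , s)
            (λ w w′ (Bw , _) (Bw′ , _) → par-injective Bw Bw′))))
        (≤-trans (+-monoʳ-≤ (# (covered? B? 1)) (#-⊎ ΛPar? solPar? pars? (λ _ (p , l) → p , inj₁ l) (λ _ (p , s) → p , inj₂ s)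
            (λ t (_ , l) (_ , ¬l , _) → ¬l l)))
        (≤-trans (#-⊎ (covered? B? 1) pars? owned? cov⇒ pars⇒ disjoint)
          (#-cover owned? BBot? (λ t (b , h) → b , h))))
        where
        pars? : Decidable (λ t → (IsPar t × 3 ≤ lay t) × (Λ t ⊎ Solitary t))
        pars? t = (isPar? t ×-dec (3 ≤? lay t)) ×-dec (Λ? t ⊎-dec solitary? t)
        cov⇒ : ∀ t → Covered B 1 t → Owned t
        cov⇒ t (u , b , Bb , b~t , e) = b , Bb , b~t , e , inj₁ u
        pars⇒ : ∀ t → (IsPar t × 3 ≤ lay t) × (Λ t ⊎ Solitary t) → Owned t
        pars⇒ _ (((w , Bw , refl) , le) , k) with dominated Bw (≤-trans le (≤-trans (n≤1+n _) (≤-reflexive (sym (lay-par Bw)))))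
        ... | b , Bb , c = b , Bb , proj₁ (proj₂ c) , proj₂ (proj₂ (child-par {B} c)) , inj₂ ((w , Bw , refl) , k)
        disjoint : ∀ t → Covered B 1 t → ¬ ((IsPar t × 3 ≤ lay t) × (Λ t ⊎ Solitary t))
        disjoint _ ((_ , _ , f) , _) (((w , Bw , refl) , _) , _) = f w Bw (par~ Bw) (lay-par Bw)

      weights : sum (λ b → # (BTop? b)) + sum (λ b → # (BBot? b)) ≤ 2 * # B? + y * # heavy?
      weights = ≤-trans (≤-reflexive (sym (∑-distrib-+ (λ b → # (BTop? b)) (λ b → # (BBot? b)))))
        (≤-trans (sum-mono pointwise)
        (≤-reflexive (trans (∑-distrib-+ (λ b → 2 * 𝟙 (B? b)) (λ b → y * 𝟙 (heavy? b)))
          (cong₂ _+_ (sum-*ˡ 2 (𝟙 ∘ B?)) (sum-*ˡ y (𝟙 ∘ heavy?))))))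
        where
        pointwise : ∀ b → # (BTop? b) + # (BBot? b) ≤ 2 * 𝟙 (B? b) + y * 𝟙 (heavy? b)
        pointwise b = bound (B? b) (heavy? b)
          where
          bound : (d : Dec (B b)) (e : Dec (Heavy b)) → # (BTop? b) + # (BBot? b) ≤ 2 * 𝟙 d + y * 𝟙 e
          bound (no ¬Bb) e = ≤-trans (≤-reflexive (cong₂ _+_ (#-none (BTop? b) (λ _ → ¬Bb ∘ proj₁)) (#-none (BBot? b) (λ _ → ¬Bb ∘ proj₁)))) z≤n
          bound (yes Bb) e = ≤-trans (+-mono-≤ (#-⊆ (BTop? b) (top? b) (λ _ → proj₂)) (#-⊆ (BBot? b) (bottom? b) (λ _ → proj₂))) (heavy e)
            where
            heavy : (e : Dec (Heavy b)) → weight b ≤ 2 + y * 𝟙 e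
            heavy (yes _) = ≤-trans (weight≤ Bb) (≤-reflexive (cong (2 +_) (sym (*-identityʳ y))))
            heavy (no ¬h) = ≤-trans (s≤s⁻¹ (≰⇒> (λ h → ¬h (Bb , h)))) (m≤m+n 2 _)

    Λ-bound : # Λ? ≤ # Λ₀? + (# (St≥? 1) + y * # heavy?)
    Λ-bound = +-cancelʳ-≤ (2 * # B?) _ _ (begin
      # Λ? + 2 * # B?
        ≤⟨ +-mono-≤ Λ-split (≤-reflexive (cong (# B? +_) (+-identityʳ (# B?)))) ⟩
      (# Λ₀? + (U + # claimed?)) + (# B? + # B?)
        ≤⟨ +-monoʳ-≤ (# Λ₀? + (U + # claimed?)) (+-monoʳ-≤ (# B?) B-split) ⟩
      (# Λ₀? + (U + # claimed?)) + (# B? + (# hasΛ? + # noΛ?))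
        ≡⟨ solve 6 (λ l u c b h o → (l :+ (u :+ c)) :+ (b :+ (h :+ o)) := l :+ ((u :+ b) :+ (h :+ (c :+ o)))) refl
             (# Λ₀?) U (# claimed?) (# B?) (# hasΛ?) (# noΛ?) ⟩
      # Λ₀? + ((U + # B?) + (# hasΛ? + (# claimed? + # noΛ?)))
        ≤⟨ +-monoʳ-≤ (# Λ₀?) (+-mono-≤ count (+-monoʳ-≤ (# hasΛ?) claimed-top)) ⟩
      # Λ₀? + ((Co + (St′ + So)) + (# hasΛ? + T))
        ≡⟨ solve 6 (λ l c s o h t → l :+ ((c :+ (s :+ o)) :+ (h :+ t)) := (l :+ s) :+ (t :+ (c :+ (h :+ o)))) refl
             (# Λ₀?) Co St′ So (# hasΛ?) T ⟩
      (# Λ₀? + St′) + (T + (Co + (# hasΛ? + So)))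
        ≤⟨ +-monoʳ-≤ (# Λ₀? + St′) (≤-trans (+-monoʳ-≤ T pars-owned) weights) ⟩
      (# Λ₀? + St′) + (2 * # B? + y * # heavy?)
        ≡⟨ solve 4 (λ l s b w → (l :+ s) :+ (b :+ w) := (l :+ (s :+ w)) :+ b) refl (# Λ₀?) St′ (2 * # B?) (y * # heavy?) ⟩
      (# Λ₀? + (St′ + y * # heavy?)) + 2 * # B? ∎)
      where
      open ≤-Reasoning
      open +-*-Solver
      U Co So St′ T : ℕ
      U   = # (unclaimed? B? 1)
      Co  = # (covered? B? 1)
      So  = # (solitaryPar? B? 1)
      St′ = # (St≥? 1)
      T   = sum (λ b → # (BTop? b))

    size-bound : # R? ≤ 2 * length M + (1 + y * (1 + # heavy?))
    size-bound with St? root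
    ... | yes St-root = +-cancelʳ-≤ (1 + St′) _ _ (begin
      # R? + (1 + St′)                ≤⟨ +-monoʳ-≤ (# R?) root-star ⟩
      # R? + # St?                    ≤⟨ size ⟩
      2 * length M + (# Λ? + extra)   ≡⟨ cong (λ e → 2 * length M + (# Λ? + e)) no-extra ⟩
      2 * length M + (# Λ? + 0)       ≡⟨ cong (2 * length M +_) (+-identityʳ _) ⟩
      2 * length M + # Λ?             ≤⟨ +-monoʳ-≤ (2 * length M) (≤-trans Λ-bound (+-monoˡ-≤ _ Λ₀≤)) ⟩
      2 * length M + ((2 + y) + (St′ + y * H))
        ≡⟨ solve 4 (λ l a s h → l :+ ((con 2 :+ a) :+ (s :+ a :* h)) := (l :+ (con 1 :+ a :* (con 1 :+ h))) :+ (con 1 :+ s))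
             refl (2 * length M) y St′ H ⟩
      (2 * length M + (1 + y * (1 + H))) + (1 + St′) ∎)
      where
      open ≤-Reasoning
      open +-*-Solver
      St′ H : ℕ
      St′ = # (St≥? 1)
      H   = # heavy?
      root-star : 1 + St′ ≤ # St?
      root-star = ≤-trans (+-monoˡ-≤ St′ (#-pos (Finₚ._≟ root) {root} refl))
        (#-⊎ (Finₚ._≟ root) (St≥? 1) St? (λ { i refl → St-root }) (λ i → proj₁)
          (λ { i refl (_ , le) → case ≤-trans le (≤-reflexive lay-root) of λ () }))
      no-extra : extra ≡ 0
      no-extra = [ id , (λ (_ , _ , ¬s) → contradiction St-root ¬s) ]′ extra≤
      Λ₀≤ : # Λ₀? ≤ 2 + y
      Λ₀≤ = star≤ Λ₀? root
        (λ { {t} (l , e) → subst (_~ t) (lay-zero (suc-injective (trans (sym (lay-cen l)) e)) (cen~ l)) (cen~ l) })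
        (λ (l , _) (l′ , _) _ → Λ-indep l l′)
    ... | no ¬St-root = +-cancelʳ-≤ St′ _ _ (begin
      # R? + St′                      ≤⟨ +-monoʳ-≤ (# R?) (#-⊆ (St≥? 1) St? (λ _ → proj₁)) ⟩
      # R? + # St?                    ≤⟨ size ⟩
      2 * length M + (# Λ? + extra)   ≤⟨ +-monoʳ-≤ (2 * length M) (+-mono-≤ Λ-bound extra≤1) ⟩
      2 * length M + ((# Λ₀? + (St′ + y * H)) + 1)
        ≡⟨ cong (λ z → 2 * length M + ((z + (St′ + y * H)) + 1)) no-Λ₀ ⟩
      2 * length M + ((St′ + y * H) + 1)
        ≤⟨ +-monoʳ-≤ (2 * length M) (+-monoˡ-≤ 1 (+-monoʳ-≤ St′ (*-monoʳ-≤ y (n≤1+n H)))) ⟩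
      2 * length M + ((St′ + y * (1 + H)) + 1)
        ≡⟨ solve 3 (λ l s h → l :+ ((s :+ h) :+ con 1) := (l :+ (con 1 :+ h)) :+ s) refl (2 * length M) St′ (y * (1 + H)) ⟩
      (2 * length M + (1 + y * (1 + H))) + St′ ∎)
      where
      open ≤-Reasoning
      open +-*-Solver
      St′ H : ℕ
      St′ = # (St≥? 1)
      H   = # heavy?
      extra≤1 : extra ≤ 1
      extra≤1 = [ (λ e → ≤-trans (≤-reflexive e) z≤n) , (λ (e , _) → ≤-reflexive e) ]′ extra≤
      no-Λ₀ : # Λ₀? ≡ 0
      no-Λ₀ = #-none Λ₀? (λ t (l , e) → ¬St-root
        (subst St (lay-zero (suc-injective (trans (sym (lay-cen l)) e)) (cen~ l)) (cen-St l)))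

-- Spreading of the heavy centres

module Geometric (y : ℕ) where

  private
    x : ℕ
    x = suc y

  σ : ℕ → ℕ
  σ zero    = 0
  σ (suc h) = suc (x * σ h)

  σ-closed : ∀ h → suc (y * σ h) ≡ x ^ h
  σ-closed zero    = cong suc (*-zeroʳ y)
  σ-closed (suc h) = begin
    suc (y * suc (x * σ h))   ≡⟨ solve 2 (λ y s → con 1 :+ y :* (con 1 :+ (con 1 :+ y) :* s)
                                   := (con 1 :+ y) :* (con 1 :+ y :* s)) refl y (σ h) ⟩
    x * suc (y * σ h)         ≡⟨ cong (x *_) (σ-closed h) ⟩
    x * x ^ h                 ∎
    where
    open ≡-Reasoning
    open +-*-Solver

  σ-bound : 1 ≤ y → ∀ h → 1 + σ (suc h) ≤ 2 * x ^ h
  σ-bound 1≤y zero    = ≤-reflexive (cong (2 +_) (*-zeroʳ y))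
  σ-bound 1≤y (suc h) = begin
    2 + x * σ (suc h)       ≤⟨ +-monoˡ-≤ (x * σ (suc h)) (s≤s 1≤y) ⟩
    x + x * σ (suc h)       ≡⟨ sym (*-suc x (σ (suc h))) ⟩
    x * (1 + σ (suc h))     ≤⟨ *-monoʳ-≤ x (σ-bound 1≤y h) ⟩
    x * (2 * x ^ h)         ≡⟨ solve 2 (λ a b → a :* (con 2 :* b) := con 2 :* (a :* b)) refl x (x ^ h) ⟩
    2 * (x * x ^ h)         ∎
    where
    open ≤-Reasoning
    open +-*-Solver

  border total : ℕ → ℕ
  border r = (r ⊓ 1) + σ (suc r)
  total r  = x ^ r + (r * x ^ r + border r)

  total-bound : 1 ≤ y → ∀ r → total r ≤ (3 + double r) * x ^ r
  total-bound 1≤y r = begin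
    x ^ r + (r * x ^ r + ((r ⊓ 1) + σ (suc r)))
      ≤⟨ +-monoʳ-≤ (x ^ r) (+-monoʳ-≤ (r * x ^ r) (≤-trans (+-monoˡ-≤ (σ (suc r)) (m⊓n≤n r 1)) (σ-bound 1≤y r))) ⟩
    x ^ r + (r * x ^ r + 2 * x ^ r)
      ≡⟨ solve 2 (λ r p → p :+ (r :* p :+ con 2 :* p) := (con 3 :+ r) :* p) refl r (x ^ r) ⟩
    (3 + r) * x ^ r
      ≤⟨ *-monoˡ-≤ (x ^ r) (+-monoʳ-≤ 3 (≤-trans (m≤m+n r (r + 0)) (≤-reflexive (2*≡double r)))) ⟩
    (3 + double r) * x ^ r ∎
    where
    open ≤-Reasoning
    open +-*-Solver

  total-0 : total 0 ≡ 2
  total-0 = cong (2 +_) (*-zeroʳ y)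

module Spread {N : ℕ} {G : Graph N} (F : Frame G) {R : Fin N → Set} {R? : Decidable R}
              (D : Decompose.Decomposition G (Frame.layering F) R?) (S : Kept.State F D 1) (y : ℕ)
              (star≤ : ∀ {Q : Fin N → Set} (Q? : Decidable Q) c → (∀ {i} → Q i → adj G c i ≡ true) →
                       (∀ {i j} → Q i → Q j → i ≢ j → adj G i j ≡ false) → # Q? ≤ 2 + y)
              (r : ℕ)
              (sum-free : ∀ {p q} → Frame.Size F p → Frame.Size F q → 3 + double r ≤ p → 3 + double r ≤ q →
                          ¬ Frame.Size F (suc (p + q)) × ¬ Frame.Size F (pred (p + q))) where
  open Weighed F D S public
  open Total y star≤ public
  open Geometric y

  private
    m x : ℕ
    m = 3 + double r
    x = suc y

  par-far-limb : ∀ {b k} (ℓ : Limb B b k) → All (Far (par b)) (tail ℓ)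
  par-far-limb ℓ = far-tail ℓ (≤-reflexive (sym (lay-par (limb-head ℓ))))

  -- With b between the root and the end of the limb, p + q ∸ 1 is realised as well.
  Short : Fin N → Set
  Short b = ∀ {k} → Limb B b k → k < m

  branching-short : ∀ {b j} → lay b ≡ double j → suc r ≤ j → Two (Bottom b) ⊎ Two (Child B b) → Short b
  branching-short {b} {j} lb r<j two (stop _ _ _ _) = s≤s (s≤s z≤n)
  branching-short {b} {j} lb r<j two L@(next {w = w} {k} Bb c@(Bw , b~x , e) ℓ) = ≰⇒> long⇒⊥
    where
    lx : lay (par w) ≡ suc (lay b)
    lx = proj₂ (proj₂ (child-par {B} c))
    Other : Fin N → Set
    Other o = (b ~ o × lay o ≡ suc (lay b)) × (Far o (par w) × o ≁ w)
    w≢ : ∀ {o} → lay o ≡ suc (lay b) → o ≢ w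
    w≢ lo = lay≢ (≤-reflexive (trans (cong suc lo) (sym e)))
    own-≁w : ∀ {o} → Bottom b o → o ≢ par w → o ≁ w
    own-≁w (_ , lo , inj₁ (_ , _ , f)) o≢x =
      ¬true⇒false (λ o~w → f w Bw o~w (trans e (cong suc (sym lo))))
    own-≁w (_ , lo , inj₂ ((w′ , Bw′ , refl) , _)) o≢x =
      proj₂ (par-far-child Bw′ Bw (λ { refl → o≢x refl }) (trans (lay-par Bw′) (trans (cong suc lo) (sym e))))
    other-child : ∀ {w′} → Child B b w′ → w′ ≢ w → Other (par w′)
    other-child c′@(Bw′ , b~x′ , e′) ne = (b~x′ , proj₂ (proj₂ (child-par {B} c′)))
      , par-far Bw′ Bw ne (trans e′ (sym e)) , proj₂ (par-far-child Bw′ Bw ne (trans e′ (sym e)))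
    other : Two (Bottom b) ⊎ Two (Child B b) → ∃ Other
    other (inj₂ (w₁ , w₂ , ne , c₁ , c₂)) with w₁ Finₚ.≟ w
    ... | yes refl = par w₂ , other-child c₂ (ne ∘ sym)
    ... | no w₁≢w  = par w₁ , other-child c₁ w₁≢w
    other (inj₁ (o₁ , o₂ , ne , q₁@(b~₁ , l₁ , own₁) , q₂@(b~₂ , l₂ , own₂)))
      with o₁ Finₚ.≟ par w | o₂ Finₚ.≟ par w | o₁ ~? par w | o₂ ~? par w
    ... | yes refl | _ | _ | _ =
            o₂ , (b~₂ , l₂) , (ne ∘ sym , own-indep own₂ own₁ (ne ∘ sym) (trans l₂ (sym l₁))) , own-≁w q₂ (ne ∘ sym)
    ... | _ | yes refl | _ | _ =
            o₁ , (b~₁ , l₁) , (ne , own-indep own₁ own₂ ne (trans l₁ (sym l₂))) , own-≁w q₁ ne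
    ... | no ne₁ | no ne₂ | no o₁≁x | _ = o₁ , (b~₁ , l₁) , (ne₁ , ¬true⇒false o₁≁x) , own-≁w q₁ ne₁
    ... | no ne₁ | no ne₂ | _ | no o₂≁x = o₂ , (b~₂ , l₂) , (ne₂ , ¬true⇒false o₂≁x) , own-≁w q₂ ne₂
    ... | no ne₁ | no ne₂ | yes o₁~x | yes o₂~x = ⊥-elim (no-fork ℓ (par~ Bw) (lay-par Bw) (~-sym o₁~x) (~-sym o₂~x)
            (ne , own-indep own₁ own₂ ne (trans l₁ (sym l₂))) (≤-reflexive (trans l₁ (sym lx))) (≤-reflexive (trans l₂ (sym lx)))
            (own-≁w q₁ ne₁) (own-≁w q₂ ne₂))
    long⇒⊥ : ¬ m ≤ suc (suc k)
    long⇒⊥ m≤k with other two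
    ... | o , (b~o , lo) , (o≢x , o≁x) , o≁w = proj₂ (sum-free
            (root-bone (proj₂ (lay-B Bb)) b~x b~o lx lo (o≢x ∘ sym , ≁-sym o≁x))
            (Size-bone (≤-trans (s≤s (s≤s z≤n)) m≤k) (bone (limb-broom L) (~-sym (par~ Bb)) b~o
              (far-lay (≤-reflexive (trans (cong suc (sym (lay-par Bb))) (sym lo))))
              (par-far-limb L)
              ((o≢x , o≁x) ∷ (w≢ lo , o≁w) ∷ far-tail ℓ (≤-reflexive (trans (cong suc lo) (sym e))))))
            (s≤s (≤-trans (double-mono r<j) (≤-reflexive (sym lb)))) m≤k)
            (limb-size L (proj₂ (lay-B Bb)))

  two-top : ∀ {b} → B b → Two (Top b) → 4 ≤ lay b × Two (ΛParent b)
  two-top Bb (s , t , ne , inj₁ e , inj₁ e′)   = contradiction (trans e (sym e′)) ne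
  two-top Bb (s , t , ne , inj₁ refl , inj₂ (le , q)) = le , s , t , ne , (par-prefers-Λ q , top-spec Bb (inj₁ refl)) , q
  two-top Bb (s , t , ne , inj₂ (le , p) , inj₁ refl) = le , s , t , ne , p , par-prefers-Λ p , top-spec Bb (inj₁ refl)
  two-top Bb (s , t , ne , inj₂ (le , p) , inj₂ (_ , q)) = le , s , t , ne , p , q

  -- Here the short bone ends in the centre of a Λ-vertex above b, so that p + q + 1 is realised as well.
  two-top-short : ∀ {b j} → lay b ≡ double j → suc (suc r) ≤ j → Two (Top b) → Short b
  two-top-short {b} {suc (suc j)} lb (s≤s (s≤s r≤j)) two {k} ℓ = ≰⇒> long⇒⊥
    where
    Bb : B b
    Bb = limb-head ℓ
    long⇒⊥ : ¬ m ≤ k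
    long⇒⊥ m≤k with two-top Bb two
    ... | _ , s , t , s≢t , (l , s~b , ls) , (l′ , t~b , lt) with partner l
    ...   | s′ , ls′ , s′≢s , ce = proj₁ (sum-free
              (root-bone lay-u (cen~ l) (subst (_~ s′) ce (cen~ ls′)) (lay-cen l)
                (trans (lay-cen ls′) (cong (suc ∘ lay) ce)) (s′≢s ∘ sym , Λ-indep l ls′))
              (Size-bone (≤-trans (s≤s (s≤s z≤n)) m≤k) (bone (limb-broom ℓ) (~-sym s~b) (~-sym t~b)
                (s≢t , Λ-indep l l′) (far-tail ℓ (≤-reflexive (sym ls))) (far-tail ℓ (≤-reflexive (sym lt)))))
              (≤-trans (s≤s (s≤s (s≤s (double-mono r≤j)))) (≤-reflexive (cong suc (sym lay-u)))) m≤k)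
              (subst Size (cong (_+ k) (trans ls (cong suc (lay-cen l)))) (limb-size ℓ lb))
      where
      lay-u : lay (cen s) ≡ suc (suc (double j))
      lay-u = suc-injective (suc-injective (trans (cong suc (sym (lay-cen l))) (trans (sym ls) lb)))

  no-two-long : ∀ {z w₁ w₂ k₁ k₂} → Child B z w₁ → Child B z w₂ → w₁ ≢ w₂ → Limb B w₁ k₁ → Limb B w₂ k₂ →
                Size (2 + k₁) → Size (2 + k₂) → m ≤ 2 + k₁ → ¬ m ≤ 2 + k₂
  no-two-long {z} {w₁} {w₂} {k₁} {k₂} c₁@(B₁ , z~x₁ , e₁) c₂@(B₂ , z~x₂ , e₂) ne ℓ₁ ℓ₂ S₁ S₂ m≤₁ m≤₂ =
    proj₂ (sum-free S₁ S₂ m≤₁ m≤₂) (Size-bone (s≤s (≤-trans (s≤s z≤n) (m≤n+m _ k₁)))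
      (join (grow (par~ B₁) (far-tail ℓ₁ (≤-reflexive (sym (lay-par B₁)))) (limb-broom ℓ₁))
            (grow z~x₂ (far-lay (≤-reflexive (sym e₂)) ∷ far-tail ℓ₂ (z< e₂))
              (grow (par~ B₂) (far-tail ℓ₂ (≤-reflexive (sym (lay-par B₂)))) (limb-broom ℓ₂)))
            (~-sym z~x₁)
            (All.tabulate λ
              { (here refl) → far-lay′ (≤-reflexive (sym e₁)) ∷ Far-sym (par-far-child B₂ B₁ (ne ∘ sym) (sym e)) ∷ All.tabulate (sep (here refl))
              ; (there x∈) → Far-sym (All.lookup (far-tail ℓ₁ (z< e₁)) x∈)
                           ∷ Far-sym (All.lookup (far-tail ℓ₁ (≤-reflexive (trans (sym (lay-par B₂)) (sym e)))) x∈)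
                           ∷ All.tabulate (sep (there x∈)) })
            (par-far B₁ B₂ ne e ∷ par-far-child B₁ B₂ ne e ∷ far-tail ℓ₂ (≤-reflexive (trans (sym (lay-par B₁)) e)))))
    where
    e : lay w₁ ≡ lay w₂
    e = trans e₁ (sym e₂)
    sep = apart ne e ℓ₁ ℓ₂
    z< : ∀ {w} → lay w ≡ suc (suc (lay z)) → lay z < lay w
    z< e = ≤-trans (n≤1+n _) (≤-reflexive (sym e))

  child? : ∀ b → Decidable (Child B b)
  child? b w = B? w ×-dec ((b ~? par w) ×-dec (lay w ≟ suc (suc (lay b))))

  Tall : ℕ → Fin N → Set
  Tall zero    b = ⊤
  Tall (suc h) b = ∃[ w ] (Child B b w × Tall h w)

  tall? : ∀ h → Decidable (Tall h)
  tall? zero    b = yes tt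
  tall? (suc h) b = Finₚ.any? (λ w → child? b w ×-dec tall? h w)

  tall⇒limb : ∀ h {b} → B b → Tall h b → ∃[ k ] (Limb B b k × suc (double h) ≤ k)
  tall⇒limb zero Bb _ with limb Bb
  ... | k , ℓ = k , ℓ , broom-length (limb-broom ℓ)
  tall⇒limb (suc h) Bb (w , c , t) with tall⇒limb h (proj₁ c) t
  ... | k , ℓ , le = suc (suc k) , next Bb c ℓ , s≤s (s≤s le)

  short⇒¬tall : ∀ {b} → B b → Short b → ¬ Tall (suc r) b
  short⇒¬tall Bb short t with tall⇒limb (suc r) Bb t
  ... | k , ℓ , le = <-irrefl refl (<-≤-trans (short ℓ) le)

  children≤ : ∀ {z e} → z ~ e → (∀ {w} → Child B z w → Far e (par w)) → # (child? z) ≤ x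
  children≤ {z} {e} z~e far = s≤s⁻¹ (begin
    1 + # (child? z)                   ≤⟨ +-mono-≤ (#-pos (Finₚ._≟ e) {e} refl) (#-inj (child? z) pars? par
                                            (λ w c → w , c , refl) (λ w w′ c c′ → par-injective (proj₁ c) (proj₁ c′))) ⟩
    # (Finₚ._≟ e) + # pars?            ≤⟨ #-⊎ (Finₚ._≟ e) pars? star? (λ _ → inj₁) (λ _ → inj₂)
                                            (λ { t refl (w , c , e′) → proj₁ (far c) (sym e′) }) ⟩
    # star?                            ≤⟨ star≤ star? z adjacent indep ⟩
    2 + y                              ∎)
    where
    open ≤-Reasoning
    Pars : Fin N → Set
    Pars t = ∃[ w ] (Child B z w × par w ≡ t)
    pars? : Decidable Pars
    pars? t = Finₚ.any? (λ w → child? z w ×-dec (par w Finₚ.≟ t))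
    star? : Decidable (λ t → t ≡ e ⊎ Pars t)
    star? t = (t Finₚ.≟ e) ⊎-dec pars? t
    adjacent : ∀ {t} → t ≡ e ⊎ Pars t → z ~ t
    adjacent (inj₁ refl) = z~e
    adjacent (inj₂ (w , c , refl)) = proj₁ (proj₂ c)
    indep : ∀ {s t} → s ≡ e ⊎ Pars s → t ≡ e ⊎ Pars t → s ≢ t → s ≁ t
    indep (inj₁ refl) (inj₁ refl) ne = contradiction refl ne
    indep (inj₁ refl) (inj₂ (w , c , refl)) ne = proj₂ (far c)
    indep (inj₂ (w , c , refl)) (inj₁ refl) ne = ≁-sym (proj₂ (far c))
    indep (inj₂ (w , (Bw , _ , e) , refl)) (inj₂ (w′ , (Bw′ , _ , e′) , refl)) ne =
      proj₂ (par-far Bw Bw′ (λ { refl → ne refl }) (trans e (sym e′)))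

  children≤-B : ∀ {b} → B b → # (child? b) ≤ x
  children≤-B Bb = children≤ (~-sym (par~ Bb))
    (λ c → far-lay (≤-reflexive (trans (cong suc (sym (lay-par Bb))) (sym (proj₂ (proj₂ (child-par {B} c)))))))

  children≤-root : # (child? root) ≤ x
  children≤-root = children≤ root~v₁ far
    where
    far : ∀ {w} → Child B root w → Far v₁ (par w)
    far {w} c@(Bw , root~x , e) =
        (λ v₁≡x → lay≢ {root} {w} (≤-trans (n≤1+n _) (≤-reflexive (sym e)))
          (sym (pendant₁ (subst (_~ w) (sym v₁≡x) (par~ Bw)))))
      , ¬true⇒false (λ v₁~x → ~⇒≢ root~x (sym (pendant₁ v₁~x)))

  sum-children : ∀ z {g : Fin N → ℕ} {s} → (∀ {w} → Child B z w → g w ≤ s) →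
                 sum (λ w → 𝟙 (child? z w) * g w) ≤ s * # (child? z)
  sum-children z {g} {s} h = ≤-trans (sum-mono pointwise) (≤-reflexive (sum-*ˡ s (λ w → 𝟙 (child? z w))))
    where
    pointwise : ∀ w → 𝟙 (child? z w) * g w ≤ s * 𝟙 (child? z w)
    pointwise w = bound (child? z w)
      where
      bound : (d : Dec (Child B z w)) → 𝟙 d * g w ≤ s * 𝟙 d
      bound (no _)  = z≤n
      bound (yes c) = ≤-trans (≤-reflexive (+-identityʳ _)) (≤-trans (h c) (≤-reflexive (sym (*-identityʳ s))))

  heavies : ℕ → Fin N → ℕ
  heavies zero    b = 0
  heavies (suc f) b = 𝟙 (heavy? b) + sum (λ w → 𝟙 (child? b w) * heavies f w)

  ¬tall-heavies : ∀ h f {b} → B b → ¬ Tall h b → heavies f b ≤ σ h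
  ¬tall-heavies h       zero    Bb ¬t = z≤n
  ¬tall-heavies zero    (suc f) Bb ¬t = contradiction tt ¬t
  ¬tall-heavies (suc h) (suc f) {b} Bb ¬t = +-mono-≤ (𝟙≤1 (heavy? b))
    (≤-trans (sum-children b (λ {w} c → ¬tall-heavies h f (proj₁ c) (λ t → ¬t (w , c , t))))
      (≤-trans (*-monoʳ-≤ (σ h) (children≤-B Bb)) (≤-reflexive (*-comm (σ h) x))))

  heavy-two : ∀ {b} → Heavy b → Two (Top b) ⊎ Two (Bottom b)
  heavy-two {b} (_ , 3≤) with 2 ≤? # (top? b)
  ... | yes h = inj₁ (#-Two (top? b) h)
  ... | no ¬h = inj₂ (#-Two (bottom? b) (+-cancelˡ-≤ 1 _ _ (≤-trans 3≤ (+-monoˡ-≤ _ (s≤s⁻¹ (≰⇒> ¬h))))))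

  single-child : ∀ f {b s} → ¬ Two (Child B b) → (∀ {w} → Child B b w → heavies f w ≤ s) →
                 sum (λ w → 𝟙 (child? b w) * heavies f w) ≤ s
  single-child f {b} {s} ¬two h = ≤-trans (sum-children b h)
    (≤-trans (*-monoʳ-≤ s (¬Two⇒#≤1 (child? b) ¬two)) (≤-reflexive (*-identityʳ s)))

  lay-child : ∀ {b w j} → lay b ≡ double j → Child B b w → lay w ≡ double (suc j)
  lay-child lb (_ , _ , e) = trans e (cong (2 +_) lb)

  far-heavies : ∀ f {b j} → B b → lay b ≡ double j → suc (suc r) ≤ j → heavies f b ≤ σ (suc r)
  far-heavies zero    Bb lb le = z≤n
  far-heavies (suc f) {b} {j} Bb lb le = cases (heavy? b) (two? (child? b))
    where
    cases : Dec (Heavy b) → Dec (Two (Child B b)) → heavies (suc f) b ≤ σ (suc r)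
    cases (yes hv) _ = ¬tall-heavies (suc r) (suc f) Bb (short⇒¬tall Bb
      (λ ℓ → [ (λ t → two-top-short lb le t ℓ) , (λ t → branching-short lb (≤-trans (n≤1+n _) le) (inj₁ t) ℓ) ]′ (heavy-two hv)))
    cases (no _) (yes two) = ¬tall-heavies (suc r) (suc f) Bb
      (short⇒¬tall Bb (branching-short lb (≤-trans (n≤1+n _) le) (inj₂ two)))
    cases (no ¬hv) (no ¬two) = ≤-trans
      (≤-reflexive (cong (_+ sum (λ w → 𝟙 (child? b w) * heavies f w)) (𝟙-no (heavy? b) ¬hv)))
      (single-child f ¬two (λ c → far-heavies f (proj₁ c) (lay-child lb c) (≤-trans le (n≤1+n j))))

  border-heavies : ∀ f {b} → B b → lay b ≡ double (suc r) → heavies f b ≤ border r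
  border-heavies zero    Bb lb = z≤n
  border-heavies (suc f) {b} Bb lb with two? (bottom? b) | two? (child? b)
  ... | yes two | _ = ≤-trans (¬tall-heavies (suc r) (suc f) Bb (short⇒¬tall Bb (branching-short lb ≤-refl (inj₁ two))))
          (m≤n+m _ (r ⊓ 1))
  ... | no _ | yes two = ≤-trans (¬tall-heavies (suc r) (suc f) Bb (short⇒¬tall Bb (branching-short lb ≤-refl (inj₂ two))))
          (m≤n+m _ (r ⊓ 1))
  ... | no ¬bot | no ¬two = +-mono-≤ (top-heavy (heavy? b))
          (single-child f ¬two (λ c → far-heavies f (proj₁ c) (lay-child lb c) ≤-refl))
    where
    1≤r : ∀ r → 4 ≤ double (suc r) → 1 ≤ r ⊓ 1
    1≤r zero    (s≤s (s≤s ()))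
    1≤r (suc r) _ = s≤s z≤n
    top-heavy : (d : Dec (Heavy b)) → 𝟙 d ≤ r ⊓ 1
    top-heavy (no _)   = z≤n
    top-heavy (yes hv) = [ (λ t → 1≤r r (≤-trans (proj₁ (two-top Bb t)) (≤-reflexive lb))) , (λ t → contradiction t ¬bot) ]′ (heavy-two hv)

  -- At most one child starts a long limb; the others have few heavy descendants.
  fork : ∀ z f {T} → σ (suc r) ≤ T → # (child? z) ≤ x →
         (∀ {w w′ k} → Child B z w → Child B z w′ → w′ ≢ w → Limb B w k → Size (2 + k)) →
         (∀ {w} → Child B z w → heavies f w ≤ T) →
         suc (sum (λ w → 𝟙 (child? z w) * heavies f w)) ≤ x ^ r + T
  fork z f {T} σ≤T ch≤ size h with Finₚ.any? (λ w → child? z w ×-dec tall? r w)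
  ... | no none = begin
    suc (sum (λ w → 𝟙 (child? z w) * heavies f w))
      ≤⟨ s≤s (sum-children z (λ {w} c → ¬tall-heavies r f (proj₁ c) (λ t → none (w , c , t)))) ⟩
    suc (σ r * # (child? z))   ≤⟨ s≤s (*-monoʳ-≤ (σ r) ch≤) ⟩
    suc (σ r * x)              ≡⟨ cong suc (*-comm (σ r) x) ⟩
    σ (suc r)                  ≤⟨ σ≤T ⟩
    T                          ≤⟨ m≤n+m T (x ^ r) ⟩
    x ^ r + T                  ∎
    where open ≤-Reasoning
  ... | yes (w₀ , c₀ , t₀) = begin
    suc (sum (λ w → 𝟙 (child? z w) * heavies f w))
      ≤⟨ s≤s (sum-mono (λ w → pointwise w (child? z w) (w Finₚ.≟ w₀))) ⟩
    suc (sum (λ w → T * 𝟙 (w Finₚ.≟ w₀) + σ r * 𝟙 ((child? z ∖ w₀) w)))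
      ≡⟨ cong suc (trans (∑-distrib-+ (λ w → T * 𝟙 (w Finₚ.≟ w₀)) (λ w → σ r * 𝟙 ((child? z ∖ w₀) w)))
           (cong₂ _+_ (sum-*ˡ T (λ w → 𝟙 (w Finₚ.≟ w₀))) (sum-*ˡ (σ r) (𝟙 ∘ (child? z ∖ w₀))))) ⟩
    suc (T * # (Finₚ._≟ w₀) + σ r * # (child? z ∖ w₀))
      ≤⟨ s≤s (+-mono-≤ (*-monoʳ-≤ T (#≤1 (Finₚ._≟ w₀) (λ i j e e′ → trans e (sym e′))))
                       (*-monoʳ-≤ (σ r) (s≤s⁻¹ (≤-trans (≤-reflexive (sym (#-remove (child? z) c₀))) ch≤)))) ⟩
    suc (T * 1 + σ r * y)
      ≡⟨ solve 3 (λ t s y → con 1 :+ (t :* con 1 :+ s :* y) := (con 1 :+ y :* s) :+ t) refl T (σ r) y ⟩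
    suc (y * σ r) + T
      ≡⟨ cong (_+ T) (σ-closed r) ⟩
    x ^ r + T ∎
    where
    open ≤-Reasoning
    open +-*-Solver
    ¬tall : ∀ {w} → Child B z w → w ≢ w₀ → ¬ Tall r w
    ¬tall c ne t with tall⇒limb r (proj₁ c) t | tall⇒limb r (proj₁ c₀) t₀
    ... | k , ℓ , le | k₀ , ℓ₀ , le₀ = no-two-long c c₀ ne ℓ ℓ₀ (size c c₀ (ne ∘ sym) ℓ) (size c₀ c ne ℓ₀) (s≤s (s≤s le)) (s≤s (s≤s le₀))
    pointwise : ∀ w (d : Dec (Child B z w)) (e : Dec (w ≡ w₀)) →
                𝟙 d * heavies f w ≤ T * 𝟙 e + σ r * 𝟙 (d ×-dec ¬? e)
    pointwise w (no _)  e = z≤n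
    pointwise w (yes c) (yes _) = ≤-trans (≤-reflexive (+-identityʳ _))
      (≤-trans (h c) (≤-trans (≤-reflexive (sym (*-identityʳ T))) (m≤m+n _ _)))
    pointwise w (yes c) (no ne) = ≤-trans (≤-reflexive (+-identityʳ _))
      (≤-trans (¬tall-heavies r f (proj₁ c) (¬tall c ne)) (≤-trans (≤-reflexive (sym (*-identityʳ (σ r)))) (m≤n+m _ (T * 0))))

  Size-child : ∀ {b w w′ k} → B b → Child B b w → Child B b w′ → w′ ≢ w → Limb B w k → Size (2 + k)
  Size-child {b} {w} {w′} Bb c@(Bw , _ , e) c′@(Bw′ , b~x′ , e′) ne ℓ = Size-bone (s≤s (s≤s z≤n))
    (bone (limb-broom (next Bb c ℓ)) (~-sym (par~ Bb)) b~x′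
      (far-lay (≤-reflexive (trans (cong suc (sym (lay-par Bb))) (sym lx′))))
      (par-far-limb (next Bb c ℓ))
      (par-far Bw′ Bw ne w≡ ∷ par-far-child Bw′ Bw ne w≡ ∷ far-tail ℓ (≤-reflexive (trans (cong suc lx′) (sym e)))))
    where
    w≡ : lay w′ ≡ lay w
    w≡ = trans e′ (sym e)
    lx′ : lay (par w′) ≡ suc (lay b)
    lx′ = proj₂ (proj₂ (child-par {B} c′))

  Size-child-root : ∀ {w k} → Child B root w → Limb B w k → Size (2 + k)
  Size-child-root {w} {k} (Bw , _ , e) ℓ = subst (λ l → Size (l + k)) (trans e (cong (2 +_) lay-root)) (limb-size ℓ e)

  near-heavies : ∀ f i {b j} → B b → lay b ≡ double j → j + i ≡ suc r → heavies f b ≤ i * x ^ r + border r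
  near-heavies f zero {j = j} Bb lb e = border-heavies f Bb (trans lb (cong double (trans (sym (+-identityʳ j)) e)))
  near-heavies zero    (suc i) Bb lb e = z≤n
  near-heavies (suc f) (suc i) {b} {j} Bb lb e = begin
    𝟙 (heavy? b) + sum (λ w → 𝟙 (child? b w) * heavies f w)
      ≤⟨ +-monoˡ-≤ _ (𝟙≤1 (heavy? b)) ⟩
    suc (sum (λ w → 𝟙 (child? b w) * heavies f w))
      ≤⟨ fork b f (≤-trans (m≤n+m _ (r ⊓ 1)) (m≤n+m _ (i * x ^ r))) (children≤-B Bb) (Size-child Bb)
           (λ c → near-heavies f i (proj₁ c) (lay-child lb c) (trans (sym (+-suc j i)) e)) ⟩
    x ^ r + (i * x ^ r + border r)
      ≡⟨ sym (+-assoc (x ^ r) (i * x ^ r) (border r)) ⟩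
    suc i * x ^ r + border r ∎
    where open ≤-Reasoning

  AtLevel : ℕ → Fin N → Set
  AtLevel j b = B b × lay b ≡ double j

  atLevel? : ∀ j → Decidable (AtLevel j)
  atLevel? j b = B? b ×-dec (lay b ≟ double j)

  heavy≥? : ∀ j → Decidable (λ b → Heavy b × double j ≤ lay b)
  heavy≥? j b = heavy? b ×-dec (double j ≤? lay b)

  heavies-below : ∀ f j → (∀ v → lay v < double (j + f)) →
                  # (heavy≥? (suc j)) ≤ sum (λ b → 𝟙 (atLevel? (suc j) b) * heavies f b)
  heavies-below zero j bound = ≤-trans (≤-reflexive (#-none (heavy≥? (suc j)) (λ b (_ , le) →
    <-irrefl refl (<-≤-trans (bound b) (≤-trans (double-mono (≤-trans (≤-reflexive (+-identityʳ j)) (n≤1+n j))) le))))) z≤n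
  heavies-below (suc f) j bound = begin
    # (heavy≥? (suc j))
      ≤⟨ #-∪ here? (heavy≥? (suc (suc j))) (heavy≥? (suc j)) split ⟩
    # here? + # (heavy≥? (suc (suc j)))
      ≤⟨ +-monoʳ-≤ (# here?) (heavies-below f (suc j) (subst (λ k → ∀ v → lay v < double k) (+-suc j f) bound)) ⟩
    # here? + sum (λ w → 𝟙 (atLevel? (suc (suc j)) w) * heavies f w)
      ≤⟨ +-monoʳ-≤ (# here?) (≤-trans (sum-mono to-parent) (≤-reflexive (∑-comm (λ w b → at b * (𝟙 (child? b w) * heavies f w))))) ⟩
    # here? + sum (λ b → sum (λ w → at b * (𝟙 (child? b w) * heavies f w)))
      ≡⟨ cong (# here? +_) (sum-cong-≗ (λ b → sum-*ˡ (at b) (λ w → 𝟙 (child? b w) * heavies f w))) ⟩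
    # here? + sum (λ b → at b * sum (λ w → 𝟙 (child? b w) * heavies f w))
      ≤⟨ +-monoˡ-≤ _ (sum-mono (λ b → here-term b (atLevel? (suc j) b) (heavy? b))) ⟩
    sum (λ b → at b * 𝟙 (heavy? b)) + sum (λ b → at b * sum (λ w → 𝟙 (child? b w) * heavies f w))
      ≡⟨ sym (∑-distrib-+ (λ b → at b * 𝟙 (heavy? b)) (λ b → at b * sum (λ w → 𝟙 (child? b w) * heavies f w))) ⟩
    sum (λ b → at b * 𝟙 (heavy? b) + at b * sum (λ w → 𝟙 (child? b w) * heavies f w))
      ≡⟨ sum-cong-≗ (λ b → sym (*-distribˡ-+ (at b) (𝟙 (heavy? b)) _)) ⟩
    sum (λ b → at b * heavies (suc f) b) ∎
    where
    open ≤-Reasoning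
    at : Fin N → ℕ
    at b = 𝟙 (atLevel? (suc j) b)
    here? : Decidable (λ b → Heavy b × lay b ≡ double (suc j))
    here? b = heavy? b ×-dec (lay b ≟ double (suc j))
    split : ∀ b → Heavy b × double (suc j) ≤ lay b →
            (Heavy b × lay b ≡ double (suc j)) ⊎ (Heavy b × double (suc (suc j)) ≤ lay b)
    split b (hv , le) with lay b ≟ double (suc j)
    ... | yes e = inj₁ (hv , e)
    ... | no ne = inj₂ (hv , ≤∧≢⇒< (≤∧≢⇒< le (ne ∘ sym)) λ e → true≢false
            (trans (cong odd (sym e)) (cong not (odd-double (suc j)))) (B-even (proj₁ hv)))
    here-term : ∀ b (d : Dec (AtLevel (suc j) b)) (e : Dec (Heavy b)) →
                𝟙 (e ×-dec (lay b ≟ double (suc j))) ≤ 𝟙 d * 𝟙 e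
    here-term b d       (no _)   = z≤n
    here-term b (yes _) (yes _)  = 𝟙≤1 (lay b ≟ double (suc j))
    here-term b (no ¬d) (yes hv) = ≤-reflexive (𝟙-no (lay b ≟ double (suc j)) (λ e → ¬d (proj₁ hv , e)))
    to-parent : ∀ w → 𝟙 (atLevel? (suc (suc j)) w) * heavies f w ≤
                      sum (λ b → at b * (𝟙 (child? b w) * heavies f w))
    to-parent w = bound′ (atLevel? (suc (suc j)) w)
      where
      bound′ : (d : Dec (AtLevel (suc (suc j)) w)) →
               𝟙 d * heavies f w ≤ sum (λ b → at b * (𝟙 (child? b w) * heavies f w))
      bound′ (no _) = z≤n
      bound′ (yes (Bw , lw)) with dominated Bw (≤-trans (s≤s (s≤s (s≤s z≤n))) (≤-reflexive (sym lw)))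
      ... | b , Bb , c = ≤-trans (≤-reflexive (trans (+-identityʳ _)
                (sym (trans (cong₂ (λ a k → a * (k * heavies f w)) (𝟙-yes (atLevel? (suc j) b) (Bb , lb)) (𝟙-yes (child? b w) c))
                  (trans (+-identityʳ _) (+-identityʳ _))))))
              (term≤sum (λ b → at b * (𝟙 (child? b w) * heavies f w)) b)
        where
        lb : lay b ≡ double (suc j)
        lb = suc-injective (suc-injective (trans (sym (proj₂ (proj₂ c))) lw))

  heavy-bound : 1 + # heavy? ≤ total r
  heavy-bound = begin
    1 + # heavy?
      ≤⟨ s≤s (#-⊆ heavy? (heavy≥? 1) (λ b hv → hv , low (proj₁ hv))) ⟩
    1 + # (heavy≥? 1)
      ≤⟨ s≤s (heavies-below f 0 (λ v → ≤-<-trans (term≤sum lay v) (n<double (sum lay)))) ⟩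
    1 + sum (λ w → 𝟙 (atLevel? 1 w) * heavies f w)
      ≤⟨ s≤s (sum-mono (λ w → *-monoˡ-≤ (heavies f w) (𝟙-mono (atLevel? 1 w) (child? root w) (root-child w)))) ⟩
    1 + sum (λ w → 𝟙 (child? root w) * heavies f w)
      ≤⟨ fork root f (≤-trans (m≤n+m _ (r ⊓ 1)) (m≤n+m _ (r * x ^ r))) children≤-root (λ c _ _ → Size-child-root c)
           (λ c → near-heavies f r (proj₁ c) (trans (proj₂ (proj₂ c)) (cong (2 +_) lay-root)) refl) ⟩
    x ^ r + (r * x ^ r + border r) ∎
    where
    open ≤-Reasoning
    f : ℕ
    f = suc (sum lay)
    n<double : ∀ n → n < double (suc n)
    n<double zero    = s≤s z≤n
    n<double (suc n) = s≤s (≤-trans (n<double n) (n≤1+n _))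
    root-child : ∀ w → AtLevel 1 w → Child B root w
    root-child w (Bw , e) = Bw , root~par , trans e (cong (2 +_) (sym lay-root))
      where
      lx : lay (par w) ≡ 1
      lx = suc-injective (trans (sym (lay-par Bw)) e)
      root~par : root ~ par w
      root~par with parent lx
      ... | p , p~x , lp = subst (_~ par w) (lay-zero lp p~x) p~x

-- Restriction to a set of vertices

module Restrict {N : ℕ} (G : Graph N) {R : Fin N → Set} (R? : Decidable R) where
  private
    inR : Fin N → Bool
    inR v = does (R? v)

  restrict : Graph N
  restrict = record
    { adj    = λ u v → adj G u v ∧ (inR u ∧ inR v)
    ; sym    = λ u v → cong₂ _∧_ (adj-sym G u v) (Boolₚ.∧-comm (inR u) (inR v))
    ; irrefl = λ v → cong (_∧ (inR v ∧ inR v)) (adj-irrefl G v)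
    }

  private
    module A = Adjacency G
    module A′ = Adjacency restrict

    does⇒ : ∀ {v} → inR v ≡ true → R v
    does⇒ {v} e with R? v
    ... | yes Rv = Rv

  ~⇒ : ∀ {u v} → u A′.~ v → u A.~ v × (R u × R v)
  ~⇒ {u} {v} e with ∧-split (adj G u v) e
  ... | u~v , e′ with ∧-split (inR u) e′
  ...   | ru , rv = u~v , does⇒ ru , does⇒ rv

  ~⇐ : ∀ {u v} → u A.~ v → R u → R v → u A′.~ v
  ~⇐ {u} {v} u~v Ru Rv = ∧-in u~v (∧-in (dec-true (R? u) Ru) (dec-true (R? v) Rv))

  ≁⇒ : ∀ {u v} → R u → R v → u A′.≁ v → u A.≁ v
  ≁⇒ Ru Rv e = ¬true⇒false (λ u~v → true≢false (~⇐ u~v Ru Rv) e)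

  Far⇒ : ∀ {u v} → R u → R v → A′.Far u v → A.Far u v
  Far⇒ Ru Rv (u≢v , e) = u≢v , ≁⇒ Ru Rv e

  Far-all⇒ : ∀ {u vs} → R u → All R vs → All (A′.Far u) vs → All (A.Far u) vs
  Far-all⇒ Ru Rvs fs = All.zipWith (λ (Rv , f) → Far⇒ Ru Rv f) (Rvs , fs)

  broom-R : ∀ {v ts k} → A′.Broom v ts k → R v × All R ts
  broom-R (A′.tip va vb _) = proj₁ (proj₂ (~⇒ va)) , proj₂ (proj₂ (~⇒ va)) ∷ proj₂ (proj₂ (~⇒ vb)) ∷ []
  broom-R (A′.grow uv _ β) = proj₁ (proj₂ (~⇒ uv)) , proj₁ (broom-R β) ∷ proj₂ (broom-R β)

  broom⇒ : ∀ {v ts k} → A′.Broom v ts k → A.Broom v ts k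
  broom⇒ (A′.tip va vb ab) = A.tip (proj₁ (~⇒ va)) (proj₁ (~⇒ vb)) (Far⇒ (proj₂ (proj₂ (~⇒ va))) (proj₂ (proj₂ (~⇒ vb))) ab)
  broom⇒ (A′.grow uv fu β) = A.grow (proj₁ (~⇒ uv)) (Far-all⇒ (proj₁ (proj₂ (~⇒ uv))) (proj₂ (broom-R β)) fu) (broom⇒ β)

  bone⇒ : ∀ {k} → A′.Bone k → A.Bone k
  bone⇒ (A′.bone β ca cb ab fa fb) = A.bone (broom⇒ β) (proj₁ (~⇒ ca)) (proj₁ (~⇒ cb)) (Far⇒ Ra Rb ab)
    (Far-all⇒ Ra (proj₂ (broom-R β)) fa) (Far-all⇒ Rb (proj₂ (broom-R β)) fb)
    where
    Ra = proj₂ (proj₂ (~⇒ ca))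
    Rb = proj₂ (proj₂ (~⇒ cb))

  matched⇒ : ∀ {M} → Matching.MatchedIn restrict R M → Matching.MatchedIn G R M
  matched⇒ ((adj , uniq) , r) = (All.map (λ { {u , v} e → proj₁ (~⇒ e) }) adj , uniq) , r

reach-trans : ∀ {N} {G : Graph N} {u v w} → Reachable G u v → Reachable G v w → Reachable G u w
reach-trans here       q = q
reach-trans (step e p) q = step e (reach-trans p q)

reach-sym : ∀ {N} {G : Graph N} {u v} → Reachable G u v → Reachable G v u
reach-sym here               = here
reach-sym {G = G} (step e p) = reach-trans (reach-sym p) (step (Adjacency.~-sym G e) here)

matched-rest : ∀ {N} {G : Graph N} (F : Frame G) {R : Fin N → Set} {R? : Decidable R} →
  Decompose.Decomposition G (Frame.layering F) R? → ∀ y r →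
  (∀ {Q : Fin N → Set} (Q? : Decidable Q) c → (∀ {i} → Q i → adj G c i ≡ true) →
     (∀ {i j} → Q i → Q j → i ≢ j → adj G i j ≡ false) → # Q? ≤ 2 + y) →
  (∀ {p q} → Frame.Size F p → Frame.Size F q → 3 + double r ≤ p → 3 + double r ≤ q →
     ¬ Frame.Size F (suc (p + q)) × ¬ Frame.Size F (pred (p + q))) →
  ∃[ M ] (Matching.MatchedIn G R M × # R? ≤ 2 * length M + (1 + y * Geometric.total y r))
matched-rest {N} {G} F {R} {R?} D y r star≤ sum-free = with-forest (Kept.forest F D)
  where
  with-forest : Kept.State F D 1 → ∃[ M ] (Matching.MatchedIn G R M × # R? ≤ 2 * length M + (1 + y * Geometric.total y r))
  with-forest S = M , matched , ≤-trans size-bound (+-monoʳ-≤ (2 * length M) (s≤s (*-monoʳ-≤ y heavy-bound)))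
    where open Spread F D S y star≤ r sum-free

module Theorem {N : ℕ} (G : Graph N) (A : ℕ → Set) (y r : ℕ) (connected : Connected G)
  (A-odd : ∀ {k} → A k → odd k ≡ true)
  (A-bone : ∀ i → 2 ≤ i → InducedCopy (boneAdj i) G → A i)
  (A-sum-free : ∀ {p q} → A p → A q → 3 + double r ≤ p → 3 + double r ≤ q → ¬ A (suc (p + q)) × ¬ A (pred (p + q)))
  (local : LocalIndepLessThan G (3 + y)) where

  private
    bound : ℕ
    bound = 1 + y * Geometric.total y r

    module FromRoot (root₀ : Fin N) where
      L₀ : Layering G root₀
      L₀ = bfs G root₀ (λ v → inj₁ (connected root₀ v))

      module L₀ = Layering L₀
      open Peeling G L₀

      module Leafy {R : Fin N → Set} (R? : Decidable R) (C : Closed R) {u V} (St : Star R u V) where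
        open Restrict G R?
        open Adjacency G
        module A′ = Adjacency restrict
        open Star St

        to-root : ∀ k {v} → R v → L₀.lay v ≡ k → Reachable restrict v root₀
        to-root zero    Rv e with Closed.base C Rv e
        ... | refl = here
        to-root (suc k) Rv e with Closed.up C Rv e
        ... | p , Rp , p~v , lp = step (~⇐ (~-sym p~v) Rv Rp) (to-root k Rp lp)

        connect : ∀ {v} → R v → Reachable restrict u v
        connect Rv = reach-trans (to-root _ u∈ refl) (reach-sym (to-root _ Rv refl))

        isolated : ∀ {v} → ¬ R v → ∀ w → v A′.≁ w
        isolated ¬Rv w = ¬true⇒false (λ e → ¬Rv (proj₁ (proj₂ (~⇒ e))))

        reached : ∀ v → Reachable restrict u v ⊎ (∀ w → v A′.≁ w)
        reached v = cases (R? v)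
          where
          cases : Dec (R v) → Reachable restrict u v ⊎ (∀ w → v A′.≁ w)
          cases (yes Rv) = inj₁ (connect Rv)
          cases (no ¬Rv) = inj₂ (isolated ¬Rv)

        frame : Frame restrict
        frame = record
          { layering  = bfs restrict u reached
          ; v₁≢v₂     = proj₁ (proj₂ (proj₂ two))
          ; root~v₁   = edge V₁
          ; root~v₂   = edge V₂
          ; pendant₁  = pend V₁
          ; pendant₂  = pend V₂
          ; Size      = A
          ; Size-odd  = A-odd
          ; Size-bone = λ {k} 2≤k B → A-bone k 2≤k (bone⇒copy (bone⇒ B))
          }
          where
          V₁ = proj₁ (proj₂ (proj₂ (proj₂ two)))
          V₂ = proj₂ (proj₂ (proj₂ (proj₂ two)))
          edge : ∀ {v} → V v → u A′.~ v
          edge Vv = ~⇐ (V~ Vv) u∈ (V⊆ Vv)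
          pend : ∀ {v w} → V v → v A′.~ w → w ≡ u
          pend Vv v~w = pendant Vv (proj₂ (proj₂ (~⇒ v~w))) (proj₁ (~⇒ v~w))

        module L′ = Layering (Frame.layering frame)

        closed : Peeling.Closed restrict (Frame.layering frame) R
        closed = record
          { up = λ Rv e → let p , p~v , lp = L′.parent e in p , proj₁ (proj₂ (~⇒ p~v)) , p~v , lp
          ; base = λ {v} Rv e → base (reach-sym (connect Rv)) e }
          where
          base : ∀ {v} → Reachable restrict v u → L′.lay v ≡ 0 → v ≡ u
          base here       e = refl
          base (step a _) e = L′.lay-zero e a

        star≤ : ∀ {Q : Fin N → Set} (Q? : Decidable Q) c → (∀ {i} → Q i → c A′.~ i) →
                (∀ {i j} → Q i → Q j → i ≢ j → i A′.≁ j) → # Q? ≤ 2 + y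
        star≤ Q? c c~ indep = s≤s⁻¹ (≰⇒> (λ le → local (# Q?) le (star Q? c (λ q → proj₁ (~⇒ (c~ q)))
          (λ q q′ ne → ≁⇒ (proj₂ (proj₂ (~⇒ (c~ q)))) (proj₂ (proj₂ (~⇒ (c~ q′)))) (indep q q′ ne)))))

        leafy-bound : Matching.MatchesAllBut G R? bound
        leafy-bound with matched-rest frame
          (Decompose.decompose restrict (Frame.layering frame) (Rooted.centre-even frame) R? closed) y r star≤ A-sum-free
        ... | M , m , h = M , matched⇒ m , h

      everything : Decidable {A = Fin N} (λ _ → ⊤)
      everything _ = yes tt

      result : Matching.MatchesAllBut G everything bound
      result = Decompose.match-pairs G L₀ (s≤s z≤n) (λ R? C St → Leafy.leafy-bound R? C St) everything (record
        { up = λ _ e → let p , p~v , lp = L₀.parent e in p , tt , p~v , lp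
        ; base = λ {v} _ e → base (connected v root₀) e })
        where
        base : ∀ {v} → Reachable G v root₀ → L₀.lay v ≡ 0 → v ≡ root₀
        base here       e = refl
        base (step a _) e = L₀.lay-zero e a

    all-size : ∀ {K} {P : Fin K → Set} (P? : Decidable P) → (∀ i → P i) → K ≤ # P?
    all-size {zero}  P? p = z≤n
    all-size {suc K} P? p = +-mono-≤ (≤-reflexive (sym (𝟙-yes (P? zero) (p zero)))) (all-size (P? ∘ suc) (p ∘ suc))

    any-root : ∀ {K} → K ≡ 0 ⊎ Fin K
    any-root {zero}  = inj₁ refl
    any-root {suc K} = inj₂ zero

  deficiency-bound : DefAtMost G bound
  deficiency-bound with any-root {N}
  ... | inj₁ N≡0 = Matching.deficiency≤ G {[]} ([] , []) (≤-trans (≤-reflexive N≡0) z≤n)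
  ... | inj₂ root₀ with FromRoot.result root₀
  ...   | M , (m , _) , h = Matching.deficiency≤ G m
            (≤-trans (all-size (FromRoot.everything root₀) (λ _ → tt)) h)

weaken-deficiency : ∀ {N} {G : Graph N} {d e} → d ≤ e → DefAtMost G d → DefAtMost G e
weaken-deficiency d≤e h M max = ≤-trans (h M max) d≤e

theorem1p4 : (m : ℕ) → 3 ≤ m → Odd m →
    (A : ℕ → Set) → (∀ p → A p → 2 ≤ p × Odd p) →
    (∀ p q → A p → A q → m ≤ p → m ≤ q → ¬ A (p + q + 1) × ¬ A (p + q ∸ 1)) →
    (n : ℕ) → 3 < n →
    {N : ℕ} (G : Graph N) → InFamily A G → LocalIndepLessThan G n →
    DefAtMost G (m * (n ∸ 3) * (n ∸ 2) ^ ((m ∸ 3) / 2) + 1)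
    × (m ≡ 3 → DefAtMost G (2 * n ∸ 5))
theorem1p4 _ (s≤s ()) (zero , refl)
theorem1p4 _ _ (suc r , refl) A A-spec A-free _ (s≤s (s≤s (s≤s (s≤s (z≤n {y′}))))) {N} G (connected , bones) local =
    weaken-deficiency {G = G} general≤ bounded
  , λ m≡3 → weaken-deficiency {G = G} (special≤ (r≡0 m≡3)) bounded
  where
  y x m : ℕ
  y = suc y′
  x = suc y
  m = suc (2 * suc r)
  m≡ : m ≡ 3 + double r
  m≡ = cong suc (2*≡double (suc r))
  A-odd : ∀ {k} → A k → odd k ≡ true
  A-odd {k} a with A-spec k a
  ... | _ , j , refl = trans (cong (not ∘ odd) (2*≡double j)) (cong not (odd-double j))
  A-sum-free : ∀ {p q} → A p → A q → 3 + double r ≤ p → 3 + double r ≤ q → ¬ A (suc (p + q)) × ¬ A (pred (p + q))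
  A-sum-free {p} {q} a b le le′ with A-free p q a b (≤-trans (≤-reflexive m≡) le) (≤-trans (≤-reflexive m≡) le′)
  ... | h , h′ = h ∘ subst A (+-comm 1 (p + q)) , h′
  open Theorem G A y r connected A-odd bones A-sum-free local
  open Geometric y
  bounded : DefAtMost G (1 + y * total r)
  bounded = deficiency-bound
  half : (m ∸ 3) / 2 ≡ r
  half = trans (cong (λ k → (k ∸ 3) / 2) m≡) (trans (cong (_/ 2) (trans (sym (2*≡double r)) (*-comm 2 r))) (m*n/n≡m r 2))
  open ≤-Reasoning
  open +-*-Solver
  general≤ : 1 + y * total r ≤ m * y * x ^ ((m ∸ 3) / 2) + 1
  general≤ = begin
    1 + y * total r                      ≤⟨ s≤s (*-monoʳ-≤ y (total-bound (s≤s z≤n) r)) ⟩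
    1 + y * ((3 + double r) * x ^ r)     ≡⟨ cong₂ (λ m k → 1 + y * (m * x ^ k)) (sym m≡) (sym half) ⟩
    1 + y * (m * x ^ ((m ∸ 3) / 2))      ≡⟨ solve 3 (λ y m p → con 1 :+ y :* (m :* p) := m :* y :* p :+ con 1)
                                              refl y m (x ^ ((m ∸ 3) / 2)) ⟩
    m * y * x ^ ((m ∸ 3) / 2) + 1        ∎
  r≡0 : m ≡ 3 → r ≡ 0
  r≡0 e = n≤0⇒n≡0 (≤-trans (m≤m+n r (r + 0)) (≤-trans (≤-reflexive (2*≡double r))
            (≤-reflexive (+-cancelˡ-≡ 3 (double r) 0 (trans (sym m≡) e)))))
  special≤ : r ≡ 0 → 1 + y * total r ≤ 2 * (4 + y′) ∸ 5
  special≤ refl = begin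
    1 + y * total 0      ≡⟨ cong (λ t → 1 + y * t) total-0 ⟩
    1 + y * 2            ≡⟨ solve 1 (λ y′ → con 1 :+ (con 1 :+ y′) :* con 2 := con 3 :+ con 2 :* y′) refl y′ ⟩
    3 + 2 * y′           ≡⟨ cong (_∸ 5) (solve 1 (λ y′ → con 8 :+ con 2 :* y′ := con 2 :* (con 4 :+ y′)) refl y′) ⟩
    2 * (4 + y′) ∸ 5     ∎
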